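{- Let $q$ be an odd prime power not in the set $\{$3, 5, 7, 9, 11, 13, 17, 19, 23, 25, 27, 29, 31, 37, 41, 43, 47, 49, 53, 59, 61, 67, 71, 73, 79, 81, 83, 89, 97, 101, 103, 109, 113, 121, 125, 127, 131, 137, 139, 149, 151, 157, 169, 173, 181, 191, 197, 199, 211, 229, 239, 241, 269, 281, 307, 311, 331, 337, 349, 361, 373, 379, 389, 409, 419, 421, 461, 463, 509, 521, 529, 569, 571, 601, 617, 631, 659, 661, 701, 761, 769, 841, 859, 881, 911, 1009, 1021, 1231, 1289, 1301, 1331, 1429, 1609, 1741, 1849, 1861, 2029, 2281, 2311, 2729, 3541$\}$. Then for every $\alpha \in \mathbb{F}_{q^2}^*$ and every $\theta \in \mathbb{F}_{q^2} \setminus \mathbb{F}_q$ there exists $x \in \mathbb{F}_q$ such that $\alpha(\theta+x)$ is $2$-primitive. In particular, for every odd prime power $q > 3541$, the extension $\mathbb{F}_{q^2}/\mathbb{F}_q$ possesses the line property for $2$-primitive elements.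
   Context: An element of $\mathbb{F}_{q^2}^*$ is $2$-primitive if its multiplicative order is $(q^2-1)/2$. The extension $\mathbb{F}_{q^2}/\mathbb{F}_q$ possesses the line property for $2$-primitive elements if for every $\alpha \in \mathbb{F}_{q^2}^*$ and every $\theta$ with $\mathbb{F}_{q^2}=\mathbb{F}_q(\theta)$, the set $\{\alpha(\theta+x): x\in\mathbb{F}_q\}$ contains a $2$-primitive element. -}

module Defs where

open import Level using (0ℓ)
open import Data.Nat using (ℕ; zero; suc; _<_; _≤_)
import Data.Nat as ℕ
open import Data.Nat.DivMod using (_/_)
open import Data.Nat.Primality using (Prime)
open import Data.Nat.Divisibility using (_∣_)
open import Data.Fin using (Fin)
open import Data.List using (List; _∷_; [])
open import Data.Product using (∃; _×_; Σ)
open import Relation.Nullary using (¬_)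
open import Relation.Binary.PropositionalEquality using (_≡_)
open import Algebra.Bundles using (CommutativeRing)
open import Algebra.Morphism.Structures using (module RingMorphisms)

OddPrimePower : ℕ → Set
OddPrimePower q = ∃ λ p → ∃ λ k → Prime p × ¬ (2 ∣ p) × 1 ≤ k × q ≡ p ℕ.^ k

record IsFiniteField (R : CommutativeRing 0ℓ 0ℓ) (n : ℕ) : Set where
  open CommutativeRing R
  field
    nontrivial : ¬ (1# ≈ 0#)
    inverse    : ∀ x → ¬ (x ≈ 0#) → ∃ λ y → x * y ≈ 1#
    enum       : Fin n → Carrier
    enum-inj   : ∀ i j → enum i ≈ enum j → i ≡ j
    enum-surj  : ∀ x → ∃ λ i → enum i ≈ x

pow : (R : CommutativeRing 0ℓ 0ℓ) → CommutativeRing.Carrier R → ℕ → CommutativeRing.Carrier R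
pow R x zero    = CommutativeRing.1# R
pow R x (suc n) = CommutativeRing._*_ R x (pow R x n)

HasOrder : (R : CommutativeRing 0ℓ 0ℓ) → CommutativeRing.Carrier R → ℕ → Set
HasOrder R x m = 0 < m × pow R x m ≈ 1# × (∀ k → 0 < k → k < m → ¬ (pow R x k ≈ 1#))
  where open CommutativeRing R

TwoPrimitive : (L : CommutativeRing 0ℓ 0ℓ) → ℕ → CommutativeRing.Carrier L → Set
TwoPrimitive L q x = HasOrder L x ((q ℕ.* q ℕ.∸ 1) / 2)

IsEmbedding : (K L : CommutativeRing 0ℓ 0ℓ) → (CommutativeRing.Carrier K → CommutativeRing.Carrier L) → Set
IsEmbedding K L ι =
  RingMorphisms.IsRingHomomorphism (CommutativeRing.rawRing K) (CommutativeRing.rawRing L) ι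

-- Line property for 2-primitive elements of the extension L/K (via ι, with |K| = q):
-- for every nonzero α and every θ generating L over K (i.e. θ ∉ ι(K), as [L:K] = 2),
-- some α(θ + x), x ∈ K, is 2-primitive.
LineProperty2 : (K L : CommutativeRing 0ℓ 0ℓ) → ℕ → (CommutativeRing.Carrier K → CommutativeRing.Carrier L) → Set
LineProperty2 K L q ι =
  ∀ (α θ : L.Carrier) → ¬ (α L.≈ L.0#) → (∀ y → ¬ (θ L.≈ ι y)) →
  ∃ λ (x : K.Carrier) → TwoPrimitive L q (α L.* (θ L.+ ι x))
  where
    module K = CommutativeRing K
    module L = CommutativeRing L

excluded : List ℕ
excluded = 3 ∷ 5 ∷ 7 ∷ 9 ∷ 11 ∷ 13 ∷ 17 ∷ 19 ∷ 23 ∷ 25 ∷ 27 ∷ 29 ∷ 31 ∷ 37 ∷ 41 ∷ 43 ∷ 47 ∷ 49 ∷ 53 ∷ 59 ∷ 61 ∷ 67 ∷ 71 ∷ 73 ∷ 79 ∷ 81 ∷ 83 ∷ 89 ∷ 97 ∷ 101 ∷ 103 ∷ 109 ∷ 113 ∷ 121 ∷ 125 ∷ 127 ∷ 131 ∷ 137 ∷ 139 ∷ 149 ∷ 151 ∷ 157 ∷ 169 ∷ 173 ∷ 181 ∷ 191 ∷ 197 ∷ 199 ∷ 211 ∷ 229 ∷ 239 ∷ 241 ∷ 269 ∷ 281 ∷ 307 ∷ 311 ∷ 331 ∷ 337 ∷ 349 ∷ 361 ∷ 373 ∷ 379 ∷ 389 ∷ 409 ∷ 419 ∷ 421 ∷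 461 ∷ 463 ∷ 509 ∷ 521 ∷ 529 ∷ 569 ∷ 571 ∷ 601 ∷ 617 ∷ 631 ∷ 659 ∷ 661 ∷ 701 ∷ 761 ∷ 769 ∷ 841 ∷ 859 ∷ 881 ∷ 911 ∷ 1009 ∷ 1021 ∷ 1231 ∷ 1289 ∷ 1301 ∷ 1331 ∷ 1429 ∷ 1609 ∷ 1741 ∷ 1849 ∷ 1861 ∷ 2029 ∷ 2281 ∷ 2311 ∷ 2729 ∷ 3541 ∷ []

{-# OPTIONS --safe #-}
-- Let n = q² − 1 and take logarithms to a generator of F_{q²}*.  Then α(θ + x) is
-- 2-primitive iff its logarithm k satisfies k ≡ 2 (mod 4) and ℓ ∤ k for every odd prime
-- ℓ ∣ n.  Indicators of such conditions are combinations of products K of the kernels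
-- κ_ℓ(k) = ℓ[ℓ ∣ k] − 1 and c₄, so everything rests on bounds for ∑_x K(log α(θ + x)).
-- A kernel of modulus D reproduces itself, ∑_{k<D} K(k)K(j + k) = D K(j), and the quotients
-- (θ + x)/(θ + y) with x ≠ y run once through F_{q²} ∖ F_q.  If K has mean zero on
-- F_{q²}* and on F_q*, the second moment of the shifted sums therefore gives
-- |∑_x K| ≤ √q K(0), without characters.  If instead the moduli divide q + 1, then K is
-- constant on the cosets of F_q*, each of which meets the line once except that of α, and
-- the sum is −K(log α) exactly.
-- The primes dividing n are split into a core and a sieved part: the number of good x is
-- at least the count for the core minus, for each sieved ℓ, a count with ℓ ∣ k under some
-- of the core conditions.  For q < 70000 the resulting criterion is evaluated; for larger
-- q the odd primes dividing n dominate 3, 5, 7, 11, … term by term, two of them form the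
-- core when there are fewer than 20, and no sieving is needed otherwise.
module Submission where

open import Level using (0ℓ)
open import Algebra.Bundles using (CommutativeRing)
open import Data.Bool using (Bool; true; false; if_then_else_; _∧_; _∨_)
open import Data.Bool.Properties using (T-≡; T-∧; T-∨)
open import Data.Nat.DivMod using (_%_; _/_; m≡m%n+[m/n]*n; m%n<n; %-distribˡ-+; %-distribˡ-*; [m+n]%n≡m%n; m∣n⇒o%n%m≡o%m; m*n/n≡m; /-monoˡ-≤)
open import Data.Nat.Divisibility using (_∣_; divides; ∣⇒≤; _∣?_; ∣m+n∣m⇒∣n; ∣m∣n⇒∣m+n; ∣-refl; _∣0; *-monoʳ-∣; ∣-trans; m∣m*n; *-monoˡ-∣; n∣m*n; n∣m⇒m%n≡0; m%n≡0⇒n∣m; *-cancelˡ-∣; 1∣_; *-cancelʳ-∣; ∣1⇒≡1)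
open import Data.Nat.Primality using (Prime; prime⇒irreducible; prime⇒nonTrivial; prime⇒nonZero; euclidsLemma; prime[2]; _Rough_; rough∧square>⇒prime; rough∧∣⇒prime; rough∧∣⇒rough; ∤⇒rough-suc; 2-rough; prime?)
open import Data.Nat.ListAction using (product)
open import Data.Fin using (Fin; zero; suc; toℕ; fromℕ<; combine; _↑ˡ_; _↑ʳ_; punchOut; inject≤; punchIn; remQuot)
open import Data.List using (List; []; _∷_; _++_; map; concatMap; foldr; length; filter; upTo)
open import Data.List.Membership.Propositional using (_∈_)
open import Data.List.Membership.Propositional.Properties using (∈-++⁺ˡ; ∈-++⁺ʳ; ∈-filter⁺; ∈-upTo⁺)
open import Data.List.Relation.Unary.Any using (here; there)
open import Data.List.Relation.Unary.All as All using (All; []; _∷_)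
open import Data.List.Relation.Unary.AllPairs as AllPairs using (AllPairs; []; _∷_)
open import Data.Product using (∃; _,_; proj₁; proj₂; _×_; ∃₂; uncurry)
open import Data.Sum as Sum using (inj₁; inj₂; _⊎_)
open import Function using (_∘_; Equivalence; id)
open import Function.Definitions using (Injective)
open import Relation.Nullary using (yes; no; contradiction; ¬_; Dec; ¬?; _×-dec_; does; _→-dec_)
open import Relation.Nullary.Decidable using (decidable-stable; map′; from-yes)
open import Data.Nat.Coprimality as Coprime using (Coprime; coprime-divisor)
import Data.Nat.Properties as ℕₚ
import Data.Integer.Properties as ℤₚ
import Data.Fin.Properties as Finₚ
import Data.List.Relation.Unary.All.Properties as Allₚ
import Data.List.Relation.Unary.AllPairs.Properties as AllPairsₚ

-- A kernel stands for the sum of a set of characters closed under inversion, and its value at 0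
-- counts them. The reproducing identity and the positivity of squares do the work of Gauss sums, so
-- that everything stays in ℤ; √q enters only as a fraction s/t with t²q ≤ s². The obstacle is the
-- number of characters. The condition ℓ ∤ k has constant term ℓ - 1 but total weight 2(ℓ - 1), so
-- each such condition doubles the error relative to the main term, and k of them ask for q to
-- exceed about 4 · 2ᵏ · √q. A sieved prime is cheaper: the count with ℓ ∣ k costs a share 1/ℓ of
-- the main term and one more copy of the core's error. With c core primes and m sieved ones, 2ᵏ is
-- thus replaced by (m + 1) · 2ᶜ / (1 - ∑ 1/ℓ). If all primes are in the core, it is enough, up to
-- the rounding of √q, that (4 · 2ᵏ)⁴ is at most a lower bound for the product of the primes, which
-- is less than q². One more prime multiplies the left side by 16 and the right side by ℓ. Hence
-- once the inequality holds for the twenty smallest odd primes, it holds for any larger number of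
-- them.

-- Periodic integer sequences and their sums over a period.

module Sums where

  open import Data.Nat as ℕ using (ℕ; zero; suc; NonZero)
  open import Data.Integer using (ℤ; +_; 0ℤ; _+_; _*_; _≤_)
  open import Data.Fin.Permutation using (Permutation; permutation)
  open import Relation.Binary.PropositionalEquality
  open import Algebra.Properties.Semiring.Sum ℤₚ.+-*-semiring public
    using (sum; sum-cong-≗; sum-permute; ∑-distrib-+; ∑-comm; *-distribˡ-sum; *-distribʳ-sum)
  open ≡-Reasoning

  -- A missed value could be punched out of the codomain, leaving an injection of `Fin (suc n)` into
  -- `Fin n`.
  injective⇒surjective : ∀ {n} (π : Fin n → Fin n) → Injective _≡_ _≡_ π → ∀ y → ∃ λ x → π x ≡ y
  injective⇒surjective {suc n} π inj y with Finₚ.any? (λ x → π x Finₚ.≟ y)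
  ... | yes p = p
  ... | no ¬p = contradiction (Finₚ.injective⇒≤ {f = λ x → punchOut (¬p ∘ (x ,_) ∘ sym)}
                                (inj ∘ Finₚ.punchOut-injective (¬p ∘ (_ ,_) ∘ sym) (¬p ∘ (_ ,_) ∘ sym)))
                              ℕₚ.1+n≰n

  sum-injective : ∀ {n} (f : Fin n → ℤ) (π : Fin n → Fin n) → Injective _≡_ _≡_ π → sum (f ∘ π) ≡ sum f
  sum-injective {n} f π inj = sym (sum-permute f perm)
    where
    π⁻¹ : Fin n → Fin n
    π⁻¹ y = proj₁ (injective⇒surjective π inj y)
    right : ∀ y → π (π⁻¹ y) ≡ y
    right y = proj₂ (injective⇒surjective π inj y)
    perm : Permutation n n
    perm = permutation π π⁻¹ right (λ x → inj (right (π x)))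

  sum-↑ : ∀ m {n} (f : Fin (m ℕ.+ n) → ℤ) → sum f ≡ sum (f ∘ (_↑ˡ n)) + sum (f ∘ (m ↑ʳ_))
  sum-↑ zero f = sym (ℤₚ.+-identityˡ _)
  sum-↑ (suc m) f = trans (cong (λ z → f zero + z) (sum-↑ m (f ∘ suc))) (sym (ℤₚ.+-assoc (f zero) _ _))

  sum-combine : ∀ m {n} (f : Fin (m ℕ.* n) → ℤ) → sum f ≡ sum (λ i → sum (λ j → f (combine {m} {n} i j)))
  sum-combine zero f = refl
  sum-combine (suc m) {n} f = trans (sum-↑ n f) (cong (λ z → sum (f ∘ (_↑ˡ m ℕ.* n)) + z) (sum-combine m (f ∘ (n ↑ʳ_))))

  sum-const : ∀ n c → sum {n} (λ _ → c) ≡ + n * c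
  sum-const zero c = sym (ℤₚ.*-zeroˡ c)
  sum-const (suc n) c = trans (cong (λ x → c + x) (sum-const n c)) (sym (ℤₚ.suc-* (+ n) c))

  sum-mono : ∀ {n} {f g : Fin n → ℤ} → (∀ i → f i ≤ g i) → sum f ≤ sum g
  sum-mono {zero} f≤g = ℤₚ.≤-refl
  sum-mono {suc n} f≤g = ℤₚ.+-mono-≤ (f≤g zero) (sum-mono (f≤g ∘ suc))

  sum-nonneg : ∀ {n} {f : Fin n → ℤ} → (∀ i → 0ℤ ≤ f i) → 0ℤ ≤ sum f
  sum-nonneg {zero} 0≤f = ℤₚ.≤-refl
  sum-nonneg {suc n} 0≤f = ℤₚ.+-mono-≤ (0≤f zero) (sum-nonneg (0≤f ∘ suc))

  sum-*ˡ : ∀ {n} c (f : Fin n → ℤ) → sum (λ i → c * f i) ≡ c * sum f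
  sum-*ˡ c f = sym (*-distribˡ-sum c f)

  sum-*ʳ : ∀ {n} (f : Fin n → ℤ) c → sum (λ i → f i * c) ≡ sum f * c
  sum-*ʳ f c = sym (*-distribʳ-sum c f)

  ∑< : ℕ → (ℕ → ℤ) → ℤ
  ∑< n f = sum {n} (f ∘ toℕ)

  ∑<-cong : ∀ n {f g : ℕ → ℤ} → (∀ k → f k ≡ g k) → ∑< n f ≡ ∑< n g
  ∑<-cong n f≗g = sum-cong-≗ (λ (i : Fin n) → f≗g (toℕ i))

  Periodic : ℕ → (ℕ → ℤ) → Set
  Periodic n f = ∀ k → f (n ℕ.+ k) ≡ f k

  periodic-* : ∀ {n f} → Periodic n f → ∀ c k → f (c ℕ.* n ℕ.+ k) ≡ f k
  periodic-* per zero k = refl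
  periodic-* {n} {f} per (suc c) k =
    trans (cong f (ℕₚ.+-assoc n (c ℕ.* n) k)) (trans (per _) (periodic-* per c k))

  periodic-∣ : ∀ {n m f} → Periodic n f → n ∣ m → Periodic m f
  periodic-∣ {n} {m} {f} per (divides c refl) k = periodic-* per c k

  periodic-% : ∀ {n f} .{{_ : NonZero n}} → Periodic n f → ∀ k → f (k % n) ≡ f k
  periodic-% {n} {f} per k = sym (trans (cong f (trans (m≡m%n+[m/n]*n k n) (ℕₚ.+-comm (k % n) _)))
                                        (periodic-* per (k / n) (k % n)))

  %≡⇒∣∸ : ∀ {n} .{{_ : NonZero n}} a b → a % n ≡ b % n → n ∣ b ℕ.∸ a
  %≡⇒∣∸ {n} a b eq = divides (b / n ℕ.∸ a / n) (begin
    b ℕ.∸ a                                              ≡⟨ cong₂ ℕ._∸_ (m≡m%n+[m/n]*n b n) (m≡m%n+[m/n]*n a n) ⟩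
    (b % n ℕ.+ b / n ℕ.* n) ℕ.∸ (a % n ℕ.+ a / n ℕ.* n)  ≡⟨ cong (λ r → (b % n ℕ.+ b / n ℕ.* n) ℕ.∸ (r ℕ.+ a / n ℕ.* n)) eq ⟩
    (b % n ℕ.+ b / n ℕ.* n) ℕ.∸ (b % n ℕ.+ a / n ℕ.* n)  ≡⟨ ℕₚ.[m+n]∸[m+o]≡n∸o (b % n) _ _ ⟩
    b / n ℕ.* n ℕ.∸ a / n ℕ.* n                          ≡⟨ ℕₚ.*-distribʳ-∸ n (b / n) (a / n) ⟨
    (b / n ℕ.∸ a / n) ℕ.* n                              ∎)

  ∣<⇒≡0 : ∀ {n d} → n ∣ d → d ℕ.< n → d ≡ 0
  ∣<⇒≡0 {n} {zero} n∣d d<n = refl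
  ∣<⇒≡0 {n} {suc d} n∣d d<n = contradiction d<n (ℕₚ.≤⇒≯ (∣⇒≤ n∣d))

  affine-injective-≤ : ∀ {n v} .{{_ : NonZero n}} → Coprime n v → ∀ u {i j} → i ℕ.≤ j → j ℕ.< n →
                       (u ℕ.+ v ℕ.* i) % n ≡ (u ℕ.+ v ℕ.* j) % n → i ≡ j
  affine-injective-≤ {n} {v} cop u {i} {j} i≤j j<n eq = ℕₚ.≤-antisym i≤j (ℕₚ.m∸n≡0⇒m≤n (∣<⇒≡0 (coprime-divisor cop
    (subst (n ∣_) (trans (ℕₚ.[m+n]∸[m+o]≡n∸o u _ _) (sym (ℕₚ.*-distribˡ-∸ v j i)))
      (%≡⇒∣∸ (u ℕ.+ v ℕ.* i) (u ℕ.+ v ℕ.* j) eq)))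
    (ℕₚ.≤-<-trans (ℕₚ.m∸n≤m j i) j<n)))

  affine-injective : ∀ {n v} .{{_ : NonZero n}} → Coprime n v → ∀ u {i j} → i ℕ.< n → j ℕ.< n →
                     (u ℕ.+ v ℕ.* i) % n ≡ (u ℕ.+ v ℕ.* j) % n → i ≡ j
  affine-injective cop u {i} {j} i<n j<n eq with ℕₚ.≤-total i j
  ... | inj₁ i≤j = affine-injective-≤ cop u i≤j j<n eq
  ... | inj₂ j≤i = sym (affine-injective-≤ cop u j≤i i<n (sym eq))

  -- Used with v = 1 for shifts, with v = `e` for sums along F_q*, and with v = `m` for the inner
  -- sum of `∑<-crt`.
  ∑<-affine : ∀ {n f} .{{_ : NonZero n}} → Periodic n f → ∀ u v → Coprime n v →
              ∑< n (λ k → f (u ℕ.+ v ℕ.* k)) ≡ ∑< n f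
  ∑<-affine {n} {f} per u v cop = trans
    (sum-cong-≗ (λ (i : Fin n) → trans (sym (periodic-% per (u ℕ.+ v ℕ.* toℕ i))) (cong f (sym (Finₚ.toℕ-fromℕ< _)))))
    (sum-injective (f ∘ toℕ) π π-inj)
    where
    π : Fin n → Fin n
    π i = fromℕ< (m%n<n (u ℕ.+ v ℕ.* toℕ i) n)
    π-inj : Injective _≡_ _≡_ π
    π-inj {i} {j} eq = Finₚ.toℕ-injective (affine-injective cop u (Finₚ.toℕ<n i) (Finₚ.toℕ<n j)
      (trans (sym (Finₚ.toℕ-fromℕ< _)) (trans (cong toℕ eq) (Finₚ.toℕ-fromℕ< _))))

  ∑<-shift : ∀ {n f} .{{_ : NonZero n}} → Periodic n f → ∀ u → ∑< n (λ k → f (u ℕ.+ k)) ≡ ∑< n f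
  ∑<-shift {n} {f} per u = trans (∑<-cong n (λ k → cong (λ z → f (u ℕ.+ z)) (sym (ℕₚ.*-identityˡ k))))
    (∑<-affine per u 1 (Coprime.sym (Coprime.1-coprimeTo n)))

  ∑<-repeat : ∀ {n f} → Periodic n f → ∀ c → ∑< (c ℕ.* n) f ≡ + c * ∑< n f
  ∑<-repeat {n} {f} per c = begin
    ∑< (c ℕ.* n) f                                        ≡⟨ sum-combine c (f ∘ toℕ) ⟩
    sum (λ i → sum (λ j → f (toℕ (combine {c} {n} i j)))) ≡⟨ sum-cong-≗ (λ i → sum-cong-≗ (λ j → cell i j)) ⟩
    sum {c} (λ _ → ∑< n f)                                ≡⟨ sum-const c _ ⟩
    + c * ∑< n f                                          ∎
    where
    cell : ∀ (i : Fin c) (j : Fin n) → f (toℕ (combine i j)) ≡ f (toℕ j)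
    cell i j = trans (cong f (trans (Finₚ.toℕ-combine i j) (cong (ℕ._+ toℕ j) (ℕₚ.*-comm n (toℕ i)))))
                     (periodic-* per (toℕ i) (toℕ j))

  -- Write k = mi + j. Then f depends on j alone, and for fixed j the index mi + j runs through all
  -- residues modulo n because m is prime to n.
  ∑<-crt : ∀ {m n f g} .{{_ : NonZero n}} → Periodic m f → Periodic n g → Coprime n m →
           ∑< (n ℕ.* m) (λ k → f k * g k) ≡ ∑< m f * ∑< n g
  ∑<-crt {m} {n} {f} {g} perf perg cop = begin
    ∑< (n ℕ.* m) (λ k → f k * g k)
      ≡⟨ sum-combine n _ ⟩
    sum (λ i → sum (λ j → f (toℕ (combine {n} {m} i j)) * g (toℕ (combine {n} {m} i j))))
      ≡⟨ sum-cong-≗ (λ i → sum-cong-≗ (λ j → cell i j)) ⟩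
    sum {n} (λ i → sum {m} (λ j → f (toℕ j) * g (toℕ j ℕ.+ m ℕ.* toℕ i)))
      ≡⟨ ∑-comm {n} {m} (λ i j → f (toℕ j) * g (toℕ j ℕ.+ m ℕ.* toℕ i)) ⟩
    sum {m} (λ j → sum {n} (λ i → f (toℕ j) * g (toℕ j ℕ.+ m ℕ.* toℕ i)))
      ≡⟨ sum-cong-≗ (λ (j : Fin m) → trans (sum-*ˡ (f (toℕ j)) (λ (i : Fin n) → g (toℕ j ℕ.+ m ℕ.* toℕ i)))
                                           (cong (f (toℕ j) *_) (∑<-affine perg (toℕ j) m cop))) ⟩
    sum {m} (λ j → f (toℕ j) * ∑< n g)
      ≡⟨ sum-*ʳ {m} (f ∘ toℕ) (∑< n g) ⟩
    ∑< m f * ∑< n g ∎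
    where
    cell : ∀ (i : Fin n) (j : Fin m) → f (toℕ (combine i j)) * g (toℕ (combine i j)) ≡ f (toℕ j) * g (toℕ j ℕ.+ m ℕ.* toℕ i)
    cell i j = cong₂ _*_
      (trans (cong f (trans (Finₚ.toℕ-combine i j) (cong (ℕ._+ toℕ j) (ℕₚ.*-comm m (toℕ i))))) (periodic-* perf (toℕ i) (toℕ j)))
      (cong g (trans (Finₚ.toℕ-combine i j) (ℕₚ.+-comm (m ℕ.* toℕ i) (toℕ j))))

-- Reproducing kernels.

module Kernels where

  open import Data.Nat as ℕ using (ℕ; suc; NonZero; z≤n; s≤s)
  open import Data.Integer using (ℤ; +_; -[1+_]; 0ℤ; 1ℤ; _+_; _*_; _-_; -_; ∣_∣)
  open import Data.Integer.Tactic.RingSolver using (solve-∀)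
  open import Relation.Binary.PropositionalEquality
  open Sums
  open ≡-Reasoning

  -- The model is the sum of a set of characters of ℤ/D that is closed under inversion, with `peak`
  -- as the number of characters. `reproducing` is then their orthogonality; closure under inversion
  -- allows j + k in place of j - k.
  record Kernel : Set where
    field
      modulus     : ℕ
      .{{nonZero}} : NonZero modulus
      fun         : ℕ → ℤ
      peak        : ℕ
      periodic    : Periodic modulus fun
      peak-0      : fun 0 ≡ + peak
      peak>0      : 0 ℕ.< peak
      bounded     : ∀ k → ∣ fun k ∣ ℕ.≤ peak
      reproducing : ∀ j → ∑< modulus (λ k → fun k * fun (j ℕ.+ k)) ≡ + modulus * fun j

  open Kernel public

  MeanZero : Kernel → Set
  MeanZero K = ∑< (modulus K) (fun K) ≡ 0ℤ

  -- When `e` is the logarithm of a generator of F_q*, this says that every character in K is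
  -- nontrivial on F_q*.
  MeanZeroAlong : ℕ → Kernel → Set
  MeanZeroAlong e K = ∑< (modulus K) (λ i → fun K (e ℕ.* i)) ≡ 0ℤ

  periodic-dilate : ∀ {n f} → Periodic n f → ∀ e → Periodic n (λ i → f (e ℕ.* i))
  periodic-dilate {n} {f} per e k = trans (cong f (ℕₚ.*-distribˡ-+ e n k)) (periodic-* per e (e ℕ.* k))

  periodic-translate : ∀ {n f} → Periodic n f → ∀ j → Periodic n (λ i → f (j ℕ.+ i))
  periodic-translate {n} {f} per j k = trans (cong f rearrange) (per (j ℕ.+ k))
    where
    rearrange : j ℕ.+ (n ℕ.+ k) ≡ n ℕ.+ (j ℕ.+ k)
    rearrange = trans (sym (ℕₚ.+-assoc j n k)) (trans (cong (ℕ._+ k) (ℕₚ.+-comm j n)) (ℕₚ.+-assoc n j k))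

  periodic-product : ∀ {n f g} → Periodic n f → Periodic n g → Periodic n (λ k → f k * g k)
  periodic-product perf perg k = cong₂ _*_ (perf k) (perg k)

  unit : Kernel
  unit = record
    { modulus = 1 ; fun = λ _ → 1ℤ ; peak = 1 ; periodic = λ _ → refl ; peak-0 = refl
    ; peak>0 = ℕₚ.≤-refl ; bounded = λ _ → ℕₚ.≤-refl ; reproducing = λ _ → refl }

  -- Since the moduli are coprime, the sum over the product modulus factors, and so the reproducing
  -- identities multiply.
  _⊗_ : (K L : Kernel) → Coprime (modulus L) (modulus K) → Kernel
  (K ⊗ L) cop = record
    { modulus = modulus L ℕ.* modulus K
    ; nonZero = ℕₚ.m*n≢0 (modulus L) (modulus K)
    ; fun = λ k → fun K k * fun L k
    ; peak = peak K ℕ.* peak L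
    ; periodic = periodic-product (periodic-* (periodic K) (modulus L))
        (λ k → trans (cong (λ z → fun L (z ℕ.+ k)) (ℕₚ.*-comm (modulus L) (modulus K))) (periodic-* (periodic L) (modulus K) k))
    ; peak-0 = trans (cong₂ _*_ (peak-0 K) (peak-0 L)) (sym (ℤₚ.pos-* (peak K) (peak L)))
    ; peak>0 = ℕₚ.*-mono-≤ (peak>0 K) (peak>0 L)
    ; bounded = λ k → subst (ℕ._≤ peak K ℕ.* peak L) (sym (ℤₚ.abs-* (fun K k) (fun L k))) (ℕₚ.*-mono-≤ (bounded K k) (bounded L k))
    ; reproducing = λ j → begin
        ∑< (modulus L ℕ.* modulus K) (λ k → (fun K k * fun L k) * (fun K (j ℕ.+ k) * fun L (j ℕ.+ k)))
          ≡⟨ ∑<-cong (modulus L ℕ.* modulus K) (λ k → swap (fun K k) (fun L k) (fun K (j ℕ.+ k)) (fun L (j ℕ.+ k))) ⟩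
        ∑< (modulus L ℕ.* modulus K) (λ k → (fun K k * fun K (j ℕ.+ k)) * (fun L k * fun L (j ℕ.+ k)))
          ≡⟨ ∑<-crt (periodic-product (periodic K) (periodic-translate (periodic K) j))
                    (periodic-product (periodic L) (periodic-translate (periodic L) j)) cop ⟩
        ∑< (modulus K) (λ k → fun K k * fun K (j ℕ.+ k)) * ∑< (modulus L) (λ k → fun L k * fun L (j ℕ.+ k))
          ≡⟨ cong₂ _*_ (reproducing K j) (reproducing L j) ⟩
        (+ modulus K * fun K j) * (+ modulus L * fun L j)
          ≡⟨ regroup (+ modulus K) (fun K j) (+ modulus L) (fun L j) ⟩
        (+ modulus L * + modulus K) * (fun K j * fun L j)
          ≡⟨ cong (_* (fun K j * fun L j)) (sym (ℤₚ.pos-* (modulus L) (modulus K))) ⟩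
        + (modulus L ℕ.* modulus K) * (fun K j * fun L j) ∎
    }
    where
    swap : ∀ a b c d → (a * b) * (c * d) ≡ (a * c) * (b * d)
    swap = solve-∀
    regroup : ∀ a b c d → (a * b) * (c * d) ≡ (c * a) * (b * d)
    regroup = solve-∀

  ⊗-meanZero : ∀ K L (cop : Coprime (modulus L) (modulus K)) → MeanZero L → MeanZero ((K ⊗ L) cop)
  ⊗-meanZero K L cop zeroL = trans (∑<-crt (periodic K) (periodic L) cop)
    (trans (cong (∑< (modulus K) (fun K) *_) zeroL) (ℤₚ.*-zeroʳ (∑< (modulus K) (fun K))))

  ⊗-along : ∀ e K L (cop : Coprime (modulus L) (modulus K)) → ∑< (modulus L ℕ.* modulus K) (λ i → fun K (e ℕ.* i) * fun L (e ℕ.* i)) ≡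
            ∑< (modulus K) (λ i → fun K (e ℕ.* i)) * ∑< (modulus L) (λ i → fun L (e ℕ.* i))
  ⊗-along e K L cop = ∑<-crt (periodic-dilate (periodic K) e) (periodic-dilate (periodic L) e) cop

  -- The sum along `e` factors as well, so one factor that is nontrivial on F_q* is enough. This is
  -- why a single prime dividing q - 1 moves a whole product of kernels to the √q side.
  ⊗-alongˡ : ∀ e K L (cop : Coprime (modulus L) (modulus K)) → MeanZeroAlong e K → MeanZeroAlong e ((K ⊗ L) cop)
  ⊗-alongˡ e K L cop zeroK = trans (⊗-along e K L cop)
    (trans (cong (_* ∑< (modulus L) (λ i → fun L (e ℕ.* i))) zeroK) (ℤₚ.*-zeroˡ (∑< (modulus L) (λ i → fun L (e ℕ.* i)))))

  ⊗-alongʳ : ∀ e K L (cop : Coprime (modulus L) (modulus K)) → MeanZeroAlong e L → MeanZeroAlong e ((K ⊗ L) cop)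
  ⊗-alongʳ e K L cop zeroL = trans (⊗-along e K L cop)
    (trans (cong (∑< (modulus K) (λ i → fun K (e ℕ.* i)) *_) zeroL) (ℤₚ.*-zeroʳ (∑< (modulus K) (λ i → fun K (e ℕ.* i)))))

  coprime-*∣ : ∀ {a b m} → Coprime a b → a ∣ m → b ∣ m → a ℕ.* b ∣ m
  coprime-*∣ {a} {b} cop (divides c refl) b∣ca =
    subst (a ℕ.* b ∣_) (ℕₚ.*-comm a c)
      (*-monoʳ-∣ a (coprime-divisor (Coprime.sym cop) (subst (b ∣_) (ℕₚ.*-comm c a) b∣ca)))

  δ : ℕ → ℕ → ℤ
  δ m k with m ∣? k
  ... | yes _ = 1ℤ
  ... | no  _ = 0ℤ

  δ-yes : ∀ {m k} → m ∣ k → δ m k ≡ 1ℤ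
  δ-yes {m} {k} m∣k with m ∣? k
  ... | yes _ = refl
  ... | no m∤k = contradiction m∣k m∤k

  δ-no : ∀ {m k} → ¬ m ∣ k → δ m k ≡ 0ℤ
  δ-no {m} {k} m∤k with m ∣? k
  ... | yes m∣k = contradiction m∣k m∤k
  ... | no _ = refl

  δ-periodic : ∀ m → Periodic m (δ m)
  δ-periodic m k with m ∣? k
  ... | yes m∣k = δ-yes (∣m∣n⇒∣m+n ∣-refl m∣k)
  ... | no m∤k = δ-no (λ m∣m+k → m∤k (∣m+n∣m⇒∣n m∣m+k ∣-refl))

  ∑<-δ : ∀ m .{{_ : NonZero m}} (f : ℕ → ℤ) → ∑< m (λ k → δ m k * f k) ≡ f 0
  ∑<-δ m@(suc m′) f = begin
    δ m 0 * f 0 + sum {m′} (λ i → δ m (suc (toℕ i)) * f (suc (toℕ i)))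
      ≡⟨ cong₂ _+_ (trans (cong (_* f 0) (δ-yes (m ∣0))) (ℤₚ.*-identityˡ (f 0))) (sum-cong-≗ off) ⟩
    f 0 + sum {m′} (λ _ → 0ℤ)
      ≡⟨ cong (λ z → f 0 + z) (trans (sum-const m′ 0ℤ) (ℤₚ.*-zeroʳ (+ m′))) ⟩
    f 0 + 0ℤ
      ≡⟨ ℤₚ.+-identityʳ (f 0) ⟩
    f 0 ∎
    where
    off : ∀ (i : Fin m′) → δ m (suc (toℕ i)) * f (suc (toℕ i)) ≡ 0ℤ
    off i = trans (cong (_* f (suc (toℕ i))) (δ-no (λ m∣ → contradiction (∣⇒≤ m∣) (ℕₚ.<⇒≱ (s≤s (Finₚ.toℕ<n i))))))
                  (ℤₚ.*-zeroˡ (f (suc (toℕ i))))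

  -- The sum of the nontrivial characters of ℤ/m; c₄ below is the sum of the two characters of order 4.
  κ : ℕ → ℕ → ℤ
  κ m k = + m * δ m k - 1ℤ

  κ-periodic : ∀ m → Periodic m (κ m)
  κ-periodic m k = cong (λ z → + m * z - 1ℤ) (δ-periodic m k)

  κ-mean : ∀ m .{{_ : NonZero m}} → ∑< m (κ m) ≡ 0ℤ
  κ-mean m = begin
    ∑< m (κ m)                                       ≡⟨ ∑<-cong m (λ k → cong (λ z → + m * z - 1ℤ) (sym (ℤₚ.*-identityʳ (δ m k)))) ⟩
    ∑< m (λ k → + m * (δ m k * 1ℤ) + - 1ℤ)           ≡⟨ ∑-distrib-+ {m} (λ i → + m * (δ m (toℕ i) * 1ℤ)) (λ _ → - 1ℤ) ⟩
    ∑< m (λ k → + m * (δ m k * 1ℤ)) + sum {m} (λ _ → - 1ℤ)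
      ≡⟨ cong₂ _+_ (trans (sum-*ˡ {m} (+ m) (λ i → δ m (toℕ i) * 1ℤ)) (cong (+ m *_) (∑<-δ m (λ _ → 1ℤ)))) (sum-const m (- 1ℤ)) ⟩
    + m * 1ℤ + + m * - 1ℤ                            ≡⟨ cancel (+ m) ⟩
    0ℤ                                               ∎
    where
    cancel : ∀ x → x * 1ℤ + x * - 1ℤ ≡ 0ℤ
    cancel = solve-∀

  κ-∣ : ∀ {m k} → m ∣ k → κ m k ≡ + m - 1ℤ
  κ-∣ {m} m∣k = cong (_- 1ℤ) (trans (cong (+ m *_) (δ-yes m∣k)) (ℤₚ.*-identityʳ (+ m)))

  κ-∤ : ∀ {m k} → ¬ m ∣ k → κ m k ≡ - 1ℤ
  κ-∤ {m} m∤k = cong (_- 1ℤ) (trans (cong (+ m *_) (δ-no m∤k)) (ℤₚ.*-zeroʳ (+ m)))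

  -- The modulus ℓ is written 2 + m, so that it is visibly nonzero and the peak ℓ - 1 is `suc m`.
  κ-kernel : ∀ m → Kernel
  κ-kernel m = record
    { modulus = 2 ℕ.+ m ; fun = κ (2 ℕ.+ m) ; peak = suc m ; periodic = κ-periodic (2 ℕ.+ m)
    ; peak-0 = κ-∣ {2 ℕ.+ m} (_ ∣0) ; peak>0 = s≤s z≤n ; bounded = bound ; reproducing = repr }
    where
    M = 2 ℕ.+ m
    bound : ∀ k → ∣ κ M k ∣ ℕ.≤ suc m
    bound k with M ∣? k
    ... | yes _ = ℕₚ.≤-reflexive (cong (λ z → ∣ z - 1ℤ ∣) (ℤₚ.*-identityʳ (+ M)))
    ... | no  _ = ℕₚ.≤-trans (ℕₚ.≤-reflexive (cong (λ z → ∣ z - 1ℤ ∣) (ℤₚ.*-zeroʳ (+ M)))) (s≤s z≤n)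
    expand : ∀ x d y → (x * d - 1ℤ) * y ≡ x * (d * y) + - 1ℤ * y
    expand = solve-∀
    collapse : ∀ x y → x * y + - 1ℤ * 0ℤ ≡ x * y
    collapse = solve-∀
    repr : ∀ j → ∑< M (λ k → κ M k * κ M (j ℕ.+ k)) ≡ + M * κ M j
    -- Only the first factor is expanded: its δ picks out the value at j, and its constant -1
    -- multiplies a full period of κ, whose sum is 0.
    repr j = begin
      ∑< M (λ k → κ M k * κ M (j ℕ.+ k))
        ≡⟨ ∑<-cong M (λ k → expand (+ M) (δ M k) (κ M (j ℕ.+ k))) ⟩
      ∑< M (λ k → + M * (δ M k * κ M (j ℕ.+ k)) + - 1ℤ * κ M (j ℕ.+ k))
        ≡⟨ ∑-distrib-+ {M} (λ i → + M * (δ M (toℕ i) * κ M (j ℕ.+ toℕ i))) (λ i → - 1ℤ * κ M (j ℕ.+ toℕ i)) ⟩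
      ∑< M (λ k → + M * (δ M k * κ M (j ℕ.+ k))) + ∑< M (λ k → - 1ℤ * κ M (j ℕ.+ k))
        ≡⟨ cong₂ _+_ (trans (sum-*ˡ {M} (+ M) (λ i → δ M (toℕ i) * κ M (j ℕ.+ toℕ i)))
                            (cong (+ M *_) (trans (∑<-δ M (λ k → κ M (j ℕ.+ k))) (cong (κ M) (ℕₚ.+-identityʳ j)))))
                     (trans (sum-*ˡ {M} (- 1ℤ) (λ i → κ M (j ℕ.+ toℕ i)))
                            (cong (- 1ℤ *_) (trans (∑<-shift (κ-periodic M) j) (κ-mean M)))) ⟩
      + M * κ M j + - 1ℤ * 0ℤ
        ≡⟨ collapse (+ M) (κ M j) ⟩
      + M * κ M j ∎

  κ-along : ∀ e m → Coprime (2 ℕ.+ m) e → MeanZeroAlong e (κ-kernel m)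
  κ-along e m cop = trans (∑<-affine (κ-periodic (2 ℕ.+ m)) 0 e cop) (κ-mean (2 ℕ.+ m))

  quartic : ℕ → ℤ
  quartic 0 = + 2
  quartic 2 = -[1+ 1 ]
  quartic _ = 0ℤ

  residue-mod-4 : ∀ k → k % 4 ≡ 0 ⊎ k % 4 ≡ 1 ⊎ k % 4 ≡ 2 ⊎ k % 4 ≡ 3
  residue-mod-4 k with k % 4 | m%n<n k 4
  ... | 0 | _ = inj₁ refl
  ... | 1 | _ = inj₂ (inj₁ refl)
  ... | 2 | _ = inj₂ (inj₂ (inj₁ refl))
  ... | 3 | _ = inj₂ (inj₂ (inj₂ refl))
  ... | suc (suc (suc (suc _))) | s≤s (s≤s (s≤s (s≤s ())))

  %4-+ : ∀ {r} j k → j % 4 ≡ r → (j ℕ.+ k) % 4 ≡ (r ℕ.+ k % 4) % 4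
  %4-+ j k refl = %-distribˡ-+ j k 4

  c₄ : ℕ → ℤ
  c₄ k = quartic (k % 4)

  c₄-kernel : Kernel
  c₄-kernel = record
    { modulus = 4 ; fun = c₄ ; peak = 2
    ; periodic = λ k → cong quartic (trans (cong (_% 4) (ℕₚ.+-comm 4 k)) ([m+n]%n≡m%n k 4))
    ; peak-0 = refl ; peak>0 = s≤s z≤n ; bounded = bound ; reproducing = repr }
    where
    bound : ∀ k → ∣ c₄ k ∣ ℕ.≤ 2
    bound k with residue-mod-4 k
    ... | inj₁ eq rewrite eq = ℕₚ.≤-refl
    ... | inj₂ (inj₁ eq) rewrite eq = z≤n
    ... | inj₂ (inj₂ (inj₁ eq)) rewrite eq = ℕₚ.≤-refl
    ... | inj₂ (inj₂ (inj₂ eq)) rewrite eq = z≤n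
    repr : ∀ j → ∑< 4 (λ k → c₄ k * c₄ (j ℕ.+ k)) ≡ + 4 * c₄ j
    repr j with residue-mod-4 j
    ... | inj₁ eq
      rewrite eq | %4-+ j 0 eq | %4-+ j 2 eq = refl
    ... | inj₂ (inj₁ eq)
      rewrite eq | %4-+ j 0 eq | %4-+ j 2 eq = refl
    ... | inj₂ (inj₂ (inj₁ eq))
      rewrite eq | %4-+ j 0 eq | %4-+ j 2 eq = refl
    ... | inj₂ (inj₂ (inj₂ eq))
      rewrite eq | %4-+ j 0 eq | %4-+ j 2 eq = refl

  c₄-mean : MeanZero c₄-kernel
  c₄-mean = refl

  %4-* : ∀ {r} e i → e % 4 ≡ r → (e ℕ.* i) % 4 ≡ (r ℕ.* (i % 4)) % 4
  %4-* e i refl = %-distribˡ-* e i 4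

  -- The multiples of `e` are alternately 0 and 2 modulo 4, where `c₄` takes the values 2 and -2.
  c₄-along : ∀ e → e % 4 ≡ 2 → MeanZeroAlong e c₄-kernel
  c₄-along e eq rewrite %4-* e 0 eq | %4-* e 1 eq | %4-* e 2 eq | %4-* e 3 eq = refl

-- Sums of a kernel over a line: the exact value and the square-root bound.

module Lines where

  open import Data.Nat as ℕ using (ℕ; suc; NonZero; z≤n)
  open import Data.Integer as ℤ using (ℤ; +_; -[1+_]; 0ℤ; _+_; _*_; _-_; -_; ∣_∣; _≤_)
  open import Data.Integer.Tactic.RingSolver using (solve-∀)
  open import Relation.Binary.PropositionalEquality
  open Sums
  open Kernels
  open ≡-Reasoning

  -- The discrete logarithms a x of the points α(θ + x) and a∞ of α, for a field with
  -- q = suc r elements; the logarithms of the elements of F_q* are the multiples of e.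
  record LineLogs (r : ℕ) : Set where
    q : ℕ
    q = suc r
    n : ℕ
    n = r ℕ.* suc q
    field
      r>0     : 0 ℕ.< r
      e       : ℕ
      q+1∣e   : suc q ∣ e
      a       : Fin q → ℕ
      a∞      : ℕ
      a≤n     : ∀ x → a x ℕ.≤ n
      cover   : ∀ f → Periodic n f →
                ∑< n f ≡ sum {r} (λ t → sum (λ x → f (e ℕ.* toℕ t ℕ.+ a x))) + ∑< r (λ i → f (e ℕ.* i ℕ.+ a∞))
      ratios  : ∀ f → Periodic n f →
                sum (λ y → sum (λ x → f (a x ℕ.+ (n ℕ.∸ a y)))) + ∑< r (λ i → f (e ℕ.* i)) ≡ + q * f 0 + ∑< n f

  ∣-∣-squared : ∀ i → + (∣ i ∣ ℕ.* ∣ i ∣) ≡ i * i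
  ∣-∣-squared (+ m) = ℤₚ.pos-* m m
  ∣-∣-squared -[1+ m ] = refl

  square-nonneg : ∀ i → 0ℤ ≤ i * i
  square-nonneg i = subst (0ℤ ≤_) (∣-∣-squared i) (ℤ.+≤+ z≤n)

  square-cancel-≤ : ∀ {m n} → m ℕ.* m ℕ.≤ n ℕ.* n → m ℕ.≤ n
  square-cancel-≤ {m} {n} m²≤n² = ℕₚ.≮⇒≥ (λ n<m → ℕₚ.<⇒≱ (ℕₚ.*-mono-< n<m n<m) m²≤n²)

  module _ {r : ℕ} (L : LineLogs r) where
    open LineLogs L

    instance
      n≢0 : NonZero n
      n≢0 = ℕₚ.m*n≢0 r (suc q) {{ℕ.>-nonZero r>0}}

    lineSum : (ℕ → ℤ) → ℤ
    lineSum f = sum (λ x → f (a x))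

    module _ (K : Kernel) (m∣n : modulus K ∣ n) (mean : MeanZero K) where
      private
        κ₀ = peak K
        T  = lineSum (fun K)
        pn : Periodic n (fun K)
        pn = periodic-∣ (periodic K) m∣n
        c  = _∣_.quotient m∣n
        eq : n ≡ c ℕ.* modulus K
        eq = _∣_.equality m∣n

      ∑<-meanZero : ∑< n (fun K) ≡ 0ℤ
      ∑<-meanZero = trans (cong (λ z → ∑< z (fun K)) eq)
        (trans (∑<-repeat (periodic K) c) (trans (cong (+ c *_) mean) (ℤₚ.*-zeroʳ (+ c))))

      -- K does not see multiples of q + 1, so the r terms over t in `cover` are equal, and the
      -- vanishing of the full sum reads r(T + K(a∞)) = 0.
      lineSum-invariant : modulus K ∣ suc q → T ≡ - fun K a∞
      lineSum-invariant m∣q+1 = isolate T (fun K a∞) (ℤₚ.*-cancelˡ-≡ (+ r) (T + fun K a∞) 0ℤ {{ℕ.>-nonZero r>0}} (begin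
        + r * (T + fun K a∞)             ≡⟨ ℤₚ.*-distribˡ-+ (+ r) T (fun K a∞) ⟩
        + r * T + + r * fun K a∞         ≡⟨ cong₂ _+_ (sum-const r T) (sum-const r (fun K a∞)) ⟨
        sum {r} (λ _ → T) + sum {r} (λ _ → fun K a∞)
          ≡⟨ cong₂ _+_ (sum-cong-≗ {r} (λ t → sum-cong-≗ {q} (λ x → inv (toℕ t) (a x)))) (sum-cong-≗ {r} (λ t → inv (toℕ t) a∞)) ⟨
        sum {r} (λ t → sum (λ x → fun K (e ℕ.* toℕ t ℕ.+ a x))) + ∑< r (λ i → fun K (e ℕ.* i ℕ.+ a∞))
          ≡⟨ cover (fun K) pn ⟨
        ∑< n (fun K)                     ≡⟨ ∑<-meanZero ⟩
        0ℤ                               ≡⟨ ℤₚ.*-zeroʳ (+ r) ⟨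
        + r * 0ℤ                         ∎))
        where
        inv : ∀ t k → fun K (e ℕ.* t ℕ.+ k) ≡ fun K k
        inv t k = periodic-∣ (periodic K) (∣-trans m∣q+1 (∣-trans q+1∣e (m∣m*n t))) k
        isolate : ∀ x y → x + y ≡ 0ℤ → x ≡ - y
        isolate x y eq = trans (shuffle x y) (trans (cong (_- y) eq) (ℤₚ.+-identityˡ (- y)))
          where
          shuffle : ∀ x y → x ≡ (x + y) - y
          shuffle = solve-∀

      ∣lineSum∣≤peak : modulus K ∣ suc q → ∣ T ∣ ℕ.≤ κ₀
      ∣lineSum∣≤peak m∣q+1 = ℕₚ.≤-trans
        (ℕₚ.≤-reflexive (trans (cong ∣_∣ (lineSum-invariant m∣q+1)) (ℤₚ.∣-i∣≡∣i∣ (fun K a∞))))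
        (bounded K a∞)

      reproducing-n : ∀ j → ∑< n (λ k → fun K k * fun K (j ℕ.+ k)) ≡ + n * fun K j
      reproducing-n j = begin
        ∑< n F                        ≡⟨ cong (λ z → ∑< z F) eq ⟩
        ∑< (c ℕ.* modulus K) F        ≡⟨ ∑<-repeat (periodic-product (periodic K) (periodic-translate (periodic K) j)) c ⟩
        + c * ∑< (modulus K) F        ≡⟨ cong (+ c *_) (reproducing K j) ⟩
        + c * (+ modulus K * fun K j) ≡⟨ ℤₚ.*-assoc (+ c) (+ modulus K) (fun K j) ⟨
        (+ c * + modulus K) * fun K j ≡⟨ cong (_* fun K j) (ℤₚ.pos-* c (modulus K)) ⟨
        + (c ℕ.* modulus K) * fun K j ≡⟨ cong (λ z → + z * fun K j) eq ⟨
        + n * fun K j                 ∎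
        where F = λ k → fun K k * fun K (j ℕ.+ k)

      private
        -- The sums of K over the lines gᵏα(θ + x), with g the base of the logarithms; T is the case
        -- k = 0.
        h : ℕ → ℤ
        h k = sum (λ x → fun K (a x ℕ.+ k))

      correlation : ∑< n (λ k → fun K k * h k) ≡ + n * T
      correlation = begin
        ∑< n (λ k → fun K k * h k)
          ≡⟨ sum-cong-≗ {n} (λ k → sum-*ˡ {q} (fun K (toℕ k)) (λ x → fun K (a x ℕ.+ toℕ k))) ⟨
        sum {n} (λ k → sum {q} (λ x → fun K (toℕ k) * fun K (a x ℕ.+ toℕ k)))
          ≡⟨ ∑-comm {n} {q} (λ k x → fun K (toℕ k) * fun K (a x ℕ.+ toℕ k)) ⟩
        sum {q} (λ x → ∑< n (λ k → fun K k * fun K (a x ℕ.+ k)))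
          ≡⟨ sum-cong-≗ {q} (λ x → reproducing-n (a x)) ⟩
        sum {q} (λ x → + n * fun K (a x))
          ≡⟨ sum-*ˡ {q} (+ n) (λ x → fun K (a x)) ⟩
        + n * T ∎

      -- Shifting the variable by -a y, which is written `n ∸ a y` in ℕ, reduces this to the
      -- reproducing identity.
      autocorrelation : ∀ x y → ∑< n (λ k → fun K (a x ℕ.+ k) * fun K (a y ℕ.+ k)) ≡ + n * fun K (a x ℕ.+ (n ℕ.∸ a y))
      autocorrelation x y = begin
        ∑< n F                                       ≡⟨ ∑<-shift perF (n ℕ.∸ a y) ⟨
        ∑< n (λ k → F ((n ℕ.∸ a y) ℕ.+ k))           ≡⟨ ∑<-cong n shifted ⟩
        ∑< n (λ k → fun K k * fun K ((a x ℕ.+ (n ℕ.∸ a y)) ℕ.+ k)) ≡⟨ reproducing-n _ ⟩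
        + n * fun K (a x ℕ.+ (n ℕ.∸ a y))            ∎
        where
        F = λ k → fun K (a x ℕ.+ k) * fun K (a y ℕ.+ k)
        perF : Periodic n F
        perF = periodic-product (periodic-translate pn (a x)) (periodic-translate pn (a y))
        shifted : ∀ k → F ((n ℕ.∸ a y) ℕ.+ k) ≡ fun K k * fun K ((a x ℕ.+ (n ℕ.∸ a y)) ℕ.+ k)
        shifted k = trans (ℤₚ.*-comm (fun K (a x ℕ.+ (n ℕ.∸ a y ℕ.+ k))) (fun K (a y ℕ.+ (n ℕ.∸ a y ℕ.+ k))))
          (cong₂ _*_
            (trans (cong (fun K) (trans (sym (ℕₚ.+-assoc (a y) (n ℕ.∸ a y) k)) (cong (ℕ._+ k) (ℕₚ.m+[n∸m]≡n (a≤n y))))) (pn k))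
            (cong (fun K) (sym (ℕₚ.+-assoc (a x) (n ℕ.∸ a y) k))))

      secondMoment : MeanZeroAlong e K → ∑< n (λ k → h k * h k) ≡ + n * (+ q * + κ₀)
      secondMoment along = begin
        ∑< n (λ k → h k * h k)
          ≡⟨ sum-cong-≗ {n} (λ k → trans (sum-cong-≗ {q} (λ y → sum-*ʳ {q} (λ x → fun K (a x ℕ.+ toℕ k)) (fun K (a y ℕ.+ toℕ k))))
                                          (sum-*ˡ {q} (h (toℕ k)) (λ y → fun K (a y ℕ.+ toℕ k)))) ⟨
        sum {n} (λ k → sum {q} (λ y → sum {q} (λ x → fun K (a x ℕ.+ toℕ k) * fun K (a y ℕ.+ toℕ k))))
          ≡⟨ ∑-comm {n} {q} (λ k y → sum {q} (λ x → fun K (a x ℕ.+ toℕ k) * fun K (a y ℕ.+ toℕ k))) ⟩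
        sum {q} (λ y → sum {n} (λ k → sum {q} (λ x → fun K (a x ℕ.+ toℕ k) * fun K (a y ℕ.+ toℕ k))))
          ≡⟨ sum-cong-≗ {q} (λ y → trans (∑-comm {n} {q} (λ k x → fun K (a x ℕ.+ toℕ k) * fun K (a y ℕ.+ toℕ k)))
                                  (trans (sum-cong-≗ {q} (λ x → autocorrelation x y)) (sum-*ˡ {q} (+ n) (λ x → fun K (a x ℕ.+ (n ℕ.∸ a y)))))) ⟩
        sum {q} (λ y → + n * sum {q} (λ x → fun K (a x ℕ.+ (n ℕ.∸ a y))))
          ≡⟨ sum-*ˡ {q} (+ n) (λ y → sum {q} (λ x → fun K (a x ℕ.+ (n ℕ.∸ a y)))) ⟩
        + n * S
          ≡⟨ cong (+ n *_) S-value ⟩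
        + n * (+ q * + κ₀) ∎
        where
        S = sum {q} (λ y → sum {q} (λ x → fun K (a x ℕ.+ (n ℕ.∸ a y))))
        -- The hypothesis sums over `modulus K` terms, `ratios` over r terms. Both lengths divide n,
        -- and both sequences are periodic, so the two sums are compared through the one with n
        -- terms.
        along-r : ∑< r (λ i → fun K (e ℕ.* i)) ≡ 0ℤ
        along-r = ℤₚ.*-cancelˡ-≡ (+ suc q) _ 0ℤ (begin
          + suc q * ∑< r g  ≡⟨ ∑<-repeat per-r (suc q) ⟨
          ∑< (suc q ℕ.* r) g ≡⟨ cong (λ z → ∑< z g) (ℕₚ.*-comm (suc q) r) ⟩
          ∑< n g            ≡⟨ full ⟩
          0ℤ                ≡⟨ ℤₚ.*-zeroʳ (+ suc q) ⟨
          + suc q * 0ℤ      ∎)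
          where
          g = λ i → fun K (e ℕ.* i)
          per-r : Periodic r g
          per-r k = trans (cong (fun K) (ℕₚ.*-distribˡ-+ e r k)) (periodic-∣ pn n∣er (e ℕ.* k))
            where
            n∣er : n ∣ e ℕ.* r
            n∣er = subst₂ _∣_ (ℕₚ.*-comm (suc q) r) refl (*-monoˡ-∣ r q+1∣e)
          full : ∑< n g ≡ 0ℤ
          full = trans (cong (λ z → ∑< z g) eq)
            (trans (∑<-repeat (periodic-dilate (periodic K) e) c) (trans (cong (+ c *_) along) (ℤₚ.*-zeroʳ (+ c))))
        S-value : S ≡ + q * + κ₀
        S-value = begin
          S                                       ≡⟨ ℤₚ.+-identityʳ S ⟨
          S + 0ℤ                                  ≡⟨ cong (λ z → S + z) along-r ⟨
          S + ∑< r (λ i → fun K (e ℕ.* i))        ≡⟨ ratios (fun K) pn ⟩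
          + q * fun K 0 + ∑< n (fun K)            ≡⟨ cong₂ _+_ (cong (+ q *_) (peak-0 K)) ∑<-meanZero ⟩
          + q * + κ₀ + 0ℤ                         ≡⟨ ℤₚ.+-identityʳ _ ⟩
          + q * + κ₀                              ∎

      -- Expanding 0 ≤ ∑ (κ₀ h(k) − T K(k))² with ∑ K h = n T and ∑ h² = n q κ₀
      -- plays the part of the evaluation of Gauss sums.
      lineSum² : MeanZeroAlong e K → ∣ T ∣ ℕ.* ∣ T ∣ ℕ.≤ q ℕ.* (κ₀ ℕ.* κ₀)
      lineSum² along = ℤₚ.drop‿+≤+ (subst₂ _≤_ (sym (∣-∣-squared T)) q-cast
        (ℤₚ.0≤i-j⇒j≤i {i = + q * (+ κ₀ * + κ₀)} {j = T * T} (ℤₚ.*-cancelˡ-≤-pos 0ℤ _ (+ (n ℕ.* κ₀)) {{ℤ.positive (ℤ.+<+ nκ₀>0)}} nonneg)))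
        where
        nκ₀>0 : 0 ℕ.< n ℕ.* κ₀
        nκ₀>0 = ℕₚ.*-mono-≤ (ℕ.>-nonZero⁻¹ n) (peak>0 K)
        q-cast : + q * (+ κ₀ * + κ₀) ≡ + (q ℕ.* (κ₀ ℕ.* κ₀))
        q-cast = sym (trans (ℤₚ.pos-* q (κ₀ ℕ.* κ₀)) (cong (+ q *_) (ℤₚ.pos-* κ₀ κ₀)))
        expand : ∀ c t H k → (c * H - t * k) * (c * H - t * k) ≡ (c * c) * (H * H) + ((- + 2 * (c * t)) * (k * H) + (t * t) * (k * k))
        expand = solve-∀
        collect : ∀ N c t Q → (c * c) * (N * (Q * c)) + ((- + 2 * (c * t)) * (N * t) + (t * t) * (N * c)) ≡ (N * c) * (Q * (c * c) - t * t)
        collect = solve-∀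
        K² : ∑< n (λ k → fun K k * fun K k) ≡ + n * + κ₀
        K² = trans (reproducing-n 0) (cong (+ n *_) (peak-0 K))
        value : ∑< n (λ k → (+ κ₀ * h k - T * fun K k) * (+ κ₀ * h k - T * fun K k)) ≡ (+ n * + κ₀) * (+ q * (+ κ₀ * + κ₀) - T * T)
        value = begin
          ∑< n (λ k → (+ κ₀ * h k - T * fun K k) * (+ κ₀ * h k - T * fun K k))
            ≡⟨ ∑<-cong n (λ k → expand (+ κ₀) T (h k) (fun K k)) ⟩
          ∑< n (λ k → A * (h k * h k) + (B * (fun K k * h k) + C * (fun K k * fun K k)))
            ≡⟨ trans (∑-distrib-+ {n} (λ k → A * (h (toℕ k) * h (toℕ k))) _)
                     (cong (λ z → ∑< n (λ k → A * (h k * h k)) + z) (∑-distrib-+ {n} (λ k → B * (fun K (toℕ k) * h (toℕ k))) _)) ⟩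
          ∑< n (λ k → A * (h k * h k)) + (∑< n (λ k → B * (fun K k * h k)) + ∑< n (λ k → C * (fun K k * fun K k)))
            ≡⟨ cong₂ _+_ (trans (sum-*ˡ {n} A _) (cong (A *_) (secondMoment along)))
                         (cong₂ _+_ (trans (sum-*ˡ {n} B _) (cong (B *_) correlation)) (trans (sum-*ˡ {n} C _) (cong (C *_) K²))) ⟩
          A * (+ n * (+ q * + κ₀)) + (B * (+ n * T) + C * (+ n * + κ₀))
            ≡⟨ collect (+ n) (+ κ₀) T (+ q) ⟩
          (+ n * + κ₀) * (+ q * (+ κ₀ * + κ₀) - T * T) ∎
          where
          A = + κ₀ * + κ₀
          B = - + 2 * (+ κ₀ * T)
          C = T * T
        nonneg : + (n ℕ.* κ₀) * 0ℤ ≤ + (n ℕ.* κ₀) * (+ q * (+ κ₀ * + κ₀) - T * T)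
        nonneg = subst₂ _≤_ (sym (ℤₚ.*-zeroʳ (+ (n ℕ.* κ₀))))
          (trans value (cong (_* (+ q * (+ κ₀ * + κ₀) - T * T)) (sym (ℤₚ.pos-* n κ₀))))
          (sum-nonneg {n} (λ k → square-nonneg (+ κ₀ * h (toℕ k) - T * fun K (toℕ k))))

      -- Here s/t is a rational upper approximation to √q.
      ∣lineSum∣≤√q : MeanZeroAlong e K → ∀ {s t} → t ℕ.* t ℕ.* q ℕ.≤ s ℕ.* s → t ℕ.* ∣ T ∣ ℕ.≤ s ℕ.* κ₀
      ∣lineSum∣≤√q along {s} {t} t²q≤s² = square-cancel-≤ (subst₂ ℕ._≤_
        (ℕₚ.[m*n]*[o*p]≡[m*o]*[n*p] t t ∣ T ∣ ∣ T ∣)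
        (ℕₚ.[m*n]*[o*p]≡[m*o]*[n*p] s s κ₀ κ₀)
        (ℕₚ.≤-trans
          (ℕₚ.≤-trans (ℕₚ.*-monoʳ-≤ (t ℕ.* t) (lineSum² along)) (ℕₚ.≤-reflexive (sym (ℕₚ.*-assoc (t ℕ.* t) q (κ₀ ℕ.* κ₀)))))
          (ℕₚ.*-monoˡ-≤ (κ₀ ℕ.* κ₀) t²q≤s²)))

-- Divisibility conditions expanded in kernels.

module Factors where

  open import Data.Nat as ℕ using (ℕ; zero; suc; z≤n; s≤s)
  open import Data.Nat.Tactic.RingSolver using () renaming (solve-∀ to solve-ℕ)
  open import Data.Integer using (ℤ; +_; 0ℤ; 1ℤ; _+_; _*_; _-_; -_; ∣_∣)
  open import Data.Integer.Tactic.RingSolver using (solve-∀)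
  open import Relation.Binary.PropositionalEquality
  open Sums
  open Kernels
  open Lines

  data Kind : Set where
    avoid hit : Kind

  -- (ℓ , avoid) stands for the condition ℓ ∤ k, and (ℓ , hit) for ℓ ∣ k.
  Factor : Set
  Factor = ℕ × Kind

  -- From ℓ[ℓ ∤ k] = (ℓ - 1) - κ and ℓ[ℓ ∣ k] = 1 + κ: `main₁` is the constant term, and `peak₁` is
  -- the sum of the absolute values of all character coefficients.
  main₁ peak₁ : Factor → ℕ
  main₁ (ℓ , avoid) = ℓ ℕ.∸ 1
  main₁ (ℓ , hit) = 1
  peak₁ (ℓ , avoid) = 2 ℕ.* (ℓ ℕ.∸ 1)
  peak₁ (ℓ , hit) = ℓ

  sign₁ : Factor → ℤ
  sign₁ (ℓ , avoid) = - 1ℤ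
  sign₁ (ℓ , hit) = 1ℤ

  -- `gap` is `peaks` minus `mainTerm`, the total weight of the nontrivial characters, in the
  -- recursive form in which the induction of `twisted-split` produces it.
  scale mainTerm peaks gap : List Factor → ℕ
  scale [] = 1
  scale (f ∷ fs) = proj₁ f ℕ.* scale fs
  mainTerm [] = 1
  mainTerm (f ∷ fs) = main₁ f ℕ.* mainTerm fs
  peaks [] = 1
  peaks (f ∷ fs) = peak₁ f ℕ.* peaks fs
  gap [] = 0
  gap (f ∷ fs) = main₁ f ℕ.* gap fs ℕ.+ (proj₁ f ℕ.∸ 1) ℕ.* peaks fs

  value : Factor → ℕ → ℤ
  value f k = + main₁ f + sign₁ f * κ (proj₁ f) k

  values : List Factor → ℕ → ℤ
  values [] k = 1ℤ
  values (f ∷ fs) k = value f k * values fs k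

  Modulus : Factor → Set
  Modulus f = 2 ℕ.≤ proj₁ f

  coprime-* : ∀ {a b c} → Coprime a b → Coprime a c → Coprime a (b ℕ.* c)
  coprime-* ab ac {d} (d∣a , d∣bc) = ac (d∣a , coprime-divisor (λ (x∣d , x∣b) → ab (∣-trans x∣d d∣a , x∣b)) d∣bc)

  _⟂_ : Factor → Factor → Set
  f ⟂ g = Coprime (proj₁ f) (proj₁ g)

  peak₁-split : ∀ f → Modulus f → main₁ f ℕ.+ (proj₁ f ℕ.∸ 1) ≡ peak₁ f
  peak₁-split (ℓ , avoid) _ = cong (ℓ ℕ.∸ 1 ℕ.+_) (sym (ℕₚ.+-identityʳ (ℓ ℕ.∸ 1)))
  peak₁-split (suc ℓ , hit) _ = refl

  peaks-++ : ∀ fs gs → peaks (fs ++ gs) ≡ peaks fs ℕ.* peaks gs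
  peaks-++ [] gs = sym (ℕₚ.+-identityʳ (peaks gs))
  peaks-++ (f ∷ fs) gs = trans (cong (peak₁ f ℕ.*_) (peaks-++ fs gs)) (sym (ℕₚ.*-assoc (peak₁ f) (peaks fs) (peaks gs)))

  Within : ℕ → ℕ → ℤ → Set
  Within t b X = t ℕ.* ∣ X ∣ ℕ.≤ b

  within-+ : ∀ {t b c X Y} → Within t b X → Within t c Y → Within t (b ℕ.+ c) (X + Y)
  within-+ {t} {b} {c} {X} {Y} p q = ℕₚ.≤-trans (ℕₚ.*-monoʳ-≤ t (ℤₚ.∣i+j∣≤∣i∣+∣j∣ X Y))
    (ℕₚ.≤-trans (ℕₚ.≤-reflexive (ℕₚ.*-distribˡ-+ t ∣ X ∣ ∣ Y ∣)) (ℕₚ.+-mono-≤ p q))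

  within-* : ∀ {t b X} c → Within t b X → Within t (∣ c ∣ ℕ.* b) (c * X)
  within-* {t} {b} {X} c p = ℕₚ.≤-trans (ℕₚ.≤-reflexive (trans (cong (t ℕ.*_) (ℤₚ.abs-* c X)) (swap t ∣ c ∣ ∣ X ∣))) (ℕₚ.*-monoʳ-≤ ∣ c ∣ p)
    where
    swap : ∀ x y z → x ℕ.* (y ℕ.* z) ≡ y ℕ.* (x ℕ.* z)
    swap = solve-ℕ

  within-sign : ∀ {t b X} f → Within t b X → Within t b (sign₁ f * X)
  within-sign {t} {b} {X} f p = subst (λ z → Within t z (sign₁ f * X)) (unit-abs f) (within-* {t} {b} {X} (sign₁ f) p)
    where
    unit-abs : ∀ f → ∣ sign₁ f ∣ ℕ.* b ≡ b
    unit-abs (ℓ , avoid) = ℕₚ.+-identityʳ b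
    unit-abs (ℓ , hit) = ℕₚ.+-identityʳ b

  module _ {r : ℕ} (L : LineLogs r) where
    open LineLogs L

    twisted : Kernel → List Factor → ℤ
    twisted K fs = lineSum L (λ k → fun K k * values fs k)

    lineSum-linear : ∀ c d f g → lineSum L (λ k → c * f k + d * g k) ≡ c * lineSum L f + d * lineSum L g
    lineSum-linear c d f g = trans (∑-distrib-+ {q} (λ x → c * f (a x)) (λ x → d * g (a x)))
      (cong₂ _+_ (sum-*ˡ {q} c (λ x → f (a x))) (sum-*ˡ {q} d (λ x → g (a x))))

    lineSum-cong : ∀ {f g} → (∀ k → f k ≡ g k) → lineSum L f ≡ lineSum L g
    lineSum-cong f≗g = sum-cong-≗ {q} (λ x → f≗g (a x))

    extend : (K : Kernel) (f : Factor) → Modulus f → Coprime (proj₁ f) (modulus K) → Kernel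
    extend K (suc (suc m) , _) _ cop = (K ⊗ κ-kernel m) cop
    extend K (suc zero , _) (s≤s ()) cop

    -- The first condition is multiplied out: its constant leaves K as it is, and its κ is absorbed
    -- into the kernel.
    twisted-∷ : ∀ K f fs (ℓ≥2 : Modulus f) (cop : Coprime (proj₁ f) (modulus K)) →
                twisted K (f ∷ fs) ≡ + main₁ f * twisted K fs + sign₁ f * twisted (extend K f ℓ≥2 cop) fs
    twisted-∷ K f@(suc (suc m) , _) fs _ cop = trans
      (lineSum-cong (λ k → expand (fun K k) (+ main₁ f) (sign₁ f) (κ (2 ℕ.+ m) k) (values fs k)))
      (lineSum-linear (+ main₁ f) (sign₁ f) (λ k → fun K k * values fs k) (λ k → (fun K k * κ (2 ℕ.+ m) k) * values fs k))
      where
      expand : ∀ u A s κ v → u * ((A + s * κ) * v) ≡ A * (u * v) + s * ((u * κ) * v)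
      expand = solve-∀
    twisted-∷ K (suc zero , _) fs (s≤s ()) cop

    extend-peak : ∀ K f ℓ≥2 (cop : Coprime (proj₁ f) (modulus K)) → peak (extend K f ℓ≥2 cop) ≡ peak K ℕ.* (proj₁ f ℕ.∸ 1)
    extend-peak K (suc (suc m) , _) _ cop = refl
    extend-peak K (suc zero , _) (s≤s ()) cop

    extend-coprime : ∀ K f ℓ≥2 (cop : Coprime (proj₁ f) (modulus K)) {g} → g ⟂ f → Coprime (proj₁ g) (modulus K) → Coprime (proj₁ g) (modulus (extend K f ℓ≥2 cop))
    extend-coprime K (suc (suc m) , _) _ cop g⟂f g⟂K = coprime-* g⟂f g⟂K
    extend-coprime K (suc zero , _) (s≤s ()) cop g⟂f g⟂K

    extend-coprimes : ∀ K f ℓ≥2 (cop : Coprime (proj₁ f) (modulus K)) gs → All (f ⟂_) gs →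
                      All (λ g → Coprime (proj₁ g) (modulus K)) gs →
                      All (λ g → Coprime (proj₁ g) (modulus (extend K f ℓ≥2 cop))) gs
    extend-coprimes K f m cop [] [] [] = []
    extend-coprimes K f m cop (g ∷ gs) (p ∷ ps) (c ∷ cs) =
      extend-coprime K f m cop {g} (Coprime.sym p) c ∷ extend-coprimes K f m cop gs ps cs

    -- The induction is shared by the two kinds of characters. P says which kernels the estimate
    -- covers, Q which primes may be adjoined without leaving P, and s/t is the bound per character:
    -- 1 for those trivial on F_q*, about √q for the others.
    module Twists (t s : ℕ) (P : Kernel → Set) (Q : Factor → Set)
      (closed : ∀ K f ℓ≥2 (cop : Coprime (proj₁ f) (modulus K)) → P K → Q f → P (extend K f ℓ≥2 cop))
      (estimate : ∀ K → P K → Within t (s ℕ.* peak K) (lineSum L (fun K))) where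

      twisted-bound : ∀ K fs → P K → All Modulus fs → All Q fs → All (λ f → Coprime (proj₁ f) (modulus K)) fs → AllPairs _⟂_ fs →
                      Within t (s ℕ.* (peak K ℕ.* peaks fs)) (twisted K fs)
      twisted-bound K [] PK _ _ _ _ = subst₂ (Within t)
        (cong (s ℕ.*_) (sym (ℕₚ.*-identityʳ (peak K)))) (lineSum-cong (λ k → sym (ℤₚ.*-identityʳ (fun K k)))) (estimate K PK)
      twisted-bound K (f ∷ fs) PK (m ∷ ms) (Qf ∷ Qs) (c ∷ cs) (p ∷ ps) =
        subst₂ (Within t) bound-eq (sym (twisted-∷ K f fs m c))
          (within-+ {t} {X = + main₁ f * twisted K fs}
            (within-* {t} {X = twisted K fs} (+ main₁ f) (twisted-bound K fs PK ms Qs cs ps))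
            (within-sign {t} {X = twisted K′ fs} f (twisted-bound K′ fs (closed K f m c PK Qf) ms Qs cs′ ps)))
        where
        K′ = extend K f m c
        cs′ = extend-coprimes K f m c fs p cs
        collect : ∀ A s k T l → A ℕ.* (s ℕ.* (k ℕ.* T)) ℕ.+ s ℕ.* ((k ℕ.* l) ℕ.* T) ≡ s ℕ.* (k ℕ.* ((A ℕ.+ l) ℕ.* T))
        collect = solve-ℕ
        bound-eq : main₁ f ℕ.* (s ℕ.* (peak K ℕ.* peaks fs)) ℕ.+ s ℕ.* (peak K′ ℕ.* peaks fs) ≡ s ℕ.* (peak K ℕ.* peaks (f ∷ fs))
        bound-eq = trans (cong (λ z → main₁ f ℕ.* (s ℕ.* (peak K ℕ.* peaks fs)) ℕ.+ s ℕ.* (z ℕ.* peaks fs)) (extend-peak K f m c))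
          (trans (collect (main₁ f) s (peak K) (peaks fs) (proj₁ f ℕ.∸ 1))
                 (cong (λ z → s ℕ.* (peak K ℕ.* (z ℕ.* peaks fs))) (peak₁-split f m)))

      -- K itself need not satisfy P. Every term outside the main one contains κ_ℓ for some ℓ in
      -- `fs`, and by `base` this factor alone brings the kernel into P.
      twisted-split : ∀ K (R : Factor → Set) → (∀ f ℓ≥2 (cop : Coprime (proj₁ f) (modulus K)) → R f → P (extend K f ℓ≥2 cop)) →
                      ∀ fs gs → All R fs → All Modulus (fs ++ gs) → All Q (fs ++ gs) →
                      All (λ f → Coprime (proj₁ f) (modulus K)) (fs ++ gs) → AllPairs _⟂_ (fs ++ gs) →
                      Within t (s ℕ.* (peak K ℕ.* (gap fs ℕ.* peaks gs))) (twisted K (fs ++ gs) - + mainTerm fs * twisted K gs)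
      twisted-split K R base [] gs _ _ _ _ _ = subst (Within t _) (sym (cancel (twisted K gs))) (ℕₚ.≤-trans (ℕₚ.≤-reflexive (ℕₚ.*-zeroʳ t)) z≤n)
        where
        cancel : ∀ x → x - 1ℤ * x ≡ 0ℤ
        cancel = solve-∀
      twisted-split K R base (f ∷ fs) gs (Rf ∷ Rs) (m ∷ ms) (Qf ∷ Qs) (c ∷ cs) (p ∷ ps) =
        subst₂ (Within t) bound-eq (sym value-eq)
          (within-+ {t} {X = + main₁ f * (twisted K (fs ++ gs) - + mainTerm fs * twisted K gs)}
            (within-* {t} {X = twisted K (fs ++ gs) - + mainTerm fs * twisted K gs} (+ main₁ f) (twisted-split K R base fs gs Rs ms Qs cs ps))
            (within-sign {t} {X = twisted K′ (fs ++ gs)} f (twisted-bound K′ (fs ++ gs) (base f m c Rf) ms Qs cs′ ps)))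
        where
        K′ = extend K f m c
        cs′ = extend-coprimes K f m c (fs ++ gs) p cs
        collect : ∀ A s k G T U l → A ℕ.* (s ℕ.* (k ℕ.* (G ℕ.* U))) ℕ.+ s ℕ.* ((k ℕ.* l) ℕ.* (T ℕ.* U)) ≡ s ℕ.* (k ℕ.* ((A ℕ.* G ℕ.+ l ℕ.* T) ℕ.* U))
        collect = solve-ℕ
        bound-eq : main₁ f ℕ.* (s ℕ.* (peak K ℕ.* (gap fs ℕ.* peaks gs))) ℕ.+ s ℕ.* (peak K′ ℕ.* peaks (fs ++ gs))
                 ≡ s ℕ.* (peak K ℕ.* (gap (f ∷ fs) ℕ.* peaks gs))
        bound-eq = trans (cong₂ (λ z w → main₁ f ℕ.* (s ℕ.* (peak K ℕ.* (gap fs ℕ.* peaks gs))) ℕ.+ s ℕ.* (z ℕ.* w)) (extend-peak K f m c) (peaks-++ fs gs))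
          (collect (main₁ f) s (peak K) (gap fs) (peaks fs) (peaks gs) (proj₁ f ℕ.∸ 1))
        regroup : ∀ A M X Y Z → (A * X + Z) - (A * M) * Y ≡ A * (X - M * Y) + Z
        regroup = solve-∀
        value-eq : twisted K ((f ∷ fs) ++ gs) - + mainTerm (f ∷ fs) * twisted K gs
                 ≡ + main₁ f * (twisted K (fs ++ gs) - + mainTerm fs * twisted K gs) + sign₁ f * twisted K′ (fs ++ gs)
        value-eq = trans (cong₂ (λ x y → x - y * twisted K gs) (twisted-∷ K f (fs ++ gs) m c) (ℤₚ.pos-* (main₁ f) (mainTerm fs)))
          (regroup (+ main₁ f) (+ mainTerm fs) (twisted K (fs ++ gs)) (twisted K gs) (sign₁ f * twisted K′ (fs ++ gs)))

-- Counting the points of a line whose logarithms satisfy given conditions.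

module Estimates where

  open import Data.Nat as ℕ using (ℕ; zero; suc; z≤n; s≤s)
  open import Data.Nat.Tactic.RingSolver using () renaming (solve-∀ to solve-ℕ)
  open import Data.Integer as ℤ using (ℤ; +_; -[1+_]; 0ℤ; 1ℤ; _+_; _*_; _-_; -_; ∣_∣; _≤_)
  open import Data.Integer.Tactic.RingSolver using (solve-∀)
  import Data.List.Properties as Listₚ
  open import Relation.Binary.PropositionalEquality
  open Sums
  open Kernels
  open Lines
  open Factors

  TwoPart : Bool → ℕ → Set
  TwoPart true k = k % 4 ≡ 2
  TwoPart false k = 2 ∣ k

  twoPart? : ∀ b k → Dec (TwoPart b k)
  twoPart? true k = k % 4 ℕₚ.≟ 2
  twoPart? false k = 2 ∣? k

  Sat : ℕ → Factor → Set
  Sat k (ℓ , avoid) = ¬ ℓ ∣ k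
  Sat k (ℓ , hit) = ℓ ∣ k

  sat? : ∀ k f → Dec (Sat k f)
  sat? k (ℓ , avoid) = ¬? (ℓ ∣? k)
  sat? k (ℓ , hit) = ℓ ∣? k

  Test : Bool → List Factor → ℕ → Set
  Test b fs k = TwoPart b k × All (Sat k) fs

  test? : ∀ b fs k → Dec (Test b fs k)
  test? b fs k = twoPart? b k ×-dec All.all? (sat? k) fs

  𝟙 : ∀ {A : Set} → Dec A → ℤ
  𝟙 (yes _) = 1ℤ
  𝟙 (no _) = 0ℤ

  𝟙-nonneg : ∀ {A : Set} (d : Dec A) → 0ℤ ≤ 𝟙 d
  𝟙-nonneg (yes _) = ℤ.+≤+ z≤n
  𝟙-nonneg (no _) = ℤ.+≤+ z≤n

  𝟙-mono : ∀ {A B : Set} (d : Dec A) (d′ : Dec B) → (A → B) → 𝟙 d ≤ 𝟙 d′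
  𝟙-mono (yes a) (yes b) f = ℤₚ.≤-refl
  𝟙-mono (yes a) (no ¬b) f = contradiction (f a) ¬b
  𝟙-mono (no ¬a) d′ f = 𝟙-nonneg d′

  𝟙-× : ∀ {A B : Set} (d : Dec A) (d′ : Dec B) → 𝟙 (d ×-dec d′) ≡ 𝟙 d * 𝟙 d′
  𝟙-× (yes a) (yes b) = refl
  𝟙-× (yes a) (no ¬b) = refl
  𝟙-× (no ¬a) (yes b) = refl
  𝟙-× (no ¬a) (no ¬b) = refl

  -- Character expansions of 4[k ≡ 2 (mod 4)] and 2[2 ∣ k]: with the minus sign, `c₄` cancels the
  -- value 2 at multiples of 4 and doubles it at 2 modulo 4.
  two : Bool → ℕ → ℤ
  two true k = 1ℤ + (κ 2 k - c₄ k)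
  two false k = 1ℤ + κ 2 k

  twoScale : Bool → ℕ
  twoScale true = 4
  twoScale false = 2

  %4⇒%2 : ∀ {i} k → k % 4 ≡ i → k % 2 ≡ i % 2
  %4⇒%2 k refl = sym (m∣n⇒o%n%m≡o%m 2 4 k (divides 2 refl))

  even-κ : ∀ k → k % 2 ≡ 0 → κ 2 k ≡ 1ℤ
  even-κ k eq = κ-∣ (m%n≡0⇒n∣m k 2 eq)

  odd-κ : ∀ k → k % 2 ≡ 1 → κ 2 k ≡ - 1ℤ
  odd-κ k eq = κ-∤ {2} {k} (λ 2∣k → contradiction (trans (sym (n∣m⇒m%n≡0 k 2 2∣k)) eq) λ ())

  two-𝟙 : ∀ b k → two b k ≡ + twoScale b * 𝟙 (twoPart? b k)
  two-𝟙 false k = by (2 ∣? k)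
    where
    by : (d : Dec (2 ∣ k)) → 1ℤ + κ 2 k ≡ + 2 * 𝟙 d
    by (yes 2∣k) = cong (λ z → 1ℤ + z) (κ-∣ 2∣k)
    by (no 2∤k) = cong (λ z → 1ℤ + z) (κ-∤ 2∤k)
  two-𝟙 true k with residue-mod-4 k
  ... | inj₁ eq rewrite eq | even-κ k (%4⇒%2 k eq) = refl
  ... | inj₂ (inj₁ eq) rewrite eq | odd-κ k (%4⇒%2 k eq) = refl
  ... | inj₂ (inj₂ (inj₁ eq)) rewrite eq | even-κ k (%4⇒%2 k eq) = refl
  ... | inj₂ (inj₂ (inj₂ eq)) rewrite eq | odd-κ k (%4⇒%2 k eq) = refl

  value-𝟙 : ∀ f k → Modulus f → value f k ≡ + proj₁ f * 𝟙 (sat? k f)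
  value-𝟙 f@(suc ℓ , avoid) k _ = by (sat? k f)
    where
    cancel : ∀ x → x + - 1ℤ * ((1ℤ + x) - 1ℤ) ≡ 0ℤ
    cancel = solve-∀
    by : (d : Dec (¬ suc ℓ ∣ k)) → value f k ≡ + suc ℓ * 𝟙 d
    by (yes ℓ∤k) = trans (cong (λ z → + ℓ + - 1ℤ * z) (κ-∤ ℓ∤k)) (trans (ℤₚ.+-comm (+ ℓ) 1ℤ) (sym (ℤₚ.*-identityʳ (+ suc ℓ))))
    by (no ¬ℓ∤k) = trans (cong (λ z → + ℓ + - 1ℤ * z) (κ-∣ (decidable-stable (suc ℓ ∣? k) ¬ℓ∤k)))
                         (trans (cancel (+ ℓ)) (sym (ℤₚ.*-zeroʳ (+ suc ℓ))))
  value-𝟙 f@(suc ℓ , hit) k _ = by (sat? k f)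
    where
    cancel : ∀ x → 1ℤ + 1ℤ * ((1ℤ + x) - 1ℤ) ≡ (1ℤ + x) * 1ℤ
    cancel = solve-∀
    by : (d : Dec (suc ℓ ∣ k)) → value f k ≡ + suc ℓ * 𝟙 d
    by (yes ℓ∣k) = trans (cong (λ z → 1ℤ + 1ℤ * z) (κ-∣ ℓ∣k)) (cancel (+ ℓ))
    by (no ℓ∤k) = trans (cong (λ z → 1ℤ + 1ℤ * z) (κ-∤ ℓ∤k)) (sym (ℤₚ.*-zeroʳ (+ suc ℓ)))

  values-𝟙 : ∀ fs k → All Modulus fs → values fs k ≡ + scale fs * 𝟙 (All.all? (sat? k) fs)
  values-𝟙 [] k [] = refl
  values-𝟙 (f ∷ fs) k (m ∷ ms) = begin
    value f k * values fs k
      ≡⟨ cong₂ _*_ (value-𝟙 f k m) (values-𝟙 fs k ms) ⟩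
    (+ proj₁ f * 𝟙 (sat? k f)) * (+ scale fs * 𝟙 (All.all? (sat? k) fs))
      ≡⟨ regroup (+ proj₁ f) (𝟙 (sat? k f)) (+ scale fs) (𝟙 (All.all? (sat? k) fs)) ⟩
    (+ proj₁ f * + scale fs) * (𝟙 (sat? k f) * 𝟙 (All.all? (sat? k) fs))
      ≡⟨ cong₂ _*_ (sym (ℤₚ.pos-* (proj₁ f) (scale fs))) (all-𝟙 (sat? k f) (All.all? (sat? k) fs)) ⟩
    + scale (f ∷ fs) * 𝟙 (All.all? (sat? k) (f ∷ fs)) ∎
    where
    open ≡-Reasoning
    regroup : ∀ a b c d → (a * b) * (c * d) ≡ (a * c) * (b * d)
    regroup = solve-∀
    all-𝟙 : (d : Dec (Sat k f)) (d′ : Dec (All (Sat k) fs)) → 𝟙 d * 𝟙 d′ ≡ 𝟙 (All.all? (sat? k) (f ∷ fs))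
    all-𝟙 d d′ with All.all? (sat? k) (f ∷ fs)
    all-𝟙 (yes _) (yes _) | yes _ = refl
    all-𝟙 (yes _) (no ¬a) | yes (_ ∷ as) = contradiction as ¬a
    all-𝟙 (no ¬s) d′      | yes (s ∷ _) = contradiction s ¬s
    all-𝟙 (yes s) (yes a) | no ¬as = contradiction (s ∷ a) ¬as
    all-𝟙 (yes _) (no _)  | no _ = refl
    all-𝟙 (no _)  (yes _) | no _ = refl
    all-𝟙 (no _)  (no _)  | no _ = refl

  -- The first argument tells whether q ≡ 1 (mod 4), when the characters of order 4
  -- are nontrivial on F_q* and c₄ contributes to the √q term.
  exactError : Bool → Bool → List Factor → List Factor → ℕ
  exactError false true fs gs = mainTerm fs ℕ.* (gap gs ℕ.+ 3 ℕ.* peaks gs)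
  exactError _     _    fs gs = mainTerm fs ℕ.* (gap gs ℕ.+ peaks gs)

  rootError : Bool → Bool → List Factor → List Factor → ℕ
  rootError true  true  fs gs = 2 ℕ.* (gap fs ℕ.* peaks gs) ℕ.+ 2 ℕ.* (peaks fs ℕ.* peaks gs)
  rootError false true  fs gs = 4 ℕ.* (gap fs ℕ.* peaks gs)
  rootError _     false fs gs = 2 ℕ.* (gap fs ℕ.* peaks gs)

  Quartic : ∀ {r} → LineLogs r → Bool → Set
  Quartic L true = (e % 4 ≡ 2) × (4 ∣ n) × (2 ∣ suc q) where open LineLogs L
  Quartic L false = 4 ∣ suc q where open LineLogs L

  i≤∣i∣ : ∀ i → i ≤ + ∣ i ∣
  i≤∣i∣ (+ m) = ℤₚ.≤-refl
  i≤∣i∣ -[1+ m ] = ℤ.-≤+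

  ∣i-j∣-upper : ∀ x y → x ℕ.≤ y ℕ.+ ∣ + x - + y ∣
  ∣i-j∣-upper x y = ℤₚ.drop‿+≤+ (subst₂ _≤_ (cancel (+ x) (+ y)) (sym (ℤₚ.pos-+ y ∣ + x - + y ∣))
    (ℤₚ.+-monoʳ-≤ (+ y) (i≤∣i∣ (+ x - + y))))
    where
    cancel : ∀ a b → b + (a - b) ≡ a
    cancel = solve-∀

  ∣i-j∣-lower : ∀ x y → y ℕ.≤ x ℕ.+ ∣ + x - + y ∣
  ∣i-j∣-lower x y = subst (λ z → y ℕ.≤ x ℕ.+ z) (ℤₚ.∣i-j∣≡∣j-i∣ (+ y) (+ x)) (∣i-j∣-upper y x)

  module _ {r : ℕ} (L : LineLogs r) where
    open LineLogs L

    q+1∣n : suc q ∣ n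
    q+1∣n = n∣m*n r

    -- The names refer to q - 1 and q + 1. The characters of a `Minus` kernel are nontrivial on
    -- F_q*, those of a `Plus` kernel are trivial there.
    Minus : Kernel → Set
    Minus K = modulus K ∣ n × MeanZero K × MeanZeroAlong e K

    Plus : Kernel → Set
    Plus K = modulus K ∣ suc q × MeanZero K

    MinusFactor : Factor → Set
    MinusFactor (ℓ , _) = ℓ ∣ n × Coprime ℓ e

    PlusFactor : Factor → Set
    PlusFactor (ℓ , _) = ℓ ∣ suc q

    extend-mean : ∀ K f ℓ≥2 (cop : Coprime (proj₁ f) (modulus K)) → MeanZero (extend L K f ℓ≥2 cop)
    extend-mean K (suc (suc m) , _) _ cop = ⊗-meanZero K (κ-kernel m) cop (κ-mean (2 ℕ.+ m))
    extend-mean K (suc zero , _) (s≤s ()) cop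

    extend-∣ : ∀ {N} K f ℓ≥2 (cop : Coprime (proj₁ f) (modulus K)) → proj₁ f ∣ N → modulus K ∣ N → modulus (extend L K f ℓ≥2 cop) ∣ N
    extend-∣ K (suc (suc m) , _) _ cop ℓ∣N K∣N = coprime-*∣ cop ℓ∣N K∣N
    extend-∣ K (suc zero , _) (s≤s ()) cop _ _

    extend-alongˡ : ∀ K f ℓ≥2 (cop : Coprime (proj₁ f) (modulus K)) → MeanZeroAlong e K → MeanZeroAlong e (extend L K f ℓ≥2 cop)
    extend-alongˡ K (suc (suc m) , _) _ cop = ⊗-alongˡ e K (κ-kernel m) cop
    extend-alongˡ K (suc zero , _) (s≤s ()) cop

    extend-alongʳ : ∀ K f ℓ≥2 (cop : Coprime (proj₁ f) (modulus K)) → Coprime (proj₁ f) e → MeanZeroAlong e (extend L K f ℓ≥2 cop)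
    extend-alongʳ K (suc (suc m) , _) _ cop ℓ⟂e = ⊗-alongʳ e K (κ-kernel m) cop (κ-along e m ℓ⟂e)
    extend-alongʳ K (suc zero , _) (s≤s ()) cop _

    module Plusₜ = Twists L 1 1 Plus PlusFactor
      (λ K f m c (K∣ , _) ℓ∣ → extend-∣ K f m c ℓ∣ K∣ , extend-mean K f m c)
      (λ K (K∣ , mean) → ℕₚ.≤-trans (ℕₚ.≤-reflexive (ℕₚ.*-identityˡ ∣ lineSum L (fun K) ∣))
        (ℕₚ.≤-trans (∣lineSum∣≤peak L K (∣-trans K∣ q+1∣n) mean K∣) (ℕₚ.≤-reflexive (sym (ℕₚ.*-identityˡ (peak K))))))

    lineSum-unit : twisted L unit [] ≡ + q
    lineSum-unit = trans (sum-const q 1ℤ) (ℤₚ.*-identityʳ (+ q))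

    lift : ∀ t {b X} → Within 1 (1 ℕ.* b) X → Within t (t ℕ.* b) X
    lift t {b} {X} p = ℕₚ.*-monoʳ-≤ t (subst₂ ℕ._≤_ (ℕₚ.*-identityˡ ∣ X ∣) (ℕₚ.*-identityˡ b) p)

    record Admissible (fs gs : List Factor) : Set where
      field
        moduli  : All Modulus (fs ++ gs)
        minus   : All MinusFactor fs
        plus    : All PlusFactor gs
        odd     : All (λ f → Coprime (proj₁ f) 2) (fs ++ gs)
        coprime : AllPairs _⟂_ (fs ++ gs)

    module _ {t s : ℕ} (t²q≤s² : t ℕ.* t ℕ.* q ℕ.≤ s ℕ.* s) where

      module Minusₜ = Twists L t s Minus (λ f → proj₁ f ∣ n)
        (λ K f m c (K∣ , _ , along) ℓ∣ → extend-∣ K f m c ℓ∣ K∣ , extend-mean K f m c , extend-alongˡ K f m c along)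
        (λ K (K∣ , mean , along) → ∣lineSum∣≤√q L K K∣ mean along {s} {t} t²q≤s²)

      module _ {fs gs : List Factor} (ok : Admissible fs gs) where
        open Admissible ok
        private
          A = mainTerm fs
          T = peaks fs
          G = gap fs
          B = mainTerm gs
          U = peaks gs
          H = gap gs
          divs : All (λ f → proj₁ f ∣ n) (fs ++ gs)
          divs = Allₚ.++⁺ (All.map proj₁ minus) (All.map (λ ℓ∣ → ∣-trans ℓ∣ q+1∣n) plus)
          coprime-mod : ∀ K → (∀ m → Coprime m 2 → Coprime m (modulus K)) →
                        ∀ (hs : List Factor) → All (λ f → Coprime (proj₁ f) 2) hs → All (λ f → Coprime (proj₁ f) (modulus K)) hs
          coprime-mod K imp [] [] = []
          coprime-mod K imp (h ∷ hs) (c ∷ cs) = imp (proj₁ h) c ∷ coprime-mod K imp hs cs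
          gs-pairs : AllPairs _⟂_ gs
          gs-pairs = drop-pairs fs coprime
            where
            drop-pairs : ∀ xs {ys} → AllPairs _⟂_ (xs ++ ys) → AllPairs _⟂_ ys
            drop-pairs [] ps = ps
            drop-pairs (x ∷ xs) (_ ∷ ps) = drop-pairs xs ps

        -- First `fs` is replaced by its main term A; all discarded characters are nontrivial on
        -- F_q* and cost √q each. What remains is A times a sum over `gs` alone, whose own error is
        -- multiplied by A.
        minus-split : ∀ K → modulus K ∣ n → (∀ m → Coprime m 2 → Coprime m (modulus K)) → ∀ {b M} →
                      Within 1 (1 ℕ.* b) (twisted L K gs - M) →
                      Within t (s ℕ.* (peak K ℕ.* (G ℕ.* U)) ℕ.+ A ℕ.* (t ℕ.* b)) (twisted L K (fs ++ gs) - + A * M)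
        minus-split K K∣n imp {b} {M} bound = subst (Within t _) (telescope (twisted L K (fs ++ gs)) (+ A) (twisted L K gs) M)
          (within-+ {t} {X = twisted L K (fs ++ gs) - + A * twisted L K gs}
            (Minusₜ.twisted-split K MinusFactor (λ f m c (ℓ∣ , ℓ⟂e) → extend-∣ K f m c ℓ∣ K∣n , extend-mean K f m c , extend-alongʳ K f m c ℓ⟂e)
               fs gs minus moduli divs (coprime-mod K imp (fs ++ gs) odd) coprime)
            (within-* {t} {X = twisted L K gs - M} (+ A) (lift t {b} {twisted L K gs - M} bound)))
          where
          telescope : ∀ x a y m → (x - a * y) + a * (y - m) ≡ x - a * m
          telescope = solve-∀

        -- As K has mean zero and does not see F_q*, the sum over `gs` has no main term: this is
        -- `minus-split` with M = 0.
        plus-only : ∀ K → modulus K ∣ suc q → MeanZero K → (∀ m → Coprime m 2 → Coprime m (modulus K)) →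
                    Within t (s ℕ.* (peak K ℕ.* (G ℕ.* U)) ℕ.+ A ℕ.* (t ℕ.* (peak K ℕ.* U))) (twisted L K (fs ++ gs))
        plus-only K K∣ mean imp = subst (Within t _) (trivial (twisted L K (fs ++ gs)) (+ A))
          (minus-split K (∣-trans K∣ q+1∣n) imp {M = 0ℤ} (subst (Within 1 _) (sym (minus-0 (twisted L K gs)))
            (Plusₜ.twisted-bound K gs (K∣ , mean) (Allₚ.++⁻ʳ fs moduli) plus (coprime-mod K imp gs (Allₚ.++⁻ʳ fs odd)) gs-pairs)))
          where
          trivial : ∀ x a → x - a * 0ℤ ≡ x
          trivial = solve-∀
          minus-0 : ∀ x → x - 0ℤ ≡ x
          minus-0 = solve-∀

        unit-split : Within t (s ℕ.* (1 ℕ.* (G ℕ.* U)) ℕ.+ A ℕ.* (t ℕ.* (1 ℕ.* (H ℕ.* 1)))) (twisted L unit (fs ++ gs) - + A * (+ B * + q))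
        unit-split = minus-split unit (divides n (sym (ℕₚ.*-identityʳ n))) (λ m _ → Coprime.sym (Coprime.1-coprimeTo m)) {M = + B * + q}
          (subst₂ (λ hs z → Within 1 (1 ℕ.* (1 ℕ.* (H ℕ.* 1))) (twisted L unit hs - + B * z)) (Listₚ.++-identityʳ gs) lineSum-unit
            (Plusₜ.twisted-split unit PlusFactor (λ f m c ℓ∣ → extend-∣ unit f m c ℓ∣ (divides (suc q) (sym (ℕₚ.*-identityʳ (suc q)))) , extend-mean unit f m c)
              gs [] plus (into (Allₚ.++⁻ʳ fs moduli)) (into plus)
              (into (coprime-mod unit (λ m _ → Coprime.sym (Coprime.1-coprimeTo m)) gs (Allₚ.++⁻ʳ fs odd)))
              (subst (AllPairs _⟂_) (sym (Listₚ.++-identityʳ gs)) gs-pairs)))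
          where
          into : ∀ {P : Factor → Set} → All P gs → All P (gs ++ [])
          into {P} = subst (All P) (sym (Listₚ.++-identityʳ gs))

        private
          S : Kernel → ℤ
          S K = twisted L K (fs ++ gs)
          2⇒2 : ∀ m → Coprime m 2 → Coprime m 2
          2⇒2 m c = c
          2⇒4 : ∀ m → Coprime m 2 → Coprime m 4
          2⇒4 m c = coprime-* c c

        total : Bool → ℤ
        total b = lineSum L (λ k → two b k * values (fs ++ gs) k)

        total-false : total false ≡ S unit + S (κ-kernel 0)
        total-false = trans (lineSum-cong L (λ k → expand (κ 2 k) (values (fs ++ gs) k)))
          (trans (lineSum-linear L 1ℤ 1ℤ (λ k → 1ℤ * values (fs ++ gs) k) (λ k → κ 2 k * values (fs ++ gs) k)) (ones (S unit) (S (κ-kernel 0))))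
          where
          expand : ∀ x v → (1ℤ + x) * v ≡ 1ℤ * (1ℤ * v) + 1ℤ * (x * v)
          expand = solve-∀
          ones : ∀ x y → 1ℤ * x + 1ℤ * y ≡ x + y
          ones = solve-∀

        total-true : total true ≡ S unit + (S (κ-kernel 0) + - 1ℤ * S c₄-kernel)
        total-true = trans (lineSum-cong L (λ k → expand (κ 2 k) (c₄ k) (values (fs ++ gs) k)))
          (trans (lineSum-linear L 1ℤ 1ℤ (λ k → 1ℤ * values (fs ++ gs) k) (λ k → 1ℤ * (κ 2 k * values (fs ++ gs) k) + - 1ℤ * (c₄ k * values (fs ++ gs) k)))
            (trans (cong (λ z → 1ℤ * S unit + 1ℤ * z) (lineSum-linear L 1ℤ (- 1ℤ) (λ k → κ 2 k * values (fs ++ gs) k) (λ k → c₄ k * values (fs ++ gs) k)))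
              (ones (S unit) (S (κ-kernel 0)) (S c₄-kernel))))
          where
          expand : ∀ x y v → (1ℤ + (x - y)) * v ≡ 1ℤ * (1ℤ * v) + 1ℤ * (1ℤ * (x * v) + - 1ℤ * (y * v))
          expand = solve-∀
          ones : ∀ x y z → 1ℤ * x + 1ℤ * (1ℤ * y + - 1ℤ * z) ≡ x + (y + - 1ℤ * z)
          ones = solve-∀

        quartic-bound : ∀ one → Quartic L one → Within t (t ℕ.* exactError one true fs gs ℕ.+ s ℕ.* rootError one true fs gs) (total true - + A * (+ B * + q))
        quartic-bound true (e%4≡2 , 4∣n , 2∣q+1) = subst₂ (Within t)
          (trans (cong (λ z → (s ℕ.* (1 ℕ.* (G ℕ.* U)) ℕ.+ A ℕ.* (t ℕ.* (1 ℕ.* (H ℕ.* 1)))) ℕ.+ ((s ℕ.* (1 ℕ.* (G ℕ.* U)) ℕ.+ A ℕ.* (t ℕ.* (1 ℕ.* U))) ℕ.+ s ℕ.* (2 ℕ.* z))) (peaks-++ fs gs))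
            (collect s A t G H T U))
          (trans (regroup (S unit) (+ A * (+ B * + q)) (S (κ-kernel 0)) (- 1ℤ * S c₄-kernel)) (cong (_- + A * (+ B * + q)) (sym total-true)))
          (within-+ {t} {X = S unit - + A * (+ B * + q)} unit-split
            (within-+ {t} {X = S (κ-kernel 0)} (plus-only (κ-kernel 0) 2∣q+1 (κ-mean 2) 2⇒2)
              -- The factor `(0 , avoid)` only supplies the sign -1 of `c₄`. Here q ≡ 1 (mod 4), so
              -- `c₄` is nontrivial on F_q* by itself, and all of its terms, including those without
              -- a prime from `fs`, cost √q.
              (within-sign {t} {X = S c₄-kernel} (0 , avoid) (Minusₜ.twisted-bound c₄-kernel (fs ++ gs) (4∣n , c₄-mean , c₄-along e e%4≡2)
                moduli divs (coprime-mod c₄-kernel 2⇒4 (fs ++ gs) odd) coprime))))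
          where
          regroup : ∀ x m y z → (x - m) + (y + z) ≡ (x + (y + z)) - m
          regroup = solve-∀
          collect : ∀ s A t G H T U → (s ℕ.* (1 ℕ.* (G ℕ.* U)) ℕ.+ A ℕ.* (t ℕ.* (1 ℕ.* (H ℕ.* 1)))) ℕ.+ ((s ℕ.* (1 ℕ.* (G ℕ.* U)) ℕ.+ A ℕ.* (t ℕ.* (1 ℕ.* U))) ℕ.+ s ℕ.* (2 ℕ.* (T ℕ.* U)))
                    ≡ t ℕ.* (A ℕ.* (H ℕ.+ U)) ℕ.+ s ℕ.* (2 ℕ.* (G ℕ.* U) ℕ.+ 2 ℕ.* (T ℕ.* U))
          collect = solve-ℕ
        quartic-bound false 4∣q+1 = subst₂ (Within t)
          (collect s A t G H U)
          (trans (regroup (S unit) (+ A * (+ B * + q)) (S (κ-kernel 0)) (- 1ℤ * S c₄-kernel)) (cong (_- + A * (+ B * + q)) (sym total-true)))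
          (within-+ {t} {X = S unit - + A * (+ B * + q)} unit-split
            (within-+ {t} {X = S (κ-kernel 0)} (plus-only (κ-kernel 0) (∣-trans (divides 2 refl) 4∣q+1) (κ-mean 2) 2⇒2)
              (within-sign {t} {X = S c₄-kernel} (0 , avoid) (plus-only c₄-kernel 4∣q+1 c₄-mean 2⇒4))))
          where
          regroup : ∀ x m y z → (x - m) + (y + z) ≡ (x + (y + z)) - m
          regroup = solve-∀
          collect : ∀ s A t G H U → (s ℕ.* (1 ℕ.* (G ℕ.* U)) ℕ.+ A ℕ.* (t ℕ.* (1 ℕ.* (H ℕ.* 1)))) ℕ.+ ((s ℕ.* (1 ℕ.* (G ℕ.* U)) ℕ.+ A ℕ.* (t ℕ.* (1 ℕ.* U))) ℕ.+ (s ℕ.* (2 ℕ.* (G ℕ.* U)) ℕ.+ A ℕ.* (t ℕ.* (2 ℕ.* U))))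
                    ≡ t ℕ.* (A ℕ.* (H ℕ.+ 3 ℕ.* U)) ℕ.+ s ℕ.* (4 ℕ.* (G ℕ.* U))
          collect = solve-ℕ

        even-bound : ∀ one → 2 ∣ suc q → Within t (t ℕ.* exactError one false fs gs ℕ.+ s ℕ.* rootError one false fs gs) (total false - + A * (+ B * + q))
        even-bound one 2∣q+1 = subst₂ (Within t) (trans (collect s A t G H U) (sym (errors one)))
          (trans (regroup (S unit) (+ A * (+ B * + q)) (S (κ-kernel 0))) (cong (_- + A * (+ B * + q)) (sym total-false)))
          (within-+ {t} {X = S unit - + A * (+ B * + q)} unit-split (plus-only (κ-kernel 0) 2∣q+1 (κ-mean 2) 2⇒2))
          where
          regroup : ∀ x m y → (x - m) + y ≡ (x + y) - m
          regroup = solve-∀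
          collect : ∀ s A t G H U → (s ℕ.* (1 ℕ.* (G ℕ.* U)) ℕ.+ A ℕ.* (t ℕ.* (1 ℕ.* (H ℕ.* 1)))) ℕ.+ (s ℕ.* (1 ℕ.* (G ℕ.* U)) ℕ.+ A ℕ.* (t ℕ.* (1 ℕ.* U)))
                    ≡ t ℕ.* (A ℕ.* (H ℕ.+ U)) ℕ.+ s ℕ.* (2 ℕ.* (G ℕ.* U))
          collect = solve-ℕ
          errors : ∀ one → t ℕ.* exactError one false fs gs ℕ.+ s ℕ.* rootError one false fs gs ≡ t ℕ.* (A ℕ.* (H ℕ.+ U)) ℕ.+ s ℕ.* (2 ℕ.* (G ℕ.* U))
          errors true = refl
          errors false = refl

        total-bound : ∀ one b → Quartic L one → 2 ∣ suc q →
                      Within t (t ℕ.* exactError one b fs gs ℕ.+ s ℕ.* rootError one b fs gs) (total b - + (A ℕ.* (B ℕ.* q)))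
        total-bound one b quartic 2∣q+1 = subst (λ z → Within t _ (total b - z)) (sym (trans (ℤₚ.pos-* A (B ℕ.* q)) (cong (+ A *_) (ℤₚ.pos-* B q)))) (cases b)
          where
          cases : ∀ b → Within t (t ℕ.* exactError one b fs gs ℕ.+ s ℕ.* rootError one b fs gs) (total b - + A * (+ B * + q))
          cases true = quartic-bound one quartic
          cases false = even-bound one 2∣q+1

    count : Bool → List Factor → ℕ
    count b hs = ∣ lineSum L (λ k → 𝟙 (test? b hs k)) ∣

    +count : ∀ b hs → + count b hs ≡ lineSum L (λ k → 𝟙 (test? b hs k))
    +count b hs = ℤₚ.0≤i⇒+∣i∣≡i (sum-nonneg {q} (λ x → 𝟙-nonneg (test? b hs (a x))))

    total-count : ∀ b hs → All Modulus hs → lineSum L (λ k → two b k * values hs k) ≡ + (twoScale b ℕ.* scale hs ℕ.* count b hs)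
    total-count b hs ms = begin
      lineSum L (λ k → two b k * values hs k)
        ≡⟨ lineSum-cong L pointwise ⟩
      lineSum L (λ k → + (twoScale b ℕ.* scale hs) * 𝟙 (test? b hs k))
        ≡⟨ sum-*ˡ {q} (+ (twoScale b ℕ.* scale hs)) (λ x → 𝟙 (test? b hs (a x))) ⟩
      + (twoScale b ℕ.* scale hs) * lineSum L (λ k → 𝟙 (test? b hs k))
        ≡⟨ cong (+ (twoScale b ℕ.* scale hs) *_) (+count b hs) ⟨
      + (twoScale b ℕ.* scale hs) * + count b hs
        ≡⟨ ℤₚ.pos-* (twoScale b ℕ.* scale hs) (count b hs) ⟨
      + (twoScale b ℕ.* scale hs ℕ.* count b hs) ∎
      where
      open ≡-Reasoning
      regroup : ∀ a b c d → (a * b) * (c * d) ≡ (a * c) * (b * d)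
      regroup = solve-∀
      pointwise : ∀ k → two b k * values hs k ≡ + (twoScale b ℕ.* scale hs) * 𝟙 (test? b hs k)
      pointwise k = begin
        two b k * values hs k
          ≡⟨ cong₂ _*_ (two-𝟙 b k) (values-𝟙 hs k ms) ⟩
        (+ twoScale b * 𝟙 (twoPart? b k)) * (+ scale hs * 𝟙 (All.all? (sat? k) hs))
          ≡⟨ regroup (+ twoScale b) (𝟙 (twoPart? b k)) (+ scale hs) (𝟙 (All.all? (sat? k) hs)) ⟩
        (+ twoScale b * + scale hs) * (𝟙 (twoPart? b k) * 𝟙 (All.all? (sat? k) hs))
          ≡⟨ cong₂ _*_ (sym (ℤₚ.pos-* (twoScale b) (scale hs))) (sym (𝟙-× (twoPart? b k) (All.all? (sat? k) hs))) ⟩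
        + (twoScale b ℕ.* scale hs) * 𝟙 (test? b hs k) ∎

    count-mono : ∀ b b′ hs hs′ → (∀ k → Test b hs k → Test b′ hs′ k) → count b hs ℕ.≤ count b′ hs′
    count-mono b b′ hs hs′ imp = ℤₚ.drop‿+≤+ (subst₂ _≤_ (sym (+count b hs)) (sym (+count b′ hs′))
      (sum-mono {q} (λ x → 𝟙-mono (test? b hs (a x)) (test? b′ hs′ (a x)) (imp (a x)))))

    module _ {t s : ℕ} (t²q≤s² : t ℕ.* t ℕ.* q ℕ.≤ s ℕ.* s) {fs gs : List Factor} (ok : Admissible fs gs)
      (one b : Bool) (quartic : Quartic L one) (2∣q+1 : 2 ∣ suc q) where
      private
        D = twoScale b ℕ.* scale (fs ++ gs)
        M = mainTerm fs ℕ.* (mainTerm gs ℕ.* q)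
        E = t ℕ.* exactError one b fs gs ℕ.+ s ℕ.* rootError one b fs gs
        c = count b (fs ++ gs)
        bound : t ℕ.* ∣ + (D ℕ.* c) - + M ∣ ℕ.≤ E
        bound = subst (λ z → Within t E (z - + M)) (total-count b (fs ++ gs) (Admissible.moduli ok)) (total-bound {t} {s} t²q≤s² ok one b quartic 2∣q+1)

      count-upper : t ℕ.* (D ℕ.* c) ℕ.≤ t ℕ.* M ℕ.+ E
      count-upper = ℕₚ.≤-trans (ℕₚ.*-monoʳ-≤ t (∣i-j∣-upper (D ℕ.* c) M))
        (ℕₚ.≤-trans (ℕₚ.≤-reflexive (ℕₚ.*-distribˡ-+ t M _)) (ℕₚ.+-monoʳ-≤ (t ℕ.* M) bound))

      count-lower : t ℕ.* M ℕ.≤ t ℕ.* (D ℕ.* c) ℕ.+ E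
      count-lower = ℕₚ.≤-trans (ℕₚ.*-monoʳ-≤ t (∣i-j∣-lower (D ℕ.* c) M))
        (ℕₚ.≤-trans (ℕₚ.≤-reflexive (ℕₚ.*-distribˡ-+ t (D ℕ.* c) _)) (ℕₚ.+-monoʳ-≤ (t ℕ.* (D ℕ.* c)) bound))

-- Primes, prime powers and a splitting of two orders.

module Arith where

  open import Data.Nat
  open import Data.Nat.Properties
  open import Data.Nat.Divisibility
  open import Data.Nat.Induction using (<-rec)
  open import Data.Nat.Primality.Factorisation using (factorise)
  open import Relation.Binary using (tri<; tri≈; tri>)
  open import Relation.Binary.PropositionalEquality
  open Kernels using (coprime-*∣)
  open Factors using (coprime-*)

  prime-divisor : ∀ n → 1 < n → ∃ λ p → Prime p × p ∣ n
  prime-divisor n 1<n with factorise n {{>-nonZero (<-trans z<s 1<n)}}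
  ... | record { factors = [] ; isFactorisation = refl } = contradiction 1<n (<-irrefl refl)
  ... | record { factors = p ∷ ps ; isFactorisation = eq ; factorsPrime = pp ∷ _ } = p , pp , subst (p ∣_) (sym eq) (m∣m*n (product ps))

  1<prime : ∀ {p} → Prime p → 1 < p
  1<prime pp = nonTrivial⇒n>1 _ {{prime⇒nonTrivial pp}}

  coprime-prime : ∀ {p n} → Prime p → ¬ p ∣ n → Coprime p n
  coprime-prime pp p∤n {d} (d∣p , d∣n) with prime⇒irreducible pp d∣p
  ... | inj₁ d≡1 = d≡1
  ... | inj₂ refl = contradiction d∣n p∤n

  coprime-^ : ∀ {a b} k → Coprime a b → Coprime a (b ^ k)
  coprime-^ {a} zero cop = Coprime.sym (Coprime.1-coprimeTo a)
  coprime-^ (suc k) cop = coprime-* cop (coprime-^ k cop)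

  prime-∣^ : ∀ {p b} k → Prime p → p ∣ b ^ k → p ∣ b
  prime-∣^ {p} {b} k pp p∣ with p ∣? b
  ... | yes p∣b = p∣b
  ... | no p∤b = contradiction (coprime-^ k (coprime-prime pp p∤b) (∣-refl , p∣)) (λ p≡1 → <-irrefl (sym p≡1) (1<prime pp))

  prime-∣-prime : ∀ {p q} → Prime p → Prime q → p ∣ q → p ≡ q
  prime-∣-prime pp pq p∣q with prime⇒irreducible pq p∣q
  ... | inj₁ p≡1 = contradiction (sym p≡1) (<⇒≢ (1<prime pp))
  ... | inj₂ p≡q = p≡q

  coprime-by-primes : ∀ {a b} → 0 < a → (∀ p → Prime p → p ∣ a → p ∣ b → p ≡ 1) → Coprime a b
  coprime-by-primes {a} a>0 none {d} (d∣a , d∣b) with <-cmp d 1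
  ... | tri≈ _ d≡1 _ = d≡1
  ... | tri< (s≤s z≤n) _ _ = contradiction (0∣⇒≡0 d∣a) (m<n⇒n≢0 a>0)
  ... | tri> _ _ 1<d with prime-divisor d 1<d
  ... | p , pp , p∣d = contradiction (sym (none p pp (∣-trans p∣d d∣a) (∣-trans p∣d d∣b))) (<⇒≢ (1<prime pp))

  valuation : ∀ {p} → Prime p → ∀ n → 0 < n → ∃₂ λ k u → n ≡ p ^ k * u × ¬ p ∣ u
  valuation {p} pp = <-rec _ step
    where
    step : ∀ n → (∀ {m} → m < n → 0 < m → ∃₂ λ k u → m ≡ p ^ k * u × ¬ p ∣ u) → 0 < n → ∃₂ λ k u → n ≡ p ^ k * u × ¬ p ∣ u
    step n rec n>0 with p ∣? n
    ... | no p∤n = 0 , n , sym (*-identityˡ n) , p∤n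
    ... | yes (divides m refl) with rec {m} (m<m*n m p {{m*n≢0⇒m≢0 m {{>-nonZero n>0}}}} (1<prime pp))
                                         (>-nonZero⁻¹ m {{m*n≢0⇒m≢0 m {{>-nonZero n>0}}}})
    ... | k , u , eq , p∤u = suc k , u , trans (*-comm m p) (trans (cong (p *_) eq) (sym (*-assoc p (p ^ k) u))) , p∤u

  -- Take a prime p dividing s. Either the full power of p in s already fails to divide r, or the
  -- cofactor must fail, being prime to that power, and it is smaller than s.
  prime-power-∤ : ∀ s r → 0 < s → ¬ s ∣ r → ∃₂ λ p k → Prime p × p ^ k ∣ s × ¬ p ^ k ∣ r
  prime-power-∤ = <-rec _ step
    where
    Goal : ℕ → Set
    Goal s = ∀ r → 0 < s → ¬ s ∣ r → ∃₂ λ p k → Prime p × p ^ k ∣ s × ¬ p ^ k ∣ r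
    step : ∀ s → (∀ {m} → m < s → Goal m) → Goal s
    step s rec r s>0 s∤r with <-cmp s 1
    ... | tri< (s≤s z≤n) _ _ = contradiction s>0 (<-irrefl refl)
    ... | tri≈ _ refl _ = contradiction (1∣ r) s∤r
    ... | tri> _ _ 1<s with prime-divisor s 1<s
    ... | p , pp , p∣s with valuation pp s s>0
    ... | k , u , refl , p∤u with p ^ k ∣? r
    ... | no pᵏ∤r = p , k , pp , m∣m*n u , pᵏ∤r
    ... | yes pᵏ∣r with rec {u} (u< k p∣s) r u>0 (λ u∣r → s∤r (coprime-*∣ (Coprime.sym (coprime-^ k (Coprime.sym (coprime-prime pp p∤u)))) pᵏ∣r u∣r))
      where
      u>0 : 0 < u
      u>0 = >-nonZero⁻¹ u {{m*n≢0⇒n≢0 (p ^ k) {{>-nonZero s>0}}}}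
      u< : ∀ k → p ∣ p ^ k * u → u < p ^ k * u
      u< zero p∣ = contradiction (subst (p ∣_) (*-identityˡ u) p∣) p∤u
      u< (suc k) _ = subst (u <_) (*-comm u (p * p ^ k)) (m<m*n u (p * p ^ k) {{>-nonZero u>0}}
        (<-≤-trans (1<prime pp) (m≤m*n p (p ^ k) {{m^n≢0 p k {{prime⇒nonZero pp}}}})))
    ... | p′ , k′ , pp′ , ∣u , ∤r = p′ , k′ , pp′ , ∣-trans ∣u (n∣m*n (p ^ k)) , ∤r

  first-power-∤ : ∀ p k r → ¬ p ^ k ∣ r → ∃ λ i → p ^ i ∣ r × ¬ p ^ suc i ∣ r × p ^ suc i ∣ p ^ k
  first-power-∤ p zero r ∤r = contradiction (1∣ r) ∤r
  first-power-∤ p (suc k) r ∤r with p ^ k ∣? r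
  ... | yes ∣r = k , ∣r , ∤r , ∣-refl
  ... | no ∤r′ with first-power-∤ p k r ∤r′
  ... | i , a , b , c = i , a , b , ∣-trans c (n∣m*n p)

  -- If x has order r and y has order s, then xᵈ and yʷ have the coprime orders r₀ and e, and their
  -- product has order r₀e > r.
  record LcmSplit (s r : ℕ) : Set where
    field
      d r₀ w e : ℕ
      r≡ : r ≡ d * r₀
      s≡ : s ≡ w * e
      d>0 : 0 < d
      r₀>0 : 0 < r₀
      w>0 : 0 < w
      e>0 : 0 < e
      coprime : Coprime r₀ e
      r< : r < r₀ * e

  -- Let pⁱ be the exact power of p in r, where pⁱ⁺¹ divides s. Taking pⁱ out of r and putting e =
  -- pⁱ⁺¹ gives r₀e = pr.
  lcm-split : ∀ s r → 0 < s → 0 < r → ¬ s ∣ r → LcmSplit s r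
  lcm-split s r s>0 r>0 s∤r with prime-power-∤ s r s>0 s∤r
  ... | p , k , pp , pᵏ∣s , pᵏ∤r with first-power-∤ p k r pᵏ∤r
  ... | i , divides r₀ r≡ , pˢⁱ∤r , pˢⁱ∣pᵏ with ∣-trans pˢⁱ∣pᵏ pᵏ∣s
  ... | divides w s≡ = record
    { d = p ^ i ; r₀ = r₀ ; w = w ; e = p ^ suc i
    ; r≡ = trans r≡ (*-comm r₀ (p ^ i)) ; s≡ = s≡
    ; d>0 = pⁱ>0 ; r₀>0 = r₀>0 ; w>0 = factor>0 w (p ^ suc i) (subst (0 <_) s≡ s>0)
    ; e>0 = >-nonZero⁻¹ _ {{m^n≢0 p (suc i) {{prime⇒nonZero pp}}}}
    ; coprime = coprime-^ (suc i) (Coprime.sym (coprime-prime pp p∤r₀))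
    ; r< = subst₂ _<_ (sym r≡) (trans (*-assoc r₀ (p ^ i) p) (cong (r₀ *_) (*-comm (p ^ i) p)))
        (m<m*n (r₀ * p ^ i) p {{>-nonZero (*-mono-≤ r₀>0 pⁱ>0)}} (1<prime pp)) }
    where
    factor>0 : ∀ a b → 0 < a * b → 0 < a
    factor>0 (suc a) b _ = z<s
    pⁱ>0 : 0 < p ^ i
    pⁱ>0 = >-nonZero⁻¹ _ {{m^n≢0 p i {{prime⇒nonZero pp}}}}
    r₀>0 : 0 < r₀
    r₀>0 = factor>0 r₀ (p ^ i) (subst (0 <_) r≡ r>0)
    p∤r₀ : ¬ p ∣ r₀
    p∤r₀ (divides v refl) = pˢⁱ∤r (divides v (trans r≡ (*-assoc v p (p ^ i))))

-- The multiplicative group of a finite field is cyclic.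

module FiniteFields where

  import Algebra.Properties.CommutativeSemigroup
  import Relation.Binary.Reasoning.Setoid
  open import Data.Nat as ℕ using (ℕ; zero; suc; z≤n; s≤s)
  open import Relation.Binary.PropositionalEquality as ≡ using (_≡_)
  open import Defs using (IsFiniteField; pow)
  open Sums using (∣<⇒≡0)
  open Kernels using (coprime-*∣)
  open Arith

  module Field (R : CommutativeRing 0ℓ 0ℓ) (N : ℕ) (isField : IsFiniteField R (suc N)) where
    open CommutativeRing R public hiding (zero)
    open IsFiniteField isField public
    open Algebra.Properties.CommutativeSemigroup +-commutativeSemigroup using () renaming (interchange to +-interchange; x∙yz≈y∙xz to +-leftComm)
    open Algebra.Properties.CommutativeSemigroup *-commutativeSemigroup using () renaming (interchange to *-interchange; x∙yz≈y∙xz to *-leftComm)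
    open Relation.Binary.Reasoning.Setoid setoid

    index : Carrier → Fin (suc N)
    index x = proj₁ (enum-surj x)

    enum-index : ∀ x → enum (index x) ≈ x
    enum-index x = proj₂ (enum-surj x)

    index-cong⁻ : ∀ {x y} → index x ≡ index y → x ≈ y
    index-cong⁻ {x} {y} eq = trans (sym (enum-index x)) (trans (reflexive (≡.cong enum eq)) (enum-index y))

    infix 4 _≟_
    _≟_ : ∀ x y → Dec (x ≈ y)
    x ≟ y = map′ index-cong⁻ (λ x≈y → enum-inj _ _ (trans (enum-index x) (trans x≈y (sym (enum-index y))))) (index x Finₚ.≟ index y)

    *-cancel : ∀ {x y z} → ¬ x ≈ 0# → x * y ≈ x * z → y ≈ z
    *-cancel {x} {y} {z} x≉0 eq with inverse x x≉0
    ... | x⁻¹ , inv = begin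
      y               ≈⟨ undo y ⟨
      x⁻¹ * (x * y)   ≈⟨ *-congˡ eq ⟩
      x⁻¹ * (x * z)   ≈⟨ undo z ⟩
      z               ∎
      where
      undo : ∀ w → x⁻¹ * (x * w) ≈ w
      undo w = trans (sym (*-assoc x⁻¹ x w)) (trans (*-congʳ (trans (*-comm x⁻¹ x) inv)) (*-identityˡ w))

    zero-product : ∀ {x y} → ¬ x ≈ 0# → x * y ≈ 0# → y ≈ 0#
    zero-product {x} x≉0 eq = *-cancel x≉0 (trans eq (sym (zeroʳ x)))

    *-nonzero : ∀ {x y} → ¬ x ≈ 0# → ¬ y ≈ 0# → ¬ x * y ≈ 0#
    *-nonzero x≉0 y≉0 xy≈0 = y≉0 (zero-product x≉0 xy≈0)

    infixr 8 _^_
    _^_ : Carrier → ℕ → Carrier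
    x ^ n = pow R x n

    ^-cong : ∀ n {x y} → x ≈ y → x ^ n ≈ y ^ n
    ^-cong zero eq = refl
    ^-cong (suc n) eq = *-cong eq (^-cong n eq)

    ^-+ : ∀ x m n → x ^ (m ℕ.+ n) ≈ x ^ m * x ^ n
    ^-+ x zero n = sym (*-identityˡ _)
    ^-+ x (suc m) n = trans (*-congˡ (^-+ x m n)) (sym (*-assoc x _ _))

    1^ : ∀ n → 1# ^ n ≈ 1#
    1^ zero = refl
    1^ (suc n) = trans (*-identityˡ _) (1^ n)

    ^-*-distrib : ∀ x y n → (x * y) ^ n ≈ x ^ n * y ^ n
    ^-*-distrib x y zero = sym (*-identityˡ 1#)
    ^-*-distrib x y (suc n) = trans (*-congˡ (^-*-distrib x y n))
      (*-interchange x y (x ^ n) (y ^ n))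

    ^-* : ∀ x m n → x ^ (m ℕ.* n) ≈ (x ^ m) ^ n
    ^-* x zero n = sym (1^ n)
    ^-* x (suc m) n = trans (^-+ x n (m ℕ.* n)) (trans (*-congˡ (^-* x m n)) (sym (^-*-distrib x (x ^ m) n)))

    ^-nonzero : ∀ {x} n → ¬ x ≈ 0# → ¬ x ^ n ≈ 0#
    ^-nonzero zero x≉0 = nontrivial
    ^-nonzero (suc n) x≉0 = *-nonzero x≉0 (^-nonzero n x≉0)

    Order : Carrier → ℕ → Set
    Order x d = 0 ℕ.< d × x ^ d ≈ 1# × (∀ m → x ^ m ≈ 1# → d ∣ m)

    ^-∣ : ∀ {x d m} → x ^ d ≈ 1# → d ∣ m → x ^ m ≈ 1#
    ^-∣ {x} {d} eq (divides c ≡.refl) = trans (reflexive (≡.cong (x ^_) (ℕₚ.*-comm c d))) (trans (^-* x d c) (trans (^-cong c eq) (1^ c)))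

    order-nonzero : ∀ {x d} → Order x d → ¬ x ≈ 0#
    order-nonzero {x} {suc d} (_ , eq , _) x≈0 = nontrivial (trans (sym eq) (trans (*-congʳ x≈0) (zeroˡ _)))

    minimal-order : ∀ {x} d → x ^ suc d ≈ 1# → (∀ m → m ℕ.< d → ¬ x ^ suc m ≈ 1#) → Order x (suc d)
    minimal-order {x} d eq least = s≤s z≤n , eq , λ m xᵐ≈1 → m%n≡0⇒n∣m m (suc d) (remainder m xᵐ≈1 (m % suc d) ≡.refl (m%n<n m (suc d)))
      where
      remainder : ∀ m → x ^ m ≈ 1# → ∀ k → m % suc d ≡ k → k ℕ.< suc d → k ≡ 0
      remainder m xᵐ≈1 zero _ _ = ≡.refl
      remainder m xᵐ≈1 (suc k) k≡ (s≤s k<d) = contradiction (begin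
        x ^ suc k                                  ≡⟨ ≡.cong (x ^_) k≡ ⟨
        x ^ (m % suc d)                            ≈⟨ *-identityʳ _ ⟨
        x ^ (m % suc d) * 1#                       ≈⟨ *-congˡ (^-∣ {x} {suc d} eq (n∣m*n (m / suc d))) ⟨
        x ^ (m % suc d) * x ^ (m / suc d ℕ.* suc d) ≈⟨ ^-+ x (m % suc d) (m / suc d ℕ.* suc d) ⟨
        x ^ (m % suc d ℕ.+ m / suc d ℕ.* suc d)    ≡⟨ ≡.cong (x ^_) (m≡m%n+[m/n]*n m (suc d)) ⟨
        x ^ m                                      ≈⟨ xᵐ≈1 ⟩
        1#                                         ∎) (least k k<d)

    least-order : ∀ {x} k → (∃ λ d → d ℕ.< k × x ^ suc d ≈ 1#) → ∃ (Order x)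
    least-order {x} (suc k) (d , d<k , eq) with Finₚ.any? {n = k} (λ i → x ^ suc (toℕ i) ≟ 1#)
    ... | yes (i , eq′) = least-order k (toℕ i , Finₚ.toℕ<n i , eq′)
    ... | no none = suc d , minimal-order d eq (λ m m<d xᵐ≈1 →
      let m<k = ℕₚ.<-≤-trans m<d (ℕₚ.≤-pred d<k) in
      none (fromℕ< m<k , trans (reflexive (≡.cong (λ z → x ^ suc z) (Finₚ.toℕ-fromℕ< m<k))) xᵐ≈1))

    finite-order : ∀ x → ¬ x ≈ 0# → ∃ (Order x)
    finite-order x x≉0 with Finₚ.pigeonhole (ℕₚ.n<1+n (suc N)) (λ (i : Fin (suc (suc N))) → index (x ^ toℕ i))
    ... | i , j , i<j , eq = least-order (suc (toℕ j ℕ.∸ suc (toℕ i))) (toℕ j ℕ.∸ suc (toℕ i) , ℕₚ.n<1+n _ ,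
      *-cancel (^-nonzero (toℕ i) x≉0) (begin
        x ^ toℕ i * x ^ suc (toℕ j ℕ.∸ suc (toℕ i))   ≈⟨ ^-+ x (toℕ i) _ ⟨
        x ^ (toℕ i ℕ.+ suc (toℕ j ℕ.∸ suc (toℕ i)))   ≡⟨ ≡.cong (x ^_) (≡.trans (ℕₚ.+-suc (toℕ i) _) (ℕₚ.m+[n∸m]≡n i<j)) ⟩
        x ^ toℕ j                                     ≈⟨ index-cong⁻ eq ⟨
        x ^ toℕ i                                     ≈⟨ *-identityʳ _ ⟨
        x ^ toℕ i * 1#                                ∎))

    -- A polynomial is a function together with a Horner scheme for it; only its values are ever
    -- needed.
    data Monic : ℕ → (Carrier → Carrier) → Set where
      one  : ∀ {f} → (∀ x → f x ≈ 1#) → Monic 0 f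
      step : ∀ {d f} c g → Monic d g → (∀ x → f x ≈ c + x * g x) → Monic (suc d) f

    data Degree< : ℕ → (Carrier → Carrier) → Set where
      null : ∀ {f} → (∀ x → f x ≈ 0#) → Degree< 0 f
      step : ∀ {d f} c g → Degree< d g → (∀ x → f x ≈ c + x * g x) → Degree< (suc d) f

    monic-scale : ∀ {d f} a → Monic d f → Degree< (suc d) (λ x → a * f x)
    monic-scale a (one eq) = step a (λ _ → 0#) (null (λ _ → refl))
      (λ x → trans (*-congˡ (eq x)) (trans (*-identityʳ a) (sym (trans (+-congˡ (zeroʳ x)) (+-identityʳ a)))))
    monic-scale a (step c g m eq) = step (a * c) (λ x → a * g x) (monic-scale a m)
      (λ x → trans (*-congˡ (eq x)) (trans (distribˡ a c _) (+-congˡ (*-leftComm a x (g x)))))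

    monic-+ : ∀ {d f h} → Monic d f → Degree< d h → Monic d (λ x → f x + h x)
    monic-+ (one eq) (null eq′) = one (λ x → trans (+-cong (eq x) (eq′ x)) (+-identityʳ 1#))
    monic-+ (step c g m eq) (step c′ g′ l eq′) = step (c + c′) (λ x → g x + g′ x) (monic-+ m l)
      (λ x → trans (+-cong (eq x) (eq′ x))
        (trans (+-interchange c (x * g x) c′ (x * g′ x)) (+-congˡ (sym (distribˡ x (g x) (g′ x))))))

    -- The factor theorem, with x = a + d to keep it free of subtraction.
    factor : ∀ {k f} → Monic (suc k) f → ∀ a → ∃ λ h → Monic k h × (∀ x d → x ≈ a + d → f x ≈ f a + d * h x)
    factor (step c g (one eq′) eq) a = g , one eq′ , λ x d x≈ → begin
      _                  ≈⟨ eq x ⟩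
      c + x * g x        ≈⟨ +-congˡ (*-congʳ x≈) ⟩
      c + (a + d) * g x  ≈⟨ trans (+-congˡ (distribʳ (g x) a d)) (sym (+-assoc c _ _)) ⟩
      (c + a * g x) + d * g x ≈⟨ +-congʳ (+-congˡ (*-congˡ (trans (eq′ x) (sym (eq′ a))))) ⟩
      (c + a * g a) + d * g x ≈⟨ +-congʳ (eq a) ⟨
      _ ∎
    factor (step c g m@(step _ _ _ _) eq) a with factor m a
    ... | h , monic-h , fac = (λ x → g x + a * h x) , monic-+ m (monic-scale a monic-h) , λ x d x≈ → begin
      _                  ≈⟨ eq x ⟩
      c + x * g x        ≈⟨ +-congˡ (*-congʳ x≈) ⟩
      c + (a + d) * g x  ≈⟨ trans (+-congˡ (distribʳ (g x) a d)) (sym (+-assoc c _ _)) ⟩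
      (c + a * g x) + d * g x ≈⟨ +-congʳ (+-congˡ (*-congˡ (fac x d x≈))) ⟩
      (c + a * (g a + d * h x)) + d * g x
        ≈⟨ +-congʳ (trans (+-congˡ (trans (distribˡ a (g a) _) (+-congˡ (*-leftComm a d (h x))))) (sym (+-assoc c _ _))) ⟩
      ((c + a * g a) + d * (a * h x)) + d * g x
        ≈⟨ trans (+-assoc (c + a * g a) _ _) (+-congˡ (trans (+-comm _ _) (sym (distribˡ d (g x) (a * h x))))) ⟩
      (c + a * g a) + d * (g x + a * h x) ≈⟨ +-congʳ (eq a) ⟨
      _ ∎

    difference : ∀ x a → x ≈ a + (x - a)
    difference x a = begin
      x             ≈⟨ +-identityʳ x ⟨
      x + 0#        ≈⟨ +-congˡ (-‿inverseʳ a) ⟨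
      x + (a - a)   ≈⟨ +-leftComm x a (- a) ⟩
      a + (x - a)   ∎

    x-y≈0⇒x≈y : ∀ x y → x - y ≈ 0# → x ≈ y
    x-y≈0⇒x≈y x y eq = trans (difference x y) (trans (+-congˡ eq) (+-identityʳ y))

    too-many-roots : ∀ {d f} → Monic d f → (ρ : Fin (suc d) → Carrier) → (∀ i j → ρ i ≈ ρ j → i ≡ j) → ¬ (∀ i → f (ρ i) ≈ 0#)
    too-many-roots (one eq) ρ inj root = nontrivial (trans (sym (eq (ρ zero))) (root zero))
    too-many-roots {suc d} {f} m@(step _ _ _ _) ρ inj root with factor m (ρ zero)
    ... | h , monic-h , fac = too-many-roots monic-h (ρ ∘ suc) (λ i j eq → Finₚ.suc-injective (inj _ _ eq)) (λ i →
      zero-product (λ eq → Finₚ.0≢1+n (≡.sym (inj (suc i) zero (x-y≈0⇒x≈y (ρ (suc i)) (ρ zero) eq)))) (begin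
        (ρ (suc i) - ρ zero) * h (ρ (suc i))               ≈⟨ +-identityˡ _ ⟨
        0# + (ρ (suc i) - ρ zero) * h (ρ (suc i))          ≈⟨ +-congʳ (root zero) ⟨
        f (ρ zero) + (ρ (suc i) - ρ zero) * h (ρ (suc i))  ≈⟨ fac (ρ (suc i)) _ (difference (ρ (suc i)) (ρ zero)) ⟨
        f (ρ (suc i))                                      ≈⟨ root (suc i) ⟩
        0#                                                 ∎))

    monic-power : ∀ d → Monic d (_^ d)
    monic-power zero = one (λ _ → refl)
    monic-power (suc d) = step 0# (_^ d) (monic-power d) (λ x → sym (+-identityˡ _))

    unity-roots : ∀ {d k} → 0 ℕ.< d → (ρ : Fin k → Carrier) → (∀ i j → ρ i ≈ ρ j → i ≡ j) → (∀ i → ρ i ^ d ≈ 1#) → k ℕ.≤ d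
    unity-roots {suc d} {k} _ ρ inj root = ℕₚ.≮⇒≥ λ d<k →
      too-many-roots {f = λ x → - 1# + x ^ suc d} (step (- 1#) (_^ d) (monic-power d) (λ _ → refl))
        (λ i → ρ (inject≤ i d<k)) (λ i j eq → Finₚ.inject≤-injective d<k d<k i j (inj _ _ eq))
        (λ i → trans (+-congˡ (root (inject≤ i d<k))) (-‿inverseˡ 1#))

    units : Fin N → Carrier
    units i = enum (punchIn (index 0#) i)

    units-injective : ∀ i j → units i ≈ units j → i ≡ j
    units-injective i j eq = Finₚ.punchIn-injective (index 0#) i j (enum-inj _ _ eq)

    units-nonzero : ∀ i → ¬ units i ≈ 0#
    units-nonzero i eq = Finₚ.punchInᵢ≢i (index 0#) i (enum-inj _ _ (trans eq (sym (enum-index 0#))))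

    order-powers-injective : ∀ {x d} → Order x d → ∀ {i j} → i ℕ.≤ j → j ℕ.< d → x ^ i ≈ x ^ j → i ≡ j
    order-powers-injective {x} {d} ord@(_ , _ , div) {i} {j} i≤j j<d eq = ℕₚ.≤-antisym i≤j (ℕₚ.m∸n≡0⇒m≤n
      (∣<⇒≡0 (div (j ℕ.∸ i) (*-cancel (^-nonzero i (order-nonzero ord)) (begin
        x ^ i * x ^ (j ℕ.∸ i)  ≈⟨ ^-+ x i (j ℕ.∸ i) ⟨
        x ^ (i ℕ.+ (j ℕ.∸ i))  ≡⟨ ≡.cong (x ^_) (ℕₚ.m+[n∸m]≡n i≤j) ⟩
        x ^ j                  ≈⟨ eq ⟨
        x ^ i                  ≈⟨ *-identityʳ _ ⟨
        x ^ i * 1#             ∎))) (ℕₚ.≤-<-trans (ℕₚ.m∸n≤m j i) j<d)))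

    -- With 0 put in front, the powers of a generator enumerate the whole field.
    powers : ∀ {d} → Carrier → Fin (suc d) → Carrier
    powers x zero = 0#
    powers x (suc i) = x ^ toℕ i

    powers-injective : ∀ {x d} → Order x d → ∀ (i j : Fin (suc d)) → powers x i ≈ powers x j → i ≡ j
    powers-injective ord zero zero eq = ≡.refl
    powers-injective ord zero (suc j) eq = contradiction (sym eq) (^-nonzero (toℕ j) (order-nonzero ord))
    powers-injective ord (suc i) zero eq = contradiction eq (^-nonzero (toℕ i) (order-nonzero ord))
    powers-injective ord (suc i) (suc j) eq with ℕₚ.≤-total (toℕ i) (toℕ j)
    ... | inj₁ i≤j = ≡.cong suc (Finₚ.toℕ-injective (order-powers-injective ord i≤j (Finₚ.toℕ<n j) eq))
    ... | inj₂ j≤i = ≡.cong suc (≡.sym (Finₚ.toℕ-injective (order-powers-injective ord j≤i (Finₚ.toℕ<n i) (sym eq))))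

    order-≤ : ∀ {x d} → Order x d → d ℕ.≤ N
    order-≤ {x} ord = ℕₚ.≤-pred (Finₚ.injective⇒≤ {f = λ i → index (powers x i)}
      (λ {i} {j} eq → powers-injective ord i j (index-cong⁻ eq)))

    order-power : ∀ {x} d e → 0 ℕ.< d → 0 ℕ.< e → Order x (d ℕ.* e) → Order (x ^ d) e
    order-power {x} d e d>0 e>0 (_ , eq , div) = e>0 , trans (sym (^-* x d e)) eq ,
      λ m eq′ → *-cancelˡ-∣ d {{ℕ.>-nonZero d>0}} (div (d ℕ.* m) (trans (^-* x d m) eq′))

    order-product : ∀ {x y d e} → Order x d → Order y e → Coprime d e → Order (x * y) (d ℕ.* e)
    order-product {x} {y} {d} {e} (d>0 , xᵈ , divx) (e>0 , yᵉ , divy) cop =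
      ℕₚ.*-mono-≤ d>0 e>0 ,
      trans (^-*-distrib x y (d ℕ.* e)) (trans (*-cong (^-∣ {x} {d} xᵈ (m∣m*n e)) (^-∣ {y} {e} yᵉ (n∣m*n d))) (*-identityʳ 1#)) ,
      λ m eq → coprime-*∣ cop
        (coprime-divisor cop (divx (e ℕ.* m) (part x y e m yᵉ (trans (sym (^-*-distrib x y m)) eq))))
        (coprime-divisor (Coprime.sym cop) (divy (d ℕ.* m) (part y x d m xᵈ (trans (*-comm _ _) (trans (sym (^-*-distrib x y m)) eq)))))
      where
      -- Raising (xy)ᵐ = 1 to the power e removes y, which isolates the order of x.
      part : ∀ x y e m → y ^ e ≈ 1# → x ^ m * y ^ m ≈ 1# → x ^ (e ℕ.* m) ≈ 1#
      part x y e m yᵉ eq = begin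
        x ^ (e ℕ.* m)                  ≈⟨ *-identityʳ _ ⟨
        x ^ (e ℕ.* m) * 1#             ≈⟨ *-congˡ (^-∣ {y} {e} yᵉ (m∣m*n m)) ⟨
        x ^ (e ℕ.* m) * y ^ (e ℕ.* m)  ≡⟨ ≡.cong₂ (λ u v → x ^ u * y ^ v) (ℕₚ.*-comm e m) (ℕₚ.*-comm e m) ⟩
        x ^ (m ℕ.* e) * y ^ (m ℕ.* e)  ≈⟨ *-cong (^-* x m e) (^-* y m e) ⟩
        (x ^ m) ^ e * (y ^ m) ^ e      ≈⟨ ^-*-distrib (x ^ m) (y ^ m) e ⟨
        (x ^ m * y ^ m) ^ e            ≈⟨ ^-cong e eq ⟩
        1# ^ e                         ≈⟨ 1^ e ⟩
        1#                             ∎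

    larger-order : ∀ {x y r s} → Order x r → Order y s → ¬ s ∣ r → ∃₂ λ z t → Order z t × r ℕ.< t
    larger-order {x} {y} {r} {s} ordx ordy s∤r = assemble (lcm-split s r (proj₁ ordy) (proj₁ ordx) s∤r)
      where
      assemble : LcmSplit s r → ∃₂ λ z t → Order z t × r ℕ.< t
      assemble split = x ^ d * y ^ w , r₀ ℕ.* e ,
        order-product (order-power d r₀ d>0 r₀>0 (≡.subst (Order x) r≡ ordx)) (order-power w e w>0 e>0 (≡.subst (Order y) s≡ ordy)) coprime , r<
        where open LcmSplit split

    some-nonroot : ∀ r → ¬ (∀ i → units i ^ r ≈ 1#) → ∃ λ i → ¬ units i ^ r ≈ 1#
    some-nonroot r = Finₚ.¬∀⟶∃¬ N (λ i → units i ^ r ≈ 1#) (λ i → units i ^ r ≟ 1#)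

    order-N : ∀ {x r} → Order x r → N ℕ.≤ r → Order x N
    order-N {x} ord N≤r = ≡.subst (Order x) (ℕₚ.≤-antisym (order-≤ ord) N≤r) ord

    nonroot-improves : ∀ {x r} → Order x r → (∃ λ i → ¬ units i ^ r ≈ 1#) → ∃₂ λ z t → Order z t × r ℕ.< t
    nonroot-improves {x} {r} ord (i , ≉1) = improve (finite-order (units i) (units-nonzero i))
      where
      improve : ∃ (Order (units i)) → ∃₂ λ z t → Order z t × r ℕ.< t
      improve (s , ordᵢ@(_ , eq , _)) = larger-order ord ordᵢ (λ s∣r → ≉1 (^-∣ {units i} {s} eq s∣r))

    -- If every unit satisfies uʳ = 1, then N units are roots of Xʳ - 1 and N ≤ r. Otherwise some
    -- unit has an order not dividing r, and an element of larger order exists. The number k bounds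
    -- the improvements still possible.
    generator-from : ∀ k x r → Order x r → N ℕ.≤ r ℕ.+ k → ∃ λ g → Order g N
    generator-from k x r ord N≤ = by (Finₚ.all? (λ i → units i ^ r ≟ 1#))
      where
      continue : ∀ k → N ℕ.≤ r ℕ.+ k → ∃₂ (λ z t → Order z t × r ℕ.< t) → ∃ λ g → Order g N
      by : Dec (∀ i → units i ^ r ≈ 1#) → ∃ λ g → Order g N
      by (yes all) = x , order-N ord (unity-roots (proj₁ ord) units units-injective all)
      by (no ¬all) = continue k N≤ (nonroot-improves ord (some-nonroot r ¬all))
      continue zero N≤ _ = x , order-N ord (≡.subst (N ℕ.≤_) (ℕₚ.+-identityʳ r) N≤)
      continue (suc k) N≤ (z , t , ordz , r<t) =
        generator-from k z t ordz (ℕₚ.≤-trans (≡.subst (N ℕ.≤_) (ℕₚ.+-suc r k) N≤) (ℕₚ.+-monoˡ-≤ k r<t))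

    generator : ∃ λ g → Order g N
    generator = generator-from N 1# 1 (s≤s z≤n , *-identityʳ 1# , λ m _ → 1∣ m) (ℕₚ.n≤1+n N)

-- Discrete logarithms of the points of a line.

module Setup where

  open import Algebra.Morphism.Structures using (module RingMorphisms)
  import Algebra.Properties.Ring
  import Algebra.Properties.Group
  import Algebra.Properties.CommutativeSemigroup
  import Relation.Binary.Reasoning.Setoid
  open import Data.Nat as ℕ using (ℕ; zero; suc; z≤n; NonZero)
  open import Data.Nat.Tactic.RingSolver using () renaming (solve-∀ to solve-ℕ)
  open import Data.Integer as ℤ using (ℤ; +_)
  open import Data.Integer.Tactic.RingSolver using (solve-∀)
  open import Relation.Binary.PropositionalEquality as ≡ using (_≡_)
  open import Defs
  open Sums
  open Lines
  open Arith
  open FiniteFields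

  module Logs (R : CommutativeRing 0ℓ 0ℓ) (N : ℕ) (isField : IsFiniteField R (suc N)) where
    open Field R N isField
    open Relation.Binary.Reasoning.Setoid setoid

    Respects : (Carrier → ℤ) → Set
    Respects F = ∀ {x y} → x ≈ y → F x ≡ F y

    -- An injective family of `suc N` elements is already an enumeration of the field; no
    -- surjectivity has to be shown for the families used below.
    sum-enum : ∀ {F} → Respects F → (M : Fin (suc N) → Carrier) → (∀ i j → M i ≈ M j → i ≡ j) → sum (λ i → F (M i)) ≡ sum (λ i → F (enum i))
    sum-enum {F} resp M inj = ≡.trans (sum-cong-≗ {suc N} (λ i → resp (sym (enum-index (M i)))))
      (sum-injective (λ i → F (enum i)) (λ i → index (M i)) (λ {i} {j} eq → inj i j (index-cong⁻ eq)))

    g : Carrier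
    g = proj₁ generator

    g-order : Order g N
    g-order = proj₂ generator

    N>0 : 0 ℕ.< N
    N>0 = proj₁ g-order

    gᴺ≈1 : g ^ N ≈ 1#
    gᴺ≈1 = proj₁ (proj₂ g-order)

    g≉0 : ¬ g ≈ 0#
    g≉0 = order-nonzero g-order

    private
      surj : ∀ y → ∃ λ i → index (powers g i) ≡ index y
      surj y = injective⇒surjective (λ i → index (powers g i)) (λ {i} {j} eq → powers-injective g-order i j (index-cong⁻ eq)) (index y)

      exponent : Fin (suc N) → ℕ
      -- An arbitrary value for the logarithm of 0. In `line-cover` and `line-ratios` the term of 0
      -- appears on both sides and cancels.
      exponent zero = 0
      exponent (suc k) = toℕ k

      exponent-≤ : ∀ i → exponent i ℕ.≤ N
      exponent-≤ zero = z≤n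
      exponent-≤ (suc k) = ℕₚ.<⇒≤ (Finₚ.toℕ<n k)

      exponent-power : ∀ i → ¬ powers g i ≈ 0# → g ^ exponent i ≈ powers g i
      exponent-power zero ≉0 = contradiction refl ≉0
      exponent-power (suc k) ≉0 = refl

    log : Carrier → ℕ
    log y = exponent (proj₁ (surj y))

    log-≤ : ∀ y → log y ℕ.≤ N
    log-≤ y = exponent-≤ (proj₁ (surj y))

    g^log : ∀ {y} → ¬ y ≈ 0# → g ^ log y ≈ y
    g^log {y} y≉0 = trans (exponent-power (proj₁ (surj y)) (λ ≈0 → y≉0 (trans (sym ≈y) ≈0))) ≈y
      where
      ≈y : powers g (proj₁ (surj y)) ≈ y
      ≈y = index-cong⁻ (proj₂ (surj y))

    log-cong : ∀ {x y} → x ≈ y → log x ≡ log y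
    log-cong {x} {y} x≈y = ≡.cong exponent same
      where
      same : proj₁ (surj x) ≡ proj₁ (surj y)
      same = powers-injective g-order (proj₁ (surj x)) (proj₁ (surj y))
        (trans (index-cong⁻ (proj₂ (surj x))) (trans x≈y (sym (index-cong⁻ (proj₂ (surj y))))))

    power-∣ : ∀ {a b} → a ℕ.≤ b → g ^ a ≈ g ^ b → N ∣ b ℕ.∸ a
    power-∣ {a} {b} a≤b eq = proj₂ (proj₂ g-order) (b ℕ.∸ a) (*-cancel (^-nonzero a g≉0) (begin
      g ^ a * g ^ (b ℕ.∸ a)  ≈⟨ ^-+ g a (b ℕ.∸ a) ⟨
      g ^ (a ℕ.+ (b ℕ.∸ a))  ≡⟨ ≡.cong (g ^_) (ℕₚ.m+[n∸m]≡n a≤b) ⟩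
      g ^ b                  ≈⟨ eq ⟨
      g ^ a                  ≈⟨ *-identityʳ _ ⟨
      g ^ a * 1#             ∎))

    periodic-power : ∀ {f} → Periodic N f → ∀ a b → g ^ a ≈ g ^ b → f a ≡ f b
    periodic-power {f} per a b eq with ℕₚ.≤-total a b
    ... | inj₁ a≤b = ≡.sym (≡.trans (≡.cong f (≡.sym (ℕₚ.m∸n+n≡m a≤b))) (periodic-∣ per (power-∣ a≤b eq) a))
    ... | inj₂ b≤a = ≡.trans (≡.cong f (≡.sym (ℕₚ.m∸n+n≡m b≤a))) (periodic-∣ per (power-∣ b≤a (sym eq)) b)

    periodic-log : ∀ {f} → Periodic N f → ∀ {y} m → y ≈ g ^ m → f (log y) ≡ f m
    periodic-log per {y} m y≈ = periodic-power per (log y) m (trans (g^log (λ y≈0 → ^-nonzero m g≉0 (trans (sym y≈) y≈0))) y≈)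

  module Line (K L : CommutativeRing 0ℓ 0ℓ) (r : ℕ) (isFieldK : IsFiniteField K (suc r)) (isFieldL : IsFiniteField L (suc r ℕ.* suc r))
    (ι : CommutativeRing.Carrier K → CommutativeRing.Carrier L) (embedding : IsEmbedding K L ι)
    (α θ : CommutativeRing.Carrier L) (α≉0 : ¬ CommutativeRing._≈_ L α (CommutativeRing.0# L))
    (θ∉K : ∀ y → ¬ CommutativeRing._≈_ L θ (ι y)) where

    private
      N : ℕ
      -- What `suc r * suc r` computes to behind its leading `suc`, so that the field module applies
      -- to L as it stands.
      N = r ℕ.+ r ℕ.* suc r
      q : ℕ
      q = suc r
      module K where
        open Field K r isFieldK public
        open Logs K r isFieldK public
    open Field L N isFieldL
    open Logs L N isFieldL
    open RingMorphisms.IsRingHomomorphism embedding using (⟦⟧-cong; +-homo; *-homo; 0#-homo; 1#-homo)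
    open Algebra.Properties.Group +-group using () renaming (∙-cancelˡ to +-cancelˡ)
    open Algebra.Properties.CommutativeSemigroup *-commutativeSemigroup using () renaming (interchange to *-interchange; x∙yz≈y∙xz to *-leftComm; xy∙z≈xz∙y to *-rightComm)
    module _ where
      open Relation.Binary.Reasoning.Setoid setoid

      ι-nonzero : ∀ {x} → ¬ x K.≈ K.0# → ¬ ι x ≈ 0#
      ι-nonzero {x} x≉0 ιx≈0 with K.inverse x x≉0
      ... | y , xy≈1 = nontrivial (begin
        1#          ≈⟨ 1#-homo ⟨
        ι K.1#      ≈⟨ ⟦⟧-cong xy≈1 ⟨
        ι (x K.* y) ≈⟨ *-homo x y ⟩
        ι x * ι y   ≈⟨ *-congʳ ιx≈0 ⟩
        0# * ι y    ≈⟨ zeroˡ _ ⟩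
        0#          ∎)

      ι-injective : ∀ {x y} → ι x ≈ ι y → x K.≈ y
      ι-injective {x} {y} eq with (x K.- y) K.≟ K.0#
      ... | yes x-y≈0 = K.x-y≈0⇒x≈y x y x-y≈0
      ... | no x-y≉0 = contradiction (+-cancelˡ (ι y) _ _ (begin
        ι y + ι (x K.- y)  ≈⟨ +-homo y (x K.- y) ⟨
        ι (y K.+ (x K.- y)) ≈⟨ ⟦⟧-cong (K.difference x y) ⟨
        ι x                ≈⟨ eq ⟩
        ι y                ≈⟨ +-identityʳ _ ⟨
        ι y + 0#           ∎)) (ι-nonzero x-y≉0)

      ι-^ : ∀ x m → ι (x K.^ m) ≈ ι x ^ m
      ι-^ x zero = 1#-homo
      ι-^ x (suc m) = trans (*-homo x _) (*-congˡ (ι-^ x m))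

      not-proportional : ∀ a b → ¬ a K.≈ K.0# → ¬ ι a * θ ≈ ι b
      not-proportional a b a≉0 eq with K.inverse a a≉0
      ... | c , ac≈1 = θ∉K (c K.* b) (begin
        θ                  ≈⟨ *-identityˡ θ ⟨
        1# * θ             ≈⟨ *-congʳ (trans (sym 1#-homo) (⟦⟧-cong (K.sym (K.trans (K.*-comm c a) ac≈1)))) ⟩
        ι (c K.* a) * θ    ≈⟨ *-congʳ (*-homo c a) ⟩
        (ι c * ι a) * θ    ≈⟨ *-assoc _ _ _ ⟩
        ι c * (ι a * θ)    ≈⟨ *-congˡ eq ⟩
        ι c * ι b          ≈⟨ *-homo c b ⟨
        ι (c K.* b)        ∎)

      -- 1 and θ are linearly independent over K: a relation with nonzero coefficient at θ would put
      -- θ into ι(K).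
      coordinates-unique : ∀ {a b a′ b′} → ι a * θ + ι b ≈ ι a′ * θ + ι b′ → (a K.≈ a′) × (b K.≈ b′)
      coordinates-unique {a} {b} {a′} {b′} eq with (a K.- a′) K.≟ K.0#
      ... | yes a-a′≈0 = a≈a′ , ι-injective (+-cancelˡ (ι a′ * θ) _ _ (trans (+-congʳ (*-congʳ (⟦⟧-cong (K.sym a≈a′)))) eq))
        where a≈a′ = K.x-y≈0⇒x≈y a a′ a-a′≈0
      ... | no d≉0 = contradiction (+-cancelˡ (ι b) _ _ (begin
        ι b + ι d * θ      ≈⟨ +-comm _ _ ⟩
        ι d * θ + ι b      ≈⟨ shifted ⟩
        ι b′               ≈⟨ ⟦⟧-cong (K.difference b′ b) ⟩
        ι (b K.+ (b′ K.- b)) ≈⟨ +-homo b _ ⟩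
        ι b + ι (b′ K.- b) ∎)) (not-proportional d (b′ K.- b) d≉0)
        where
        d = a K.- a′
        shifted : ι d * θ + ι b ≈ ι b′
        shifted = +-cancelˡ (ι a′ * θ) _ _ (begin
          ι a′ * θ + (ι d * θ + ι b)   ≈⟨ +-assoc _ _ _ ⟨
          (ι a′ * θ + ι d * θ) + ι b   ≈⟨ +-congʳ (distribʳ θ (ι a′) (ι d)) ⟨
          (ι a′ + ι d) * θ + ι b       ≈⟨ +-congʳ (*-congʳ (+-homo a′ d)) ⟨
          ι (a′ K.+ d) * θ + ι b       ≈⟨ +-congʳ (*-congʳ (⟦⟧-cong (K.difference a a′))) ⟨
          ι a * θ + ι b                ≈⟨ eq ⟩
          ι a′ * θ + ι b′              ∎)

      point : Fin q → Carrier
      point x = θ + ι (K.enum x)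

      scaled-point : ∀ c x → ι c * (θ + ι x) ≈ ι c * θ + ι (c K.* x)
      scaled-point c x = trans (distribˡ (ι c) θ (ι x)) (+-congˡ (sym (*-homo c x)))

      ι-coordinates : ∀ z → ι z ≈ ι K.0# * θ + ι z
      ι-coordinates z = sym (trans (+-congʳ (trans (*-congʳ 0#-homo) (zeroˡ θ))) (+-identityˡ (ι z)))

      scaled-point-∉ : ∀ c x z → ¬ c K.≈ K.0# → ¬ ι c * (θ + ι x) ≈ ι z
      scaled-point-∉ c x z c≉0 eq = c≉0 (proj₁ (coordinates-unique (trans (sym (scaled-point c x)) (trans eq (ι-coordinates z)))))

      scaled-point-injective : ∀ c x c′ x′ → ¬ c K.≈ K.0# → ι c * (θ + ι x) ≈ ι c′ * (θ + ι x′) → (c K.≈ c′) × (x K.≈ x′)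
      scaled-point-injective c x c′ x′ c≉0 eq with coordinates-unique (trans (sym (scaled-point c x)) (trans eq (scaled-point c′ x′)))
      ... | c≈c′ , cx≈c′x′ = c≈c′ , K.*-cancel c≉0 (K.trans cx≈c′x′ (K.*-congʳ (K.sym c≈c′)))

      θ+ι-nonzero : ∀ x → ¬ θ + ι x ≈ 0#
      θ+ι-nonzero x eq = scaled-point-∉ K.1# x K.0# K.nontrivial (trans (*-congʳ 1#-homo) (trans (*-identityˡ _) (trans eq (sym 0#-homo))))

      γ^ : Fin r → K.Carrier
      γ^ t = K.g K.^ toℕ t

      γ^-nonzero : ∀ t → ¬ γ^ t K.≈ K.0#
      γ^-nonzero t = K.^-nonzero (toℕ t) K.g≉0

      γ^-injective : ∀ t t′ → γ^ t K.≈ γ^ t′ → t ≡ t′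
      γ^-injective t t′ eq = Finₚ.suc-injective (K.powers-injective K.g-order (suc t) (suc t′) eq)

      e : ℕ
      e = log (ι K.g)

      ιγ^ : ∀ i → ι (K.g K.^ i) ≈ g ^ (e ℕ.* i)
      ιγ^ i = trans (ι-^ K.g i) (trans (^-cong i (sym (g^log (ι-nonzero K.g≉0)))) (sym (^-* g e i)))

    -- Together with the q elements of ι(K), r · q distinct elements outside it exhaust the q²
    -- elements of L. Counting thus replaces the construction of inverse maps.
    module Grid (M : Fin r → Fin q → Carrier)
      (M-∉ : ∀ t y z → ¬ M t y ≈ ι z) (M-injective : ∀ t y t′ y′ → M t y ≈ M t′ y′ → (t ≡ t′) × (y ≡ y′)) where

      cell : Fin q → Fin q → Carrier
      cell zero y = ι (K.enum y)
      cell (suc t) y = M t y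

      cell-injective : ∀ i y i′ y′ → cell i y ≈ cell i′ y′ → (i ≡ i′) × (y ≡ y′)
      cell-injective zero y zero y′ eq = ≡.refl , K.enum-inj y y′ (ι-injective eq)
      cell-injective zero y (suc t) y′ eq = contradiction (sym eq) (M-∉ t y′ _)
      cell-injective (suc t) y zero y′ eq = contradiction eq (M-∉ t y _)
      cell-injective (suc t) y (suc t′) y′ eq with M-injective t y t′ y′ eq
      ... | ≡.refl , y≡y′ = ≡.refl , y≡y′

      private
        flat : Fin (q ℕ.* q) → Carrier
        flat k = uncurry cell (remQuot {q} q k)

        flat-injective : ∀ k l → flat k ≈ flat l → k ≡ l
        flat-injective k l eq with cell-injective (proj₁ (remQuot {q} q k)) (proj₂ (remQuot {q} q k)) (proj₁ (remQuot {q} q l)) (proj₂ (remQuot {q} q l)) eq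
        ... | i≡ , y≡ = ≡.trans (≡.sym (Finₚ.combine-remQuot {q} q k)) (≡.trans (≡.cong₂ combine i≡ y≡) (Finₚ.combine-remQuot {q} q l))

      grid-sum : ∀ {F} → Respects F → sum {q} (λ y → F (ι (K.enum y))) ℤ.+ sum {r} (λ t → sum {q} (λ y → F (M t y))) ≡ sum (λ i → F (powers {N} g i))
      grid-sum {F} resp = ≡.trans (≡.sym (≡.trans (sum-combine q {q} (λ k → F (flat k)))
          (sum-cong-≗ {q} (λ i → sum-cong-≗ {q} (λ y → ≡.cong (λ p → F (uncurry cell p)) (Finₚ.remQuot-combine i y))))))
        (≡.trans (sum-enum resp flat flat-injective) (≡.sym (sum-enum resp (powers g) (powers-injective g-order))))

    K-sum : ∀ {F} → Respects F → sum {q} (λ y → F (ι (K.enum y))) ≡ F 0# ℤ.+ ∑< r (λ i → F (ι (K.g K.^ i)))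
    K-sum {F} resp = ≡.trans (≡.sym (K.sum-enum (λ eq → resp (⟦⟧-cong eq)) (K.powers K.g) (K.powers-injective K.g-order)))
      (≡.cong (ℤ._+ ∑< r (λ i → F (ι (K.g K.^ i)))) (resp 0#-homo))

    powers-sum : ∀ {F : Carrier → ℤ} {f : ℕ → ℤ} → (∀ m → F (g ^ m) ≡ f m) → sum (λ i → F (powers {N} g i)) ≡ F 0# ℤ.+ ∑< N f
    powers-sum {F} {f} eq = ≡.cong (λ z → F 0# ℤ.+ z) (∑<-cong N eq)

    α-log : ℕ
    α-log = log α

    point-log : Fin q → ℕ
    point-log x = log (α * point x)

    α-point-nonzero : ∀ x → ¬ α * point x ≈ 0#
    α-point-nonzero x = *-nonzero α≉0 (θ+ι-nonzero (K.enum x))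

    N≡n : N ≡ r ℕ.* suc q
    N≡n = ≡.sym (ℕₚ.*-suc r q)

    instance
      N-nonZero : NonZero N
      N-nonZero = ℕ.>-nonZero N>0

    module _ where
      open Relation.Binary.Reasoning.Setoid setoid

      power-+ : ∀ {x y} a b → x ≈ g ^ a → y ≈ g ^ b → x * y ≈ g ^ (a ℕ.+ b)
      power-+ a b x≈ y≈ = trans (*-cong x≈ y≈) (sym (^-+ g a b))

      α-power : α ≈ g ^ α-log
      α-power = sym (g^log α≉0)

      M₁ : Fin r → Fin q → Carrier
      M₁ t x = ι (γ^ t) * point x

      M₁-power : ∀ t x → α * M₁ t x ≈ g ^ (e ℕ.* toℕ t ℕ.+ point-log x)
      M₁-power t x = trans (*-leftComm α (ι (γ^ t)) (point x)) (power-+ (e ℕ.* toℕ t) (point-log x) (ιγ^ (toℕ t)) (sym (g^log (α-point-nonzero x))))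

      module _ (y : Fin q) where
        w : Carrier
        w = proj₁ (inverse (point y) (θ+ι-nonzero (K.enum y)))

        point*w : point y * w ≈ 1#
        point*w = proj₂ (inverse (point y) (θ+ι-nonzero (K.enum y)))

        w*-transfer : ∀ {u v} → u * w ≈ v → u ≈ v * point y
        w*-transfer {u} {v} eq = begin
          u                  ≈⟨ *-identityʳ u ⟨
          u * 1#             ≈⟨ *-congˡ (trans (*-comm w (point y)) point*w) ⟨
          u * (w * point y)  ≈⟨ *-assoc u w (point y) ⟨
          (u * w) * point y  ≈⟨ *-congʳ eq ⟩
          v * point y        ∎

        difference-quotient : ∀ x → 1# + ι (x K.- K.enum y) * w ≈ (θ + ι x) * w
        difference-quotient x = begin
          1# + ι (x K.- b) * w            ≈⟨ +-congʳ point*w ⟨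
          (θ + ι b) * w + ι (x K.- b) * w ≈⟨ distribʳ w _ _ ⟨
          ((θ + ι b) + ι (x K.- b)) * w   ≈⟨ *-congʳ (+-assoc θ _ _) ⟩
          (θ + (ι b + ι (x K.- b))) * w   ≈⟨ *-congʳ (+-congˡ (+-homo b (x K.- b))) ⟨
          (θ + ι (b K.+ (x K.- b))) * w   ≈⟨ *-congʳ (+-congˡ (⟦⟧-cong (K.difference x b))) ⟨
          (θ + ι x) * w                   ∎
          where b = K.enum y

        quotient-power : ∀ x → point x * w ≈ g ^ (point-log x ℕ.+ (N ℕ.∸ point-log y))
        quotient-power x = *-cancel (α-point-nonzero y) (begin
          (α * point y) * (point x * w)  ≈⟨ *-congˡ (*-comm (point x) w) ⟩
          (α * point y) * (w * point x)  ≈⟨ *-assoc _ w _ ⟨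
          ((α * point y) * w) * point x  ≈⟨ *-congʳ (trans (*-assoc α _ w) (trans (*-congˡ point*w) (*-identityʳ α))) ⟩
          α * point x                    ≈⟨ g^log (α-point-nonzero x) ⟨
          g ^ point-log x                ≈⟨ *-identityˡ _ ⟨
          1# * g ^ point-log x           ≈⟨ *-congʳ gᴺ≈1 ⟨
          g ^ N * g ^ point-log x        ≈⟨ ^-+ g N (point-log x) ⟨
          g ^ (N ℕ.+ point-log x)        ≡⟨ ≡.cong (g ^_) exponents ⟩
          g ^ (point-log y ℕ.+ (point-log x ℕ.+ (N ℕ.∸ point-log y))) ≈⟨ ^-+ g (point-log y) _ ⟩
          g ^ point-log y * g ^ (point-log x ℕ.+ (N ℕ.∸ point-log y)) ≈⟨ *-congʳ (g^log (α-point-nonzero y)) ⟩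
          (α * point y) * g ^ (point-log x ℕ.+ (N ℕ.∸ point-log y))   ∎)
          where
          exponents : N ℕ.+ point-log x ≡ point-log y ℕ.+ (point-log x ℕ.+ (N ℕ.∸ point-log y))
          exponents = ≡.trans (≡.cong (ℕ._+ point-log x) (≡.sym (ℕₚ.m+[n∸m]≡n (log-≤ (α * point y)))))
            (≡.trans (ℕₚ.+-assoc (point-log y) _ _) (≡.cong (point-log y ℕ.+_) (ℕₚ.+-comm _ (point-log x))))

      -- The quotients (θ + x)/(θ + y) = 1 + (x - y)/(θ + y) for x ≠ y, with x - y written as a
      -- power of the generator of K*.
      M₂ : Fin r → Fin q → Carrier
      M₂ t y = 1# + ι (γ^ t) * w y

      -- Otherwise γᵗ = (z - 1)(θ + y). The coordinate at θ gives z = 1, and then γᵗ = 0.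
      M₂-∉ : ∀ t y z → ¬ M₂ t y ≈ ι z
      M₂-∉ t y z eq = γ^-nonzero t (K.trans (proj₂ coords) (K.trans (K.*-congʳ (K.sym (proj₁ coords))) (K.zeroˡ _)))
        where
        quotient : ι (γ^ t) * w y ≈ ι (z K.- K.1#)
        quotient = +-cancelˡ 1# _ _ (begin
          1# + ι (γ^ t) * w y         ≈⟨ eq ⟩
          ι z                         ≈⟨ ⟦⟧-cong (K.difference z K.1#) ⟩
          ι (K.1# K.+ (z K.- K.1#))   ≈⟨ +-homo K.1# _ ⟩
          ι K.1# + ι (z K.- K.1#)     ≈⟨ +-congʳ 1#-homo ⟩
          1# + ι (z K.- K.1#)         ∎)
        coords : (K.0# K.≈ z K.- K.1#) × (γ^ t K.≈ (z K.- K.1#) K.* K.enum y)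
        coords = coordinates-unique (begin
          ι K.0# * θ + ι (γ^ t)           ≈⟨ ι-coordinates (γ^ t) ⟨
          ι (γ^ t)                        ≈⟨ w*-transfer y quotient ⟩
          ι (z K.- K.1#) * point y        ≈⟨ scaled-point _ _ ⟩
          ι (z K.- K.1#) * θ + ι ((z K.- K.1#) K.* K.enum y) ∎)

      -- Clearing denominators gives γᵗ(θ + y′) = γᵗ′(θ + y), where the coordinates can be compared.
      M₂-injective : ∀ t y t′ y′ → M₂ t y ≈ M₂ t′ y′ → (t ≡ t′) × (y ≡ y′)
      M₂-injective t y t′ y′ eq = conclude (scaled-point-injective (γ^ t) (K.enum y′) (γ^ t′) (K.enum y) (γ^-nonzero t) (begin
        ι (γ^ t) * point y′                   ≈⟨ *-congʳ (w*-transfer y (+-cancelˡ 1# _ _ eq)) ⟩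
        ((ι (γ^ t′) * w y′) * point y) * point y′  ≈⟨ *-rightComm (ι (γ^ t′) * w y′) (point y) (point y′) ⟩
        ((ι (γ^ t′) * w y′) * point y′) * point y  ≈⟨ *-congʳ (w*-transfer y′ refl) ⟨
        ι (γ^ t′) * point y                   ∎))
        where
        conclude : (γ^ t K.≈ γ^ t′) × (K.enum y′ K.≈ K.enum y) → (t ≡ t′) × (y ≡ y′)
        conclude (c≈ , x≈) = γ^-injective t t′ c≈ , K.enum-inj y y′ (K.sym x≈)

    module _ where
      open ≡.≡-Reasoning

      ℤ-cancel : ∀ z a b c → z ℤ.+ a ≡ (z ℤ.+ b) ℤ.+ c → a ≡ c ℤ.+ b
      ℤ-cancel z a b c eq = ≡.trans (undo z a) (≡.trans (≡.cong (ℤ._- z) eq) (rearrange z b c))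
        where
        undo : ∀ z a → a ≡ (z ℤ.+ a) ℤ.- z
        undo = solve-∀
        rearrange : ∀ z b c → ((z ℤ.+ b) ℤ.+ c) ℤ.- z ≡ c ℤ.+ b
        rearrange = solve-∀

      -- L is enumerated twice with the weight f(log(αβ)): by the powers of g, where α merely shifts
      -- the sum, and by ι(K) with the multiples γᵗ(θ + x). The elements of ι(K) other than 0 give
      -- the coset of α.
      line-cover : ∀ f → Periodic N f →
        ∑< N f ≡ sum {r} (λ t → sum {q} (λ x → f (e ℕ.* toℕ t ℕ.+ point-log x))) ℤ.+ ∑< r (λ i → f (e ℕ.* i ℕ.+ α-log))
      line-cover f per = ℤ-cancel (F 0#) _ _ _ (begin
        F 0# ℤ.+ ∑< N f
          ≡⟨ ≡.cong (λ z → F 0# ℤ.+ z) (∑<-shift per α-log) ⟨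
        F 0# ℤ.+ ∑< N (λ k → f (α-log ℕ.+ k))
          ≡⟨ powers-sum {F} (λ m → periodic-log per (α-log ℕ.+ m) (power-+ α-log m α-power refl)) ⟨
        sum (λ i → F (powers {N} g i))
          ≡⟨ Grid.grid-sum M₁ (λ t y z → scaled-point-∉ (γ^ t) (K.enum y) z (γ^-nonzero t)) M₁-injective F-cong ⟨
        sum {q} (λ y → F (ι (K.enum y))) ℤ.+ sum {r} (λ t → sum {q} (λ x → F (M₁ t x)))
          ≡⟨ ≡.cong₂ ℤ._+_ (≡.trans (K-sum F-cong) (≡.cong (λ z → F 0# ℤ.+ z) (∑<-cong r F-ι)))
                           (sum-cong-≗ {r} (λ t → sum-cong-≗ {q} (λ x → periodic-log per (e ℕ.* toℕ t ℕ.+ point-log x) (M₁-power t x)))) ⟩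
        (F 0# ℤ.+ ∑< r (λ i → f (e ℕ.* i ℕ.+ α-log))) ℤ.+ sum {r} (λ t → sum {q} (λ x → f (e ℕ.* toℕ t ℕ.+ point-log x))) ∎)
        where
        F : Carrier → ℤ
        F β = f (log (α * β))
        F-cong : Respects F
        F-cong eq = ≡.cong f (log-cong (*-congˡ eq))
        F-ι : ∀ i → F (ι (K.g K.^ i)) ≡ f (e ℕ.* i ℕ.+ α-log)
        F-ι i = periodic-log per (e ℕ.* i ℕ.+ α-log) (trans (*-comm _ _) (power-+ (e ℕ.* i) α-log (ιγ^ i) α-power))
        M₁-injective : ∀ t y t′ y′ → M₁ t y ≈ M₁ t′ y′ → (t ≡ t′) × (y ≡ y′)
        M₁-injective t y t′ y′ eq with scaled-point-injective (γ^ t) (K.enum y) (γ^ t′) (K.enum y′) (γ^-nonzero t) eq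
        ... | c≈ , x≈ = γ^-injective t t′ c≈ , K.enum-inj y y′ x≈

      line-ratios : ∀ f → Periodic N f →
        sum {q} (λ y → sum {q} (λ x → f (point-log x ℕ.+ (N ℕ.∸ point-log y)))) ℤ.+ ∑< r (λ i → f (e ℕ.* i)) ≡ + q ℤ.* f 0 ℤ.+ ∑< N f
      line-ratios f per = begin
        sum {q} (λ y → sum {q} (λ x → f (point-log x ℕ.+ (N ℕ.∸ point-log y)))) ℤ.+ E
          ≡⟨ ≡.cong (ℤ._+ E) (≡.trans (sum-cong-≗ {q} column) (∑-distrib-+ {q} (λ _ → f 0) (λ y → sum {r} (λ t → F (M₂ t y))))) ⟩
        (sum {q} (λ _ → f 0) ℤ.+ sum {q} (λ y → sum {r} (λ t → F (M₂ t y)))) ℤ.+ E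
          ≡⟨ ≡.cong₂ (λ u v → (u ℤ.+ v) ℤ.+ E) (sum-const q (f 0)) (∑-comm {q} {r} (λ y t → F (M₂ t y))) ⟩
        (+ q ℤ.* f 0 ℤ.+ G) ℤ.+ E
          ≡⟨ ℤₚ.+-assoc (+ q ℤ.* f 0) G E ⟩
        + q ℤ.* f 0 ℤ.+ (G ℤ.+ E)
          ≡⟨ ≡.cong (λ z → + q ℤ.* f 0 ℤ.+ z) (ℤ-cancel (F 0#) _ _ _ whole) ⟨
        + q ℤ.* f 0 ℤ.+ ∑< N f ∎
        where
        F : Carrier → ℤ
        F β = f (log β)
        F-cong : Respects F
        F-cong eq = ≡.cong f (log-cong eq)
        E = ∑< r (λ i → f (e ℕ.* i))
        G = sum {r} (λ t → sum {q} (λ y → F (M₂ t y)))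
        whole : F 0# ℤ.+ ∑< N f ≡ (F 0# ℤ.+ E) ℤ.+ G
        whole = begin
          F 0# ℤ.+ ∑< N f
            ≡⟨ powers-sum {F} (λ m → periodic-log per m refl) ⟨
          sum (λ i → F (powers {N} g i))
            ≡⟨ Grid.grid-sum M₂ M₂-∉ M₂-injective F-cong ⟨
          sum {q} (λ y → F (ι (K.enum y))) ℤ.+ G
            ≡⟨ ≡.cong (ℤ._+ G) (≡.trans (K-sum F-cong) (≡.cong (λ z → F 0# ℤ.+ z) (∑<-cong r (λ i → periodic-log per (e ℕ.* i) (ιγ^ i))))) ⟩
          (F 0# ℤ.+ E) ℤ.+ G ∎
        -- For fixed y the differences x - y run through K. The difference 0 gives the quotient 1,
        -- and the powers of the generator give the column y of `M₂`.
        column : ∀ y → sum {q} (λ x → f (point-log x ℕ.+ (N ℕ.∸ point-log y))) ≡ f 0 ℤ.+ sum {r} (λ t → F (M₂ t y))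
        column y = begin
          sum {q} (λ x → f (point-log x ℕ.+ (N ℕ.∸ point-log y)))
            ≡⟨ sum-cong-≗ {q} (λ x → ≡.trans (F-cong (difference-quotient y (K.enum x))) (periodic-log per (point-log x ℕ.+ (N ℕ.∸ point-log y)) (quotient-power y x))) ⟨
          sum {q} (λ x → H (K.enum x K.- K.enum y))
            ≡⟨ K.sum-enum H-cong (λ x → K.enum x K.- K.enum y) translate-injective ⟩
          sum {q} (λ x → H (K.enum x))
            ≡⟨ K.sum-enum H-cong (K.powers K.g) (K.powers-injective K.g-order) ⟨
          H K.0# ℤ.+ sum {r} (λ t → F (M₂ t y))
            ≡⟨ ≡.cong (ℤ._+ sum {r} (λ t → F (M₂ t y))) (periodic-log per 0 H-0) ⟩
          f 0 ℤ.+ sum {r} (λ t → F (M₂ t y)) ∎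
          where
          H : K.Carrier → ℤ
          H c = F (1# + ι c * w y)
          H-cong : K.Respects H
          H-cong eq = F-cong (+-congˡ (*-congʳ (⟦⟧-cong eq)))
          H-0 : 1# + ι K.0# * w y ≈ 1#
          H-0 = trans (+-congˡ (trans (*-congʳ 0#-homo) (zeroˡ _))) (+-identityʳ 1#)
          translate-injective : ∀ i j → K.enum i K.- K.enum y K.≈ K.enum j K.- K.enum y → i ≡ j
          translate-injective i j eq = K.enum-inj i j (K.trans (K.difference (K.enum i) (K.enum y))
            (K.trans (K.+-congˡ eq) (K.sym (K.difference (K.enum j) (K.enum y)))))

    logs : LineLogs r
    logs = record
      { r>0 = K.N>0
      ; e = e
      ; q+1∣e = *-cancelˡ-∣ r {{ℕ.>-nonZero K.N>0}} (≡.subst₂ _∣_ N≡n (ℕₚ.*-comm e r) N∣er)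
      ; a = point-log
      ; a∞ = α-log
      ; a≤n = λ x → ≡.subst (point-log x ℕ.≤_) N≡n (log-≤ _)
      ; cover = ≡.subst (λ m → ∀ f → Periodic m f → ∑< m f ≡ sum {r} (λ t → sum {q} (λ x → f (e ℕ.* toℕ t ℕ.+ point-log x))) ℤ.+ ∑< r (λ i → f (e ℕ.* i ℕ.+ α-log))) N≡n line-cover
      ; ratios = ≡.subst (λ m → ∀ f → Periodic m f → sum {q} (λ y → sum {q} (λ x → f (point-log x ℕ.+ (m ℕ.∸ point-log y)))) ℤ.+ ∑< r (λ i → f (e ℕ.* i)) ≡ + q ℤ.* f 0 ℤ.+ ∑< m f) N≡n line-ratios
      }
      where
      N∣er : N ∣ e ℕ.* r
      N∣er = proj₂ (proj₂ g-order) (e ℕ.* r) (trans (sym (ιγ^ r)) (trans (⟦⟧-cong K.gᴺ≈1) 1#-homo))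

    -- e = e′(q + 1) with e′ prime to q − 1, because ι(γ) still has order q − 1.
    e-cofactor : ∀ p → Prime p → p ∣ r → ¬ p ∣ _∣_.quotient (LineLogs.q+1∣e logs)
    e-cofactor p pp (divides r′ r≡) (divides e″ e′≡) = ℕₚ.<⇒≱ r′<r (∣⇒≤ {{ℕ.>-nonZero r′>0}} (proj₂ (proj₂ K.g-order) r′ γ^r′))
      where
      e′ = _∣_.quotient (LineLogs.q+1∣e logs)
      r′>0 : 0 ℕ.< r′
      r′>0 = ℕₚ.n≢0⇒n>0 (λ r′≡0 → ℕₚ.<⇒≢ K.N>0 (≡.sym (≡.trans r≡ (≡.cong (ℕ._* p) r′≡0))))
      r′<r : r′ ℕ.< r
      r′<r = ≡.subst (r′ ℕ.<_) (≡.sym r≡) (ℕₚ.m<m*n r′ p {{ℕ.>-nonZero r′>0}} (1<prime pp))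
      N∣ : N ∣ e ℕ.* r′
      N∣ = divides e″ (begin
        e ℕ.* r′                      ≡⟨ ≡.cong (ℕ._* r′) (≡.trans (_∣_.equality (LineLogs.q+1∣e logs)) (≡.cong (ℕ._* suc q) e′≡)) ⟩
        ((e″ ℕ.* p) ℕ.* suc q) ℕ.* r′ ≡⟨ shuffle e″ p (suc q) r′ ⟩
        e″ ℕ.* ((r′ ℕ.* p) ℕ.* suc q) ≡⟨ ≡.cong (λ z → e″ ℕ.* (z ℕ.* suc q)) r≡ ⟨
        e″ ℕ.* (r ℕ.* suc q)          ≡⟨ ≡.cong (e″ ℕ.*_) N≡n ⟨
        e″ ℕ.* N                      ∎)
        where
        open ≡.≡-Reasoning
        shuffle : ∀ a b c d → ((a ℕ.* b) ℕ.* c) ℕ.* d ≡ a ℕ.* ((d ℕ.* b) ℕ.* c)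
        shuffle = solve-ℕ
      γ^r′ : K.g K.^ r′ K.≈ K.1#
      γ^r′ = ι-injective (trans (ιγ^ r′) (trans (^-∣ {g} {N} gᴺ≈1 N∣) (sym 1#-homo)))

    -- Put k = 2k′ with k′ odd, and N = 2h. Then βʲ = 1 iff N ∣ kj iff h ∣ k′j iff h ∣ j, the last
    -- step because k′ is prime to h.
    two-primitive : ∀ x → 2 ∣ r → point-log x % 4 ≡ 2 → (∀ p → Prime p → ¬ p ≡ 2 → p ∣ N → ¬ p ∣ point-log x) →
                    TwoPrimitive L q (α * (θ + ι (K.enum x)))
    two-primitive x (divides c r≡) k%4≡2 avoids = ≡.subst (HasOrder L β) (≡.sym half) (h>0 , βʰ≈1 , λ j j>0 j<h βʲ≈1 → ℕₚ.<⇒≱ j<h (∣⇒≤ {{ℕ.>-nonZero j>0}} (h∣ j βʲ≈1)))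
      where
      β = α * (θ + ι (K.enum x))
      k = point-log x
      h = c ℕ.* suc q
      k′ = 1 ℕ.+ k / 4 ℕ.* 2
      N≡h*2 : N ≡ h ℕ.* 2
      N≡h*2 = ≡.trans N≡n (≡.trans (≡.cong (ℕ._* suc q) r≡) (shuffle c (suc q)))
        where
        shuffle : ∀ c s → (c ℕ.* 2) ℕ.* s ≡ (c ℕ.* s) ℕ.* 2
        shuffle = solve-ℕ
      half : N / 2 ≡ h
      half = ≡.trans (≡.cong (_/ 2) N≡h*2) (m*n/n≡m h 2)
      h>0 : 0 ℕ.< h
      h>0 = ℕₚ.n≢0⇒n>0 (λ h≡0 → ℕₚ.<⇒≢ N>0 (≡.sym (≡.trans N≡h*2 (≡.cong (ℕ._* 2) h≡0))))
      k≡ : k ≡ k′ ℕ.* 2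
      k≡ = ≡.trans (m≡m%n+[m/n]*n k 4) (≡.trans (≡.cong (ℕ._+ k / 4 ℕ.* 4) k%4≡2) (shuffle (k / 4)))
        where
        shuffle : ∀ d → 2 ℕ.+ d ℕ.* 4 ≡ (1 ℕ.+ d ℕ.* 2) ℕ.* 2
        shuffle = solve-ℕ
      β-power : ∀ j → β ^ j ≈ g ^ (k ℕ.* j)
      β-power j = trans (^-cong j (sym (g^log (α-point-nonzero x)))) (sym (^-* g k j))
      βʰ≈1 : β ^ h ≈ 1#
      βʰ≈1 = trans (β-power h) (^-∣ {g} {N} gᴺ≈1 (divides k′ (≡.trans (≡.cong (ℕ._* h) k≡)
        (≡.trans (ℕₚ.*-assoc k′ 2 h) (≡.cong (k′ ℕ.*_) (≡.trans (ℕₚ.*-comm 2 h) (≡.sym N≡h*2)))))))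
      h⟂k′ : Coprime h k′
      h⟂k′ = coprime-by-primes h>0 common
        where
        common : ∀ p → Prime p → p ∣ h → p ∣ k′ → p ≡ 1
        common p pp p∣h p∣k′ with p ℕₚ.≟ 2
        ... | yes ≡.refl = ∣1⇒≡1 (∣m+n∣m⇒∣n (≡.subst (2 ∣_) (ℕₚ.+-comm 1 (k / 4 ℕ.* 2)) p∣k′) (n∣m*n (k / 4)))
        ... | no p≢2 = contradiction (≡.subst (p ∣_) (≡.sym k≡) (∣-trans p∣k′ (m∣m*n 2)))
                                     (avoids p pp p≢2 (≡.subst (p ∣_) (≡.sym N≡h*2) (∣-trans p∣h (m∣m*n 2))))
      h∣ : ∀ j → β ^ j ≈ 1# → h ∣ j
      h∣ j βʲ≈1 = coprime-divisor h⟂k′ (*-cancelʳ-∣ 2 (≡.subst₂ _∣_ N≡h*2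
        (≡.trans (≡.cong (ℕ._* j) k≡) (shuffle k′ j)) (proj₂ (proj₂ g-order) (k ℕ.* j) (trans (sym (β-power j)) βʲ≈1))))
        where
        shuffle : ∀ a j → (a ℕ.* 2) ℕ.* j ≡ (a ℕ.* j) ℕ.* 2
        shuffle = solve-ℕ

-- The sieve inequality and numerical bounds for counts.

module Sieve where

  open import Data.Nat as ℕ using (ℕ; zero; suc; z≤n; s≤s)
  open import Data.Integer as ℤ using (ℤ; +_; 0ℤ; 1ℤ)
  open import Relation.Binary.PropositionalEquality
  open Sums
  open Lines
  open Factors
  open Estimates
  open Arith

  OddPrimeDivisor : ℕ → ℕ → Set
  OddPrimeDivisor m ℓ = Prime ℓ × (¬ ℓ ≡ 2) × (ℓ ∣ m)

  PrimeFactor : ℕ → Factor → Set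
  PrimeFactor m f = OddPrimeDivisor m (proj₁ f)

  _≢₁_ : Factor → Factor → Set
  f ≢₁ g = ¬ proj₁ f ≡ proj₁ g

  avoids : List ℕ → List Factor
  avoids = map (_, avoid)

  distinct-primes-coprime : ∀ {p p′} → Prime p → Prime p′ → ¬ p ≡ p′ → Coprime p p′
  distinct-primes-coprime pp pp′ p≢p′ = coprime-prime pp (λ p∣p′ → p≢p′ (prime-∣-prime pp pp′ p∣p′))

  -- The default at 0 lets the bounds be evaluated without evidence that a denominator is nonzero.
  _div_ : ℕ → ℕ → ℕ
  m div zero = 0
  m div suc d = m / suc d

  ≤-div : ∀ {c d m} → 0 ℕ.< d → d ℕ.* c ℕ.≤ m → c ℕ.≤ m div d
  ≤-div {c} {suc d} {m} _ le = subst (ℕ._≤ m / suc d) (m*n/n≡m c (suc d)) (/-monoˡ-≤ (suc d) (subst (ℕ._≤ m) (ℕₚ.*-comm (suc d) c) le))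

  div-≤ : ∀ {c d m} → m ℕ.≤ d ℕ.* c → m div d ℕ.≤ c
  div-≤ {c} {zero} {m} le = z≤n
  div-≤ {c} {suc d} {m} le = subst (m / suc d ℕ.≤_) (m*n/n≡m c (suc d)) (/-monoˡ-≤ (suc d) (subst (m ℕ.≤_) (ℕₚ.*-comm (suc d) c) le))

  scale>0 : ∀ fs → All Modulus fs → 0 ℕ.< scale fs
  scale>0 [] [] = s≤s z≤n
  scale>0 (f ∷ fs) (m ∷ ms) = ℕₚ.*-mono-≤ (ℕₚ.≤-trans (s≤s z≤n) m) (scale>0 fs ms)

  error : ℕ → ℕ → Bool → Bool → List Factor → List Factor → ℕ
  error t s one b fs gs = t ℕ.* exactError one b fs gs ℕ.+ s ℕ.* rootError one b fs gs

  denominator : ℕ → Bool → List Factor → List Factor → ℕ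
  denominator t b fs gs = t ℕ.* (twoScale b ℕ.* scale (fs ++ gs))

  expected : ℕ → ℕ → List Factor → List Factor → ℕ
  expected t q fs gs = t ℕ.* (mainTerm fs ℕ.* (mainTerm gs ℕ.* q))

  -- A count is an integer, so the upper bound may be rounded down. If the error exceeds the main
  -- term, truncated subtraction leaves the valid lower bound 0.
  upper lower : ℕ → ℕ → ℕ → Bool → Bool → List Factor → List Factor → ℕ
  upper t s q one b fs gs = (expected t q fs gs ℕ.+ error t s one b fs gs) div denominator t b fs gs
  lower t s q one b fs gs = (expected t q fs gs ℕ.∸ error t s one b fs gs) div denominator t b fs gs

  isEven : ℕ → Bool
  isEven h = h % 2 ℕ.≡ᵇ 0

  module Sieving (h : ℕ) (L : LineLogs (h ℕ.* 2))
    (cofactor : ∀ p → Prime p → p ∣ h ℕ.* 2 → ¬ p ∣ _∣_.quotient (LineLogs.q+1∣e L)) where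
    open LineLogs L
    private
      r = h ℕ.* 2
      e′ = _∣_.quotient q+1∣e

    2∣q+1 : 2 ∣ suc q
    2∣q+1 = divides (suc h) refl

    odd-prime-∤ : ∀ {p} → Prime p → ¬ p ≡ 2 → p ∣ r → ¬ p ∣ suc q
    odd-prime-∤ {p} pp p≢2 p∣r p∣q+1 = p≢2 (prime-∣-prime pp prime[2] (∣m+n∣m⇒∣n (subst (p ∣_) (ℕₚ.+-comm 2 r) p∣q+1) p∣r))

    coprime-e : ∀ {p} → Prime p → ¬ p ≡ 2 → p ∣ r → Coprime p e
    coprime-e pp p≢2 p∣r = coprime-prime pp λ p∣e → case-e (euclidsLemma e′ (suc q) pp (subst (_ ∣_) (_∣_.equality q+1∣e) p∣e))
      where
      case-e : ¬ (_ ∣ e′ ⊎ _ ∣ suc q)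
      case-e (inj₁ p∣e′) = cofactor _ pp p∣r p∣e′
      case-e (inj₂ p∣q+1) = odd-prime-∤ pp p≢2 p∣r p∣q+1

    -- For even h, q ≡ 1 (mod 4), and e = e′(q + 1) with e′ odd and q + 1 ≡ 2 (mod 4). For odd h, q
    -- + 1 = 2(h + 1) is divisible by 4.
    quartic : Quartic L (isEven h)
    quartic = by-parity (h % 2) refl (m%n<n h 2)
      where
      by-parity : ∀ k → h % 2 ≡ k → k ℕ.< 2 → Quartic L (k ℕ.≡ᵇ 0)
      by-parity 0 h%2≡0 _ = e%4≡2 , ∣-trans 4∣r (m∣m*n (suc q)) , 2∣q+1
        where
        4∣r : 4 ∣ r
        4∣r = *-monoˡ-∣ 2 (m%n≡0⇒n∣m h 2 h%2≡0)
        e′-odd : e′ % 2 ≡ 1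
        e′-odd = by (e′ % 2) refl (m%n<n e′ 2)
          where
          by : ∀ k → e′ % 2 ≡ k → k ℕ.< 2 → k ≡ 1
          by 0 eq _ = contradiction (m%n≡0⇒n∣m e′ 2 eq) (cofactor 2 prime[2] (n∣m*n h))
          by 1 eq _ = refl
          by (suc (suc _)) eq (s≤s (s≤s ()))
        q+1%4 : suc q % 4 ≡ 2
        q+1%4 = trans (%-distribˡ-+ 2 r 4) (cong (λ z → (2 ℕ.+ z) % 4) (n∣m⇒m%n≡0 r 4 4∣r))
        double : ∀ k → k % 2 ≡ 1 → (k % 4 ℕ.* 2) % 4 ≡ 2
        double k eq with k % 4 | m∣n⇒o%n%m≡o%m 2 4 k (divides 2 refl) | m%n<n k 4
        ... | 0 | eq′ | _ = contradiction (trans eq′ eq) λ ()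
        ... | 1 | eq′ | _ = refl
        ... | 2 | eq′ | _ = contradiction (trans eq′ eq) λ ()
        ... | 3 | eq′ | _ = refl
        ... | suc (suc (suc (suc _))) | _ | s≤s (s≤s (s≤s (s≤s ())))
        e%4≡2 : e % 4 ≡ 2
        e%4≡2 = trans (cong (_% 4) (_∣_.equality q+1∣e)) (trans (%-distribˡ-* e′ (suc q) 4)
          (trans (cong (λ z → (e′ % 4 ℕ.* z) % 4) q+1%4) (double e′ e′-odd)))
      by-parity 1 h%2≡1 _ = *-monoˡ-∣ 2 (m%n≡0⇒n∣m (suc h) 2 (trans (%-distribˡ-+ 1 h 2) (cong (λ z → (1 ℕ.+ z) % 2) h%2≡1)))
      by-parity (suc (suc _)) _ (s≤s (s≤s ()))

    MinusSide PlusSide : List Factor → Set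
    MinusSide fs = All (PrimeFactor r) fs × AllPairs _≢₁_ fs
    PlusSide gs = All (PrimeFactor (suc q)) gs × AllPairs _≢₁_ gs

    admissible : ∀ {fs gs} → MinusSide fs → PlusSide gs → Admissible L fs gs
    admissible {fs} {gs} (minus , fs≢) (plus , gs≢) = record
      { moduli = Allₚ.++⁺ (All.map (1<prime ∘ proj₁) minus) (All.map (1<prime ∘ proj₁) plus)
      ; minus = minus-factors minus
      ; plus = All.map (proj₂ ∘ proj₂) plus
      ; odd = Allₚ.++⁺ (odds minus) (odds plus)
      ; coprime = AllPairsₚ.++⁺ (pairs minus fs≢) (pairs plus gs≢) (All.map (λ {f} m → cross f m plus) minus)
      }
      where
      minus-factors : ∀ {hs} → All (PrimeFactor r) hs → All (MinusFactor L) hs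
      minus-factors [] = []
      minus-factors {(p , k) ∷ _} ((pp , p≢2 , p∣r) ∷ ps) = (∣-trans p∣r (m∣m*n (suc q)) , coprime-e pp p≢2 p∣r) ∷ minus-factors ps
      odds : ∀ {m hs} → All (PrimeFactor m) hs → All (λ f → Coprime (proj₁ f) 2) hs
      odds [] = []
      odds ((pp , p≢2 , _) ∷ ps) = distinct-primes-coprime pp prime[2] p≢2 ∷ odds ps
      all-coprime : ∀ {m} f {hs} → Prime (proj₁ f) → All (f ≢₁_) hs → All (PrimeFactor m) hs → All (f ⟂_) hs
      all-coprime f pp [] [] = []
      all-coprime f pp (≢ ∷ ≢s) ((pp′ , _) ∷ ps) = distinct-primes-coprime pp pp′ ≢ ∷ all-coprime f pp ≢s ps
      pairs : ∀ {m hs} → All (PrimeFactor m) hs → AllPairs _≢₁_ hs → AllPairs _⟂_ hs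
      pairs [] [] = []
      pairs {hs = f ∷ _} ((pp , _) ∷ ps) (≢s ∷ rest) = all-coprime f pp ≢s ps ∷ pairs ps rest
      cross : ∀ f {hs} → PrimeFactor r f → All (PrimeFactor (suc q)) hs → All (f ⟂_) hs
      cross f _ [] = []
      cross f m@(pp , p≢2 , p∣r) ((pp′ , _ , p′∣) ∷ ps) =
        distinct-primes-coprime pp pp′ (λ { refl → odd-prime-∤ pp p≢2 p∣r p′∣ }) ∷ cross f m ps

    module _ {t s : ℕ} (t>0 : 0 ℕ.< t) (t²q≤s² : t ℕ.* t ℕ.* q ℕ.≤ s ℕ.* s) {fs gs : List Factor} (minus : MinusSide fs) (plus : PlusSide gs) (b : Bool) where
      private
        adm = admissible minus plus
        D>0 : 0 ℕ.< denominator t b fs gs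
        D>0 = ℕₚ.*-mono-≤ t>0 (ℕₚ.*-mono-≤ {1} {twoScale b} (twoScale>0 b) (scale>0 (fs ++ gs) (Admissible.moduli adm)))
          where
          twoScale>0 : ∀ b → 0 ℕ.< twoScale b
          twoScale>0 true = s≤s z≤n
          twoScale>0 false = s≤s z≤n
        assoc : denominator t b fs gs ℕ.* count L b (fs ++ gs) ≡ t ℕ.* (twoScale b ℕ.* scale (fs ++ gs) ℕ.* count L b (fs ++ gs))
        assoc = ℕₚ.*-assoc t _ _

      count-≤-upper : count L b (fs ++ gs) ℕ.≤ upper t s q (isEven h) b fs gs
      count-≤-upper = ≤-div D>0 (ℕₚ.≤-trans (ℕₚ.≤-reflexive assoc) (count-upper L {t} {s} t²q≤s² adm (isEven h) b quartic 2∣q+1))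

      lower-≤-count : lower t s q (isEven h) b fs gs ℕ.≤ count L b (fs ++ gs)
      lower-≤-count = div-≤ {d = denominator t b fs gs} (ℕₚ.≤-trans (ℕₚ.m≤n+o⇒m∸n≤o _ (error t s (isEven h) b fs gs)
        (subst (expected t q fs gs ℕ.≤_) (ℕₚ.+-comm _ (error t s (isEven h) b fs gs)) (count-lower L {t} {s} t²q≤s² adm (isEven h) b quartic 2∣q+1)))
        (ℕₚ.≤-reflexive (sym assoc)))

    count-split : ∀ b ℓ hs → count L b hs ℕ.≤ count L b ((ℓ , avoid) ∷ hs) ℕ.+ count L b ((ℓ , hit) ∷ hs)
    count-split b ℓ hs = ℤₚ.drop‿+≤+ (subst₂ ℤ._≤_ (sym (+count L b hs))
      (trans (∑-distrib-+ {q} (λ x → 𝟙 (test? b ((ℓ , avoid) ∷ hs) (a x))) (λ x → 𝟙 (test? b ((ℓ , hit) ∷ hs) (a x))))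
        (trans (cong₂ ℤ._+_ (sym (+count L b ((ℓ , avoid) ∷ hs))) (sym (+count L b ((ℓ , hit) ∷ hs)))) (sym (ℤₚ.pos-+ _ (count L b ((ℓ , hit) ∷ hs))))))
      (sum-mono {q} (λ x → pointwise (a x) (test? b hs (a x)) (test? b ((ℓ , avoid) ∷ hs) (a x)) (test? b ((ℓ , hit) ∷ hs) (a x)))))
      where
      pointwise : ∀ k (d : Dec (Test b hs k)) (d₁ : Dec (Test b ((ℓ , avoid) ∷ hs) k)) (d₂ : Dec (Test b ((ℓ , hit) ∷ hs) k)) → 𝟙 d ℤ.≤ 𝟙 d₁ ℤ.+ 𝟙 d₂
      pointwise k (no _) d₁ d₂ = ℤₚ.+-mono-≤ (𝟙-nonneg d₁) (𝟙-nonneg d₂)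
      pointwise k (yes _) (yes _) d₂ = ℤₚ.+-mono-≤ {1ℤ} {1ℤ} ℤₚ.≤-refl (𝟙-nonneg d₂)
      pointwise k (yes _) (no _) (yes _) = ℤₚ.≤-refl
      pointwise k (yes (two , all)) (no ¬avoid) (no ¬hit) with ℓ ∣? k
      ... | yes ℓ∣k = contradiction (two , ℓ∣k ∷ all) ¬hit
      ... | no ℓ∤k = contradiction (two , ℓ∤k ∷ all) ¬avoid

    hits : List ℕ → List Factor → ℕ
    hits [] hs = 0
    hits (ℓ ∷ ℓs) hs = count L true ((ℓ , hit) ∷ hs) ℕ.+ hits ℓs hs

    -- A point lost to the sieve is charged to a sieved prime dividing its logarithm; the other
    -- sieved conditions are dropped from the charge.
    sieve-bound : ∀ ℓs hs → count L true hs ℕ.≤ count L true (avoids ℓs ++ hs) ℕ.+ hits ℓs hs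
    sieve-bound [] hs = ℕₚ.≤-reflexive (sym (ℕₚ.+-identityʳ _))
    sieve-bound (ℓ ∷ ℓs) hs = ℕₚ.≤-trans (sieve-bound ℓs hs)
      (ℕₚ.≤-trans (ℕₚ.+-monoˡ-≤ (hits ℓs hs) (ℕₚ.≤-trans (count-split true ℓ (avoids ℓs ++ hs))
        (ℕₚ.+-monoʳ-≤ _ (count-mono L true true ((ℓ , hit) ∷ avoids ℓs ++ hs) ((ℓ , hit) ∷ hs) (λ { k (two , ℓ∣k ∷ all) → two , ℓ∣k ∷ Allₚ.++⁻ʳ (avoids ℓs) all })))))
        (ℕₚ.≤-reflexive (ℕₚ.+-assoc (count L true (avoids (ℓ ∷ ℓs) ++ hs)) _ (hits ℓs hs))))

    count-witness : ∀ b hs → 0 ℕ.< count L b hs → ∃ λ x → Test b hs (a x)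
    count-witness b hs pos with Finₚ.any? (λ x → test? b hs (a x))
    ... | yes found = found
    ... | no none = contradiction pos (ℕₚ.<-irrefl (sym zero-count))
      where
      vanish : ∀ x (d : Dec (Test b hs (a x))) → 𝟙 d ≡ 0ℤ
      vanish x (yes p) = contradiction (x , p) none
      vanish x (no _) = refl
      zero-count : count L b hs ≡ 0
      zero-count = ℤₚ.+-injective (trans (+count L b hs)
        (trans (sum-cong-≗ {q} (λ x → vanish x (test? b hs (a x)))) (trans (sum-const q 0ℤ) (ℤₚ.*-zeroʳ (+ q)))))

    sieve : ∀ ℓs hs → hits ℓs hs ℕ.< count L true hs → ∃ λ x → Test true (avoids ℓs ++ hs) (a x)
    sieve ℓs hs lt = count-witness true (avoids ℓs ++ hs)
      (ℕₚ.+-cancelʳ-< (hits ℓs hs) 0 _ (ℕₚ.<-≤-trans lt (sieve-bound ℓs hs)))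

-- Evaluation of the criterion for small q.

module Search where

  open import Data.Nat as ℕ using (ℕ; zero; suc; z≤n; s≤s; _+_; _*_; _≤_; _<_; _^_; _⊓_)
  open import Data.List.Membership.DecPropositional ℕₚ._≟_ using (_∈?_)
  open import Data.List.Relation.Binary.Sublist.Propositional using (_⊆_; []; _∷_; _∷ʳ_; ⊆-refl; ⊆-trans)
  open import Data.List.Relation.Binary.Sublist.Propositional.Properties using (All-resp-⊆)
  open import Relation.Binary.PropositionalEquality
  open import Defs using (excluded)
  open Lines
  open Factors
  open Estimates
  open Arith
  open Sieve

  _mod_ : ℕ → ℕ → ℕ
  m mod zero = m
  m mod suc d = m % suc d

  divides? : ℕ → ℕ → Bool
  divides? d m = (m mod d) ℕ.≡ᵇ 0

  strip : ℕ → ℕ → ℕ → ℕ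
  strip zero d m = m
  strip (suc f) d m = if divides? d m then strip f d (m div d) else m

  mutual
    trial : ℕ → ℕ → ℕ → List ℕ
    trial zero d m = cofactor m
    trial (suc f) d m = if m ℕ.<ᵇ d * d then cofactor m else continue f d m (divides? d m)

    continue : ℕ → ℕ → ℕ → Bool → List ℕ
    continue f d m true = d ∷ trial f (2 + d) (strip 17 d m)
    continue f d m false = trial f (2 + d) m

    cofactor : ℕ → List ℕ
    cofactor m = if m ℕ.≡ᵇ 1 then [] else m ∷ []

  -- For m ≤ 70000 the fuel is enough: the last trial divisor 3 + 2 · 131 exceeds √m, and m < 2 ^ 17.
  oddPrimes : ℕ → List ℕ
  oddPrimes m = trial 131 3 (strip 17 2 m)

  sublists : List ℕ → List (List ℕ)
  sublists [] = [] ∷ []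
  sublists (x ∷ xs) = map (x ∷_) (sublists xs) ++ sublists xs

  -- Among the primes dividing q ∓ 1, those up to z form the core and the others are sieved.
  small large : ℕ → List ℕ → List ℕ
  small z [] = []
  small z (x ∷ xs) = if z ℕ.<ᵇ x then small z xs else x ∷ small z xs
  large z [] = []
  large z (x ∷ xs) = if z ℕ.<ᵇ x then x ∷ large z xs else large z xs

  Option : Set
  Option = List ℕ × List ℕ × Bool

  -- A sieved prime ℓ is counted under any subset of the core conditions; the smallest bound is used.
  options : Bool → List ℕ → List ℕ → List Option
  options false Ym Yp = []
  options true Ym Yp = concatMap (λ ym → concatMap (λ yp → (ym , yp , true) ∷ (ym , yp , false) ∷ []) (sublists Yp)) (sublists Ym)

  module Check (q s : ℕ) (one : Bool) where
    evaluate : List Factor → List Factor → Option → ℕ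
    evaluate bm bp (ym , yp , b) = upper 100 s q one b (bm ++ avoids ym) (bp ++ avoids yp)

    hitBound : Bool → List ℕ → List ℕ → List Factor → List Factor → ℕ
    hitBound deep Ym Yp bm bp = foldr (λ o best → evaluate bm bp o ⊓ best) (evaluate bm bp (Ym , Yp , true)) (options deep Ym Yp)

    hitsBound : Bool → List ℕ → List ℕ → List ℕ → List ℕ → ℕ
    hitsBound deep Ym Yp [] [] = 0
    hitsBound deep Ym Yp [] (ℓ ∷ ℓs) = hitBound deep Ym Yp [] ((ℓ , hit) ∷ []) + hitsBound deep Ym Yp [] ℓs
    hitsBound deep Ym Yp (ℓ ∷ ℓs) ks = hitBound deep Ym Yp ((ℓ , hit) ∷ []) [] + hitsBound deep Ym Yp ℓs ks

    attempt : List ℕ → List ℕ → Bool → ℕ → Bool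
    attempt Pm Pp deep z = hitsBound deep (small z Pm) (small z Pp) (large z Pm) (large z Pp)
      ℕ.<ᵇ lower 100 s q one true (avoids (small z Pm)) (avoids (small z Pp))

    attempts : Bool → List ℕ → List ℕ → List ℕ → Bool
    attempts deep [] Pm Pp = false
    attempts deep (z ∷ zs) Pm Pp = if attempt Pm Pp deep z then true else attempts deep zs Pm Pp

  newton : ℕ → ℕ → ℕ → ℕ
  -- The iterates settle near the integer part of the root, so one is added in order to end above
  -- it.
  newton zero N x = suc x
  newton (suc f) N x = newton f N ((x + N div x) div 2)

  -- The value 1 means an empty core, with every odd prime sieved.
  thresholds : List ℕ
  thresholds = 7 ∷ 3 ∷ 1 ∷ []

  -- The first round is cheap: a sieved prime is counted under all core conditions only. The minimum
  -- over all subsets of the core, and further thresholds, are tried when that fails.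
  criterion : ℕ → ℕ → Bool → List ℕ → List ℕ → Bool
  criterion q s one Pm Pp = if 100 * 100 * q ℕ.≤ᵇ s * s
    then (if attempts false thresholds Pm Pp then true else attempts true (thresholds ++ 5 ∷ 11 ∷ 13 ∷ 17 ∷ []) Pm Pp)
    else false
    where open Check q s one

  -- Applied to the odd primes dividing q: two of them show that q is not a prime power, so such q
  -- are passed over.
  manyPrimes : List ℕ → Bool
  manyPrimes (_ ∷ _ ∷ _) = true
  manyPrimes _ = false

  checkWith : List ℕ → ℕ → ℕ → Bool → List ℕ → List ℕ → List ℕ → Bool
  checkWith exceptions q s one Pq Pm Pp = if manyPrimes Pq then true else (if criterion q s one Pm Pp then true else does (q ∈? exceptions))

  checkAll : (ℕ → Bool) → ℕ → ℕ → Bool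
  checkAll P zero h = true
  checkAll P (suc f) h = if P h then checkAll P f (suc h) else false

  if-or : ∀ b {c} → (if b then true else c) ≡ true → b ≡ true ⊎ c ≡ true
  if-or true eq = inj₁ refl
  if-or false eq = inj₂ eq

  if-and : ∀ b {c} → (if b then c else false) ≡ true → b ≡ true × c ≡ true
  if-and true eq = refl , eq

  <ᵇ-true : ∀ {m n} → (m ℕ.<ᵇ n) ≡ true → m < n
  <ᵇ-true {m} {n} eq = ℕₚ.<ᵇ⇒< m n (Equivalence.from T-≡ eq)

  <ᵇ-false : ∀ {m n} → (m ℕ.<ᵇ n) ≡ false → n ≤ m
  <ᵇ-false eq = ℕₚ.≮⇒≥ (λ m<n → contradiction (trans (sym eq) (Equivalence.to T-≡ (ℕₚ.<⇒<ᵇ m<n))) λ ())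

  ≡ᵇ-true : ∀ {m n} → (m ℕ.≡ᵇ n) ≡ true → m ≡ n
  ≡ᵇ-true {m} {n} eq = ℕₚ.≡ᵇ⇒≡ m n (Equivalence.from T-≡ eq)

  ≡ᵇ-false : ∀ {m n} → (m ℕ.≡ᵇ n) ≡ false → ¬ m ≡ n
  ≡ᵇ-false {m} {n} eq m≡n = contradiction (trans (sym eq) (Equivalence.to T-≡ (ℕₚ.≡⇒≡ᵇ m n m≡n))) λ ()

  divides?-true : ∀ {d} m → 0 < d → divides? d m ≡ true → d ∣ m
  divides?-true {suc d} m _ eq = m%n≡0⇒n∣m m (suc d) (≡ᵇ-true eq)

  divides?-false : ∀ {d} m → 0 < d → divides? d m ≡ false → ¬ d ∣ m
  divides?-false {suc d} m _ eq d∣m = ≡ᵇ-false eq (n∣m⇒m%n≡0 m (suc d) d∣m)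

  *-div : ∀ c {d} → 0 < d → (c * d) div d ≡ c
  *-div c {suc d} _ = m*n/n≡m c (suc d)

  record Stripped (d m m′ : ℕ) : Set where
    field
      m′∣m   : m′ ∣ m
      m′>0   : 0 < m′
      d∤m′   : ¬ d ∣ m′
      primes : ∀ p → Prime p → p ∣ m → p ≡ d ⊎ p ∣ m′

  factorˡ>0 : ∀ a b → 0 < a * b → 0 < a
  factorˡ>0 (suc a) b _ = s≤s z≤n

  -- Each division by d ≥ 2 at least halves m, so f steps suffice when m < 2ᶠ.
  strip-spec : ∀ f {d} m → Prime d → 0 < m → m < 2 ^ f → Stripped d m (strip f d m)
  strip-spec zero (suc m) pd m>0 (s≤s ())
  strip-spec (suc f) {d} m pd m>0 m<2ᶠ = by (divides? d m) refl
    where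
    d>0 : 0 < d
    d>0 = ℕₚ.<-trans ℕₚ.0<1+n (1<prime pd)
    by : ∀ b → divides? d m ≡ b → Stripped d m (if b then strip f d (m div d) else m)
    by false eq = record { m′∣m = ∣-refl ; m′>0 = m>0 ; d∤m′ = divides?-false m d>0 eq ; primes = λ p pp p∣m → inj₂ p∣m }
    by true eq = quotient (divides?-true m d>0 eq)
      where
      quotient : d ∣ m → Stripped d m (strip f d (m div d))
      quotient (divides c refl) = subst (λ z → Stripped d m (strip f d z)) (sym (*-div c d>0)) record
        { m′∣m = ∣-trans m′∣m (m∣m*n d) ; m′>0 = m′>0 ; d∤m′ = d∤m′
        ; primes = λ p pp p∣m → split p pp (euclidsLemma c d pp p∣m) }
        where
        c<2ᶠ : c < 2 ^ f
        c<2ᶠ = ℕₚ.*-cancelˡ-< 2 c (2 ^ f) (ℕₚ.≤-<-trans (subst (2 * c ≤_) (ℕₚ.*-comm d c) (ℕₚ.*-monoˡ-≤ c (1<prime pd))) m<2ᶠ)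
        open Stripped (strip-spec f {d} c pd (factorˡ>0 c d m>0) c<2ᶠ)
        split : ∀ p → Prime p → p ∣ c ⊎ p ∣ d → p ≡ d ⊎ p ∣ strip f d c
        split p pp (inj₁ p∣c) = primes p pp p∣c
        split p pp (inj₂ p∣d) = inj₁ (prime-∣-prime pp pd p∣d)

  record PrimesOf (m : ℕ) (ℓs : List ℕ) : Set where
    field
      sound    : All (λ ℓ → Prime ℓ × ℓ ∣ m) ℓs
      distinct : AllPairs (λ ℓ ℓ′ → ¬ ℓ ≡ ℓ′) ℓs
      complete : ∀ p → Prime p → p ∣ m → p ∈ ℓs

  prime-∤1 : ∀ {p} → Prime p → ¬ p ∣ 1
  prime-∤1 pp p∣1 = ℕₚ.<⇒≱ (1<prime pp) (∣⇒≤ p∣1)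

  cofactor-spec : ∀ {d} m → 0 < m → d Rough m → m < d * d → PrimesOf m (cofactor m)
  cofactor-spec 1 _ _ _ = record { sound = [] ; distinct = [] ; complete = λ p pp p∣1 → contradiction p∣1 (prime-∤1 pp) }
  cofactor-spec m@(suc (suc _)) _ rough m<d² = record
    { sound = (pm , ∣-refl) ∷ [] ; distinct = [] ∷ [] ; complete = λ p pp p∣m → here (prime-∣-prime pp pm p∣m) }
    where pm = rough∧square>⇒prime rough m<d²

  odd⇒2∣suc : ∀ d → ¬ 2 ∣ d → 2 ∣ suc d
  odd⇒2∣suc zero 2∤0 = contradiction (divides 0 refl) 2∤0
  odd⇒2∣suc 1 _ = ∣-refl
  odd⇒2∣suc (suc (suc d)) 2∤ = step (odd⇒2∣suc d (λ { (divides c eq) → 2∤ (divides (suc c) (cong (2 +_) eq)) }))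
    where
    step : 2 ∣ suc d → 2 ∣ suc (suc (suc d))
    step (divides c eq) = divides (suc c) (cong (2 +_) eq)

  rough-skip : ∀ {d m} → ¬ 2 ∣ d → ¬ 2 ∣ m → ¬ d ∣ m → d Rough m → (2 + d) Rough m
  rough-skip 2∤d 2∤m d∤m rough = ∤⇒rough-suc (λ d+1∣m → 2∤m (∣-trans (odd⇒2∣suc _ 2∤d) d+1∣m)) (∤⇒rough-suc d∤m rough)

  2∤2+ : ∀ {d} → ¬ 2 ∣ d → ¬ 2 ∣ 2 + d
  2∤2+ 2∤d (divides (suc c) eq) = 2∤d (divides c (ℕₚ.suc-injective (ℕₚ.suc-injective eq)))

  -- Nothing below d except 1 divides m. Hence a d that divides m is prime, although all odd d are
  -- tried, and a cofactor below d² is prime or 1. The last hypothesis says that the remaining fuel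
  -- reaches beyond √m.
  trial-spec : ∀ f d m → 2 < d → ¬ 2 ∣ d → 0 < m → ¬ 2 ∣ m → d Rough m → m < 2 ^ 17 → m < (2 * f + d) * (2 * f + d) → PrimesOf m (trial f d m)
  trial-spec zero d m _ _ m>0 _ rough _ m<d² = cofactor-spec m m>0 rough m<d²
  trial-spec (suc f) d m d>2 2∤d m>0 2∤m rough m<2¹⁷ m<d² = by (m ℕ.<ᵇ d * d) refl
    where
    shift : (2 * suc f + d) ≡ 2 * f + (2 + d)
    shift = trans (cong (_+ d) (trans (ℕₚ.*-suc 2 f) (ℕₚ.+-comm 2 (2 * f)))) (ℕₚ.+-assoc (2 * f) 2 d)
    m<d²′ : m < (2 * f + (2 + d)) * (2 * f + (2 + d))
    m<d²′ = subst (λ z → m < z * z) shift m<d²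
    d>0 : 0 < d
    d>0 = ℕₚ.<-trans ℕₚ.0<1+n d>2
    by-divides : ∀ b → divides? d m ≡ b → PrimesOf m (continue f d m b)
    by-divides false eq = trial-spec f (2 + d) m (ℕₚ.m≤n⇒m≤o+n 2 d>2) (2∤2+ 2∤d) m>0 2∤m
      (rough-skip 2∤d 2∤m (divides?-false m d>0 eq) rough) m<2¹⁷ m<d²′
    by-divides true eq = record
      { sound = (pd , d∣m) ∷ All.map (λ (pℓ , ℓ∣m′) → pℓ , ∣-trans ℓ∣m′ m′∣m) sound
      ; distinct = All.map (λ (pℓ , ℓ∣m′) d≡ℓ → d∤m′ (subst (_∣ m′) (sym d≡ℓ) ℓ∣m′)) sound ∷ distinct
      ; complete = λ p pp p∣m → member p pp (primes p pp p∣m) }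
      where
      d∣m = divides?-true m d>0 eq
      pd : Prime d
      pd = rough∧∣⇒prime {{ℕ.n>1⇒nonTrivial (ℕₚ.<-trans (s≤s (s≤s z≤n)) d>2)}} rough d∣m
      m′ = strip 17 d m
      open Stripped (strip-spec 17 {d} m pd m>0 m<2¹⁷)
      2∤m′ : ¬ 2 ∣ m′
      2∤m′ 2∣m′ = 2∤m (∣-trans 2∣m′ m′∣m)
      m′≤m : m′ ≤ m
      m′≤m = ∣⇒≤ {{ℕ.>-nonZero m>0}} m′∣m
      open PrimesOf (trial-spec f (2 + d) m′ (ℕₚ.m≤n⇒m≤o+n 2 d>2) (2∤2+ 2∤d) m′>0 2∤m′
        (rough-skip 2∤d 2∤m′ d∤m′ (rough∧∣⇒rough rough m′∣m)) (ℕₚ.≤-<-trans m′≤m m<2¹⁷) (ℕₚ.≤-<-trans m′≤m m<d²′))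
      member : ∀ p → Prime p → p ≡ d ⊎ p ∣ m′ → p ∈ d ∷ trial f (2 + d) m′
      member p pp (inj₁ p≡d) = here p≡d
      member p pp (inj₂ p∣m′) = there (complete p pp p∣m′)
    by : ∀ b → (m ℕ.<ᵇ d * d) ≡ b → PrimesOf m (if b then cofactor m else continue f d m (divides? d m))
    by true eq = cofactor-spec m m>0 rough (<ᵇ-true eq)
    by false eq = by-divides (divides? d m) refl

  record OddPrimesOf (m : ℕ) (ℓs : List ℕ) : Set where
    field
      sound    : All (OddPrimeDivisor m) ℓs
      distinct : AllPairs (λ ℓ ℓ′ → ¬ ℓ ≡ ℓ′) ℓs
      complete : ∀ p → Prime p → ¬ p ≡ 2 → p ∣ m → p ∈ ℓs

  2∤3 : ¬ 2 ∣ 3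
  2∤3 (divides 1 ())
  2∤3 (divides (suc (suc c)) ())

  oddPrimes-spec : ∀ m → 0 < m → m ≤ 70000 → OddPrimesOf m (oddPrimes m)
  oddPrimes-spec m m>0 m≤ = record
    { sound = All.map (λ (pℓ , ℓ∣m′) → pℓ , (λ { refl → d∤m′ ℓ∣m′ }) , ∣-trans ℓ∣m′ m′∣m) sound
    ; distinct = distinct
    ; complete = λ p pp p≢2 p∣m → odd p pp p≢2 (primes p pp p∣m) }
    where
    m<2¹⁷ : m < 2 ^ 17
    m<2¹⁷ = ℕₚ.≤-<-trans m≤ (<ᵇ-true {70000} {2 ^ 17} refl)
    m′ = strip 17 2 m
    open Stripped (strip-spec 17 {2} m prime[2] m>0 m<2¹⁷)
    m′≤m : m′ ≤ m
    m′≤m = ∣⇒≤ {{ℕ.>-nonZero m>0}} m′∣m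
    open PrimesOf (trial-spec 131 3 m′ ℕₚ.≤-refl 2∤3 m′>0 d∤m′ (∤⇒rough-suc d∤m′ 2-rough)
      (ℕₚ.≤-<-trans m′≤m m<2¹⁷) (ℕₚ.≤-<-trans m′≤m (ℕₚ.≤-<-trans m≤ (<ᵇ-true {70000} {265 * 265} refl))))
    odd : ∀ p → Prime p → ¬ p ≡ 2 → p ≡ 2 ⊎ p ∣ m′ → p ∈ trial 131 3 m′
    odd p pp p≢2 (inj₁ p≡2) = contradiction p≡2 p≢2
    odd p pp p≢2 (inj₂ p∣m′) = complete p pp p∣m′

  manyPrimes-sound : ∀ {p k q ℓs} → Prime p → q ≡ p ^ k → OddPrimesOf q ℓs → ¬ manyPrimes ℓs ≡ true
  manyPrimes-sound {p} {k} {ℓs = ℓ ∷ ℓ′ ∷ _} pp refl record { sound = (pℓ , _ , ℓ∣q) ∷ (pℓ′ , _ , ℓ′∣q) ∷ _ ; distinct = (ℓ≢ℓ′ ∷ _) ∷ _ } _ =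
    ℓ≢ℓ′ (trans (prime-∣-prime pℓ pp (prime-∣^ k pℓ ℓ∣q)) (sym (prime-∣-prime pℓ′ pp (prime-∣^ k pℓ′ ℓ′∣q))))

  sublists-⊆ : ∀ xs → All (_⊆ xs) (sublists xs)
  sublists-⊆ [] = [] ∷ []
  sublists-⊆ (x ∷ xs) = Allₚ.++⁺ (Allₚ.map⁺ (All.map (refl ∷_) (sublists-⊆ xs))) (All.map (x ∷ʳ_) (sublists-⊆ xs))

  allPairs-⊆ : ∀ {R : ℕ → ℕ → Set} {xs ys} → xs ⊆ ys → AllPairs R ys → AllPairs R xs
  allPairs-⊆ [] [] = []
  allPairs-⊆ (y ∷ʳ sub) (_ ∷ ps) = allPairs-⊆ sub ps
  allPairs-⊆ (refl ∷ sub) (p ∷ ps) = All-resp-⊆ sub p ∷ allPairs-⊆ sub ps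

  small-⊆ : ∀ z xs → small z xs ⊆ xs
  small-⊆ z [] = []
  small-⊆ z (x ∷ xs) with z ℕ.<ᵇ x
  ... | true = x ∷ʳ small-⊆ z xs
  ... | false = refl ∷ small-⊆ z xs

  large-⊆ : ∀ z xs → large z xs ⊆ xs
  large-⊆ z [] = []
  large-⊆ z (x ∷ xs) with z ℕ.<ᵇ x
  ... | true = refl ∷ large-⊆ z xs
  ... | false = x ∷ʳ large-⊆ z xs

  small-≤ : ∀ z xs → All (_≤ z) (small z xs)
  small-≤ z [] = []
  small-≤ z (x ∷ xs) with z ℕ.<ᵇ x in eq
  ... | true = small-≤ z xs
  ... | false = <ᵇ-false eq ∷ small-≤ z xs

  large-> : ∀ z xs → All (z <_) (large z xs)
  large-> z [] = []
  large-> z (x ∷ xs) with z ℕ.<ᵇ x in eq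
  ... | true = <ᵇ-true eq ∷ large-> z xs
  ... | false = large-> z xs

  large-or-small : ∀ z {x} xs → x ∈ xs → x ∈ large z xs ⊎ x ∈ small z xs
  large-or-small z (y ∷ xs) (here refl) with z ℕ.<ᵇ y
  ... | true = inj₁ (here refl)
  ... | false = inj₂ (here refl)
  large-or-small z (y ∷ xs) (there x∈) with z ℕ.<ᵇ y | large-or-small z xs x∈
  ... | true  | inj₁ l = inj₁ (there l)
  ... | true  | inj₂ s = inj₂ s
  ... | false | inj₁ l = inj₁ l
  ... | false | inj₂ s = inj₂ (there s)

  options-⊆ : ∀ deep Ym Yp → All (λ (ym , yp , _) → ym ⊆ Ym × yp ⊆ Yp) (options deep Ym Yp)
  options-⊆ false Ym Yp = []
  options-⊆ true Ym Yp = Allₚ.concat⁺ (Allₚ.map⁺ (All.map (λ ym⊆ → Allₚ.concat⁺ (Allₚ.map⁺ (All.map (λ yp⊆ →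
    (ym⊆ , yp⊆) ∷ (ym⊆ , yp⊆) ∷ []) (sublists-⊆ Yp)))) (sublists-⊆ Ym)))

  ≤-minimum : ∀ {A : Set} {c base} (f : A → ℕ) os → c ≤ base → All (λ o → c ≤ f o) os → c ≤ foldr (λ o best → f o ⊓ best) base os
  ≤-minimum f [] c≤ [] = c≤
  ≤-minimum f (o ∷ os) c≤ (p ∷ ps) = ℕₚ.⊓-glb p (≤-minimum f os c≤ ps)

  module Correctness (h : ℕ) (L : LineLogs (h * 2))
    (cofactor-e : ∀ p → Prime p → p ∣ h * 2 → ¬ p ∣ _∣_.quotient (LineLogs.q+1∣e L))
    (s : ℕ) (s-large : 100 * 100 * suc (h * 2) ≤ s * s) where
    open LineLogs L
    open Sieving h L cofactor-e
    open Check q s (isEven h)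

    module _ {Pm Pp : List ℕ} (minus : OddPrimesOf (h * 2) Pm) (plus : OddPrimesOf (suc q) Pp) where
      private
        module M = OddPrimesOf minus
        module P = OddPrimesOf plus

      module _ (deep : Bool) (z : ℕ) where
        private
          Ym = small z Pm
          Yp = small z Pp
          Sm = large z Pm
          Sp = large z Pp
          Y = avoids Ym ++ avoids Yp

        avoids-side : ∀ {m Q ys} → ys ⊆ Q → All (OddPrimeDivisor m) Q → AllPairs (λ ℓ ℓ′ → ¬ ℓ ≡ ℓ′) Q →
                      All (PrimeFactor m) (avoids ys) × AllPairs _≢₁_ (avoids ys)
        avoids-side ys⊆ all pairs = Allₚ.map⁺ (All-resp-⊆ ys⊆ all) , AllPairsₚ.map⁺ (allPairs-⊆ ys⊆ pairs)

        hit-side : ∀ {m Q ys ℓ} → ys ⊆ small z Q → z < ℓ → OddPrimeDivisor m ℓ → All (OddPrimeDivisor m) Q → AllPairs (λ ℓ ℓ′ → ¬ ℓ ≡ ℓ′) Q →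
                   All (PrimeFactor m) ((ℓ , hit) ∷ avoids ys) × AllPairs _≢₁_ ((ℓ , hit) ∷ avoids ys)
        hit-side {Q = Q} ys⊆ z<ℓ pℓ all pairs with avoids-side (⊆-trans ys⊆ (small-⊆ z Q)) all pairs
        ... | primes , distinct = pℓ ∷ primes ,
          Allₚ.map⁺ (All-resp-⊆ ys⊆ (All.map (λ y≤z ℓ≡y → ℕₚ.<⇒≱ z<ℓ (subst (_≤ z) (sym ℓ≡y) y≤z)) (small-≤ z Q))) ∷ distinct

        weaken-two : ∀ b {k} → TwoPart true k → TwoPart b k
        weaken-two true eq = eq
        weaken-two false {k} eq = m%n≡0⇒n∣m k 2 (%4⇒%2 k eq)

        avoids-⊆ : ∀ {k ys Q} → ys ⊆ Q → All (Sat k) (avoids Q) → All (Sat k) (avoids ys)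
        avoids-⊆ ys⊆ all = Allₚ.map⁺ (All-resp-⊆ ys⊆ (Allₚ.map⁻ all))

        -- Dropping conditions only enlarges a count, so each choice of core conditions, and
        -- evenness in place of 2 modulo 4, gives a valid bound for the same charge.
        hit-minus : ∀ {ℓ} → z < ℓ → OddPrimeDivisor (h * 2) ℓ → ∀ {ym yp} b → ym ⊆ Ym → yp ⊆ Yp →
                    count L true ((ℓ , hit) ∷ Y) ≤ evaluate ((ℓ , hit) ∷ []) [] (ym , yp , b)
        hit-minus {ℓ} z<ℓ pℓ {ym} {yp} b ym⊆ yp⊆ = ℕₚ.≤-trans
          (count-mono L true b ((ℓ , hit) ∷ Y) ((ℓ , hit) ∷ avoids ym ++ avoids yp) (λ { k (two , ℓ∣k ∷ all) →
            weaken-two b two , ℓ∣k ∷ Allₚ.++⁺ (avoids-⊆ ym⊆ (Allₚ.++⁻ˡ (avoids Ym) all)) (avoids-⊆ yp⊆ (Allₚ.++⁻ʳ (avoids Ym) all)) }))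
          (count-≤-upper {100} {s} (s≤s z≤n) s-large (hit-side ym⊆ z<ℓ pℓ M.sound M.distinct)
            (avoids-side (⊆-trans yp⊆ (small-⊆ z Pp)) P.sound P.distinct) b)

        hit-plus : ∀ {ℓ} → z < ℓ → OddPrimeDivisor (suc q) ℓ → ∀ {ym yp} b → ym ⊆ Ym → yp ⊆ Yp →
                   count L true ((ℓ , hit) ∷ Y) ≤ evaluate [] ((ℓ , hit) ∷ []) (ym , yp , b)
        hit-plus {ℓ} z<ℓ pℓ {ym} {yp} b ym⊆ yp⊆ = ℕₚ.≤-trans
          (count-mono L true b ((ℓ , hit) ∷ Y) (avoids ym ++ (ℓ , hit) ∷ avoids yp) (λ { k (two , ℓ∣k ∷ all) →
            weaken-two b two , Allₚ.++⁺ (avoids-⊆ ym⊆ (Allₚ.++⁻ˡ (avoids Ym) all)) (ℓ∣k ∷ avoids-⊆ yp⊆ (Allₚ.++⁻ʳ (avoids Ym) all)) }))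
          (count-≤-upper {100} {s} (s≤s z≤n) s-large (avoids-side (⊆-trans ym⊆ (small-⊆ z Pm)) M.sound M.distinct)
            (hit-side yp⊆ z<ℓ pℓ P.sound P.distinct) b)

        hits-≤ : ∀ ms ps → All (λ ℓ → (z < ℓ) × OddPrimeDivisor (h * 2) ℓ) ms → All (λ ℓ → (z < ℓ) × OddPrimeDivisor (suc q) ℓ) ps →
                 hits (ms ++ ps) Y ≤ hitsBound deep Ym Yp ms ps
        hits-≤ [] [] [] [] = z≤n
        hits-≤ [] (ℓ ∷ ps) [] ((z<ℓ , pℓ) ∷ pps) = ℕₚ.+-mono-≤
          (≤-minimum (evaluate [] ((ℓ , hit) ∷ [])) (options deep Ym Yp) (hit-plus z<ℓ pℓ {Ym} {Yp} true ⊆-refl ⊆-refl)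
            (All.map (λ {o} (ym⊆ , yp⊆) → hit-plus z<ℓ pℓ {proj₁ o} {proj₁ (proj₂ o)} (proj₂ (proj₂ o)) ym⊆ yp⊆) (options-⊆ deep Ym Yp)))
          (hits-≤ [] ps [] pps)
        hits-≤ (ℓ ∷ ms) ps ((z<ℓ , pℓ) ∷ pms) pps = ℕₚ.+-mono-≤
          (≤-minimum (evaluate ((ℓ , hit) ∷ []) []) (options deep Ym Yp) (hit-minus z<ℓ pℓ {Ym} {Yp} true ⊆-refl ⊆-refl)
            (All.map (λ {o} (ym⊆ , yp⊆) → hit-minus z<ℓ pℓ {proj₁ o} {proj₁ (proj₂ o)} (proj₂ (proj₂ o)) ym⊆ yp⊆) (options-⊆ deep Ym Yp)))
          (hits-≤ ms ps pms pps)

        attempt-sound : attempt Pm Pp deep z ≡ true →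
                        ∃ λ x → TwoPart true (a x) × (∀ ℓ → ℓ ∈ Pm ⊎ ℓ ∈ Pp → ¬ ℓ ∣ a x)
        attempt-sound eq = conclude (sieve (Sm ++ Sp) Y (ℕₚ.≤-<-trans
          (hits-≤ Sm Sp (All.zip (large-> z Pm , All-resp-⊆ (large-⊆ z Pm) M.sound)) (All.zip (large-> z Pp , All-resp-⊆ (large-⊆ z Pp) P.sound)))
          (ℕₚ.<-≤-trans (<ᵇ-true eq) (lower-≤-count {100} {s} (s≤s z≤n) s-large
            (avoids-side (small-⊆ z Pm) M.sound M.distinct) (avoids-side (small-⊆ z Pp) P.sound P.distinct) true))))
          where
          avoided : ∀ {k ys ℓ} → All (Sat k) (avoids ys) → ℓ ∈ ys → ¬ ℓ ∣ k
          avoided all ℓ∈ = All.lookup (Allₚ.map⁻ all) ℓ∈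
          conclude : (∃ λ x → Test true (avoids (Sm ++ Sp) ++ Y) (a x)) → ∃ λ x → TwoPart true (a x) × (∀ ℓ → ℓ ∈ Pm ⊎ ℓ ∈ Pp → ¬ ℓ ∣ a x)
          conclude (x , two , all) = x , two , λ ℓ → cases ℓ
            where
            sieved : ∀ {ℓ} → ℓ ∈ Sm ++ Sp → ¬ ℓ ∣ a x
            sieved = avoided {ys = Sm ++ Sp} (Allₚ.++⁻ˡ (avoids (Sm ++ Sp)) all)
            core = Allₚ.++⁻ʳ (avoids (Sm ++ Sp)) all
            cases : ∀ ℓ → ℓ ∈ Pm ⊎ ℓ ∈ Pp → ¬ ℓ ∣ a x
            cases ℓ (inj₁ ℓ∈) with large-or-small z Pm ℓ∈
            ... | inj₁ l = sieved (∈-++⁺ˡ l)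
            ... | inj₂ l = avoided {ys = Ym} (Allₚ.++⁻ˡ (avoids Ym) core) l
            cases ℓ (inj₂ ℓ∈) with large-or-small z Pp ℓ∈
            ... | inj₁ l = sieved (∈-++⁺ʳ Sm l)
            ... | inj₂ l = avoided {ys = Yp} (Allₚ.++⁻ʳ (avoids Ym) core) l

      attempts-sound : ∀ deep zs → attempts deep zs Pm Pp ≡ true →
                       ∃ λ x → TwoPart true (a x) × (∀ ℓ → ℓ ∈ Pm ⊎ ℓ ∈ Pp → ¬ ℓ ∣ a x)
      attempts-sound deep (z ∷ zs) eq with if-or (attempt Pm Pp deep z) eq
      ... | inj₁ now = attempt-sound deep z now
      ... | inj₂ later = attempts-sound deep zs later

  checkAll-sound : ∀ P f h → checkAll P f h ≡ true → ∀ k → k < f → P (k + h) ≡ true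
  checkAll-sound P (suc f) h eq zero _ = proj₁ (if-and (P h) eq)
  checkAll-sound P (suc f) h eq (suc k) (s≤s k<f) =
    subst (λ z → P z ≡ true) (ℕₚ.+-suc k h) (checkAll-sound P f (suc h) (proj₂ (if-and (P h) eq)) k k<f)

  checkAll-from-1 : ∀ P f → checkAll P f 1 ≡ true → ∀ h → 0 < h → h ≤ f → P h ≡ true
  checkAll-from-1 P f eq (suc h) _ h≤f = subst (λ z → P z ≡ true) (ℕₚ.+-comm h 1) (checkAll-sound P f 1 eq h h≤f)

  abstract
    -- 100√q for q = 2h + 1, rounded up; unproved, since criterion tests it.
    root-approximation : ℕ → ℕ
    root-approximation h = newton 12 (10000 * suc (h * 2)) 22400

    -- Evaluated for all odd q = 2h + 1 from 3 to 69999; the next odd number, 70001, is where the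
    -- argument for large q begins.
    checked : ∀ h → 0 < h → h ≤ 34999 →
      checkWith excluded (suc (h * 2)) (root-approximation h) (isEven h) (oddPrimes (suc (h * 2))) (oddPrimes h) (oddPrimes (suc h)) ≡ true
    checked = checkAll-from-1
      (λ h → checkWith excluded (suc (h * 2)) (root-approximation h) (isEven h) (oddPrimes (suc (h * 2))) (oddPrimes h) (oddPrimes (suc h)))
      34999 refl

  criterion-cases : ∀ q s one Pm Pp → criterion q s one Pm Pp ≡ true →
    100 * 100 * q ≤ s * s × ∃ λ deep → ∃ λ zs → Check.attempts q s one deep zs Pm Pp ≡ true
  criterion-cases q s one Pm Pp eq = ℕₚ.≤ᵇ⇒≤ _ _ (Equivalence.from T-≡ (proj₁ both)) , by (if-or (Check.attempts q s one false thresholds Pm Pp) (proj₂ both))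
    where
    both = if-and (100 * 100 * q ℕ.≤ᵇ s * s) eq
    by : Check.attempts q s one false thresholds Pm Pp ≡ true ⊎ Check.attempts q s one true (thresholds ++ 5 ∷ 11 ∷ 13 ∷ 17 ∷ []) Pm Pp ≡ true →
         ∃ λ deep → ∃ λ zs → Check.attempts q s one deep zs Pm Pp ≡ true
    by (inj₁ shallow) = false , thresholds , shallow
    by (inj₂ deep) = true , thresholds ++ 5 ∷ 11 ∷ 13 ∷ 17 ∷ [] , deep

  ∈?-sound : ∀ {x : ℕ} {xs : List ℕ} (d : Dec (x ∈ xs)) → does d ≡ true → x ∈ xs
  ∈?-sound (yes x∈xs) _ = x∈xs

  checkWith-cases : ∀ exceptions q s one Pq Pm Pp → checkWith exceptions q s one Pq Pm Pp ≡ true →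
    manyPrimes Pq ≡ true ⊎ criterion q s one Pm Pp ≡ true ⊎ q ∈ exceptions
  checkWith-cases exceptions q s one Pq Pm Pp eq = first (if-or (manyPrimes Pq) eq)
    where
    second : criterion q s one Pm Pp ≡ true ⊎ does (q ∈? exceptions) ≡ true → manyPrimes Pq ≡ true ⊎ criterion q s one Pm Pp ≡ true ⊎ q ∈ exceptions
    second (inj₁ found) = inj₂ (inj₁ found)
    second (inj₂ listed) = inj₂ (inj₂ (∈?-sound (q ∈? exceptions) listed))
    first : manyPrimes Pq ≡ true ⊎ (if criterion q s one Pm Pp then true else does (q ∈? exceptions)) ≡ true →
            manyPrimes Pq ≡ true ⊎ criterion q s one Pm Pp ≡ true ⊎ q ∈ exceptions
    first (inj₁ many) = inj₁ many
    first (inj₂ eq′) = second (if-or (criterion q s one Pm Pp) eq′)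

  2∤⇒odd-part : ∀ {m p} → Prime p → ¬ p ≡ 2 → p ∣ m * 2 → p ∣ m
  2∤⇒odd-part {m} pp p≢2 p∣ with euclidsLemma m 2 pp p∣
  ... | inj₁ p∣m = p∣m
  ... | inj₂ p∣2 = contradiction (prime-∣-prime pp prime[2] p∣2) p≢2

  -- With q = 2h + 1, the odd primes of q - 1 and q + 1 are those of h and h + 1, so only the halves
  -- are factored.
  double-spec : ∀ {m ℓs} → OddPrimesOf m ℓs → OddPrimesOf (m * 2) ℓs
  double-spec {m} spec = record
    { sound = All.map (λ (pℓ , ℓ≢2 , ℓ∣m) → pℓ , ℓ≢2 , ∣-trans ℓ∣m (m∣m*n 2)) sound
    ; distinct = distinct
    ; complete = λ p pp p≢2 p∣ → complete p pp p≢2 (2∤⇒odd-part pp p≢2 p∣) }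
    where open OddPrimesOf spec

  module _ (h : ℕ) (L : LineLogs (h * 2)) (cofactor-e : ∀ p → Prime p → p ∣ h * 2 → ¬ p ∣ _∣_.quotient (LineLogs.q+1∣e L)) where
    open LineLogs L using (a)

    GoodPoint : Set
    GoodPoint = ∃ λ x → TwoPart true (a x) × (∀ p → Prime p → ¬ p ≡ 2 → p ∣ h * 2 ⊎ p ∣ suc (suc (h * 2)) → ¬ p ∣ a x)

    criterion-sound : ∀ s {Pm Pp} → OddPrimesOf (h * 2) Pm → OddPrimesOf (suc (suc (h * 2))) Pp →
                      criterion (suc (h * 2)) s (isEven h) Pm Pp ≡ true → GoodPoint
    criterion-sound s {Pm} {Pp} minus plus eq = by (criterion-cases (suc (h * 2)) s (isEven h) Pm Pp eq)
      where
      Found : Set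
      Found = ∃ λ x → TwoPart true (a x) × (∀ ℓ → ℓ ∈ Pm ⊎ ℓ ∈ Pp → ¬ ℓ ∣ a x)
      finish : Found → GoodPoint
      finish (x , two , avoid-all) = x , two , cases
        where
        cases : ∀ p → Prime p → ¬ p ≡ 2 → p ∣ h * 2 ⊎ p ∣ suc (suc (h * 2)) → ¬ p ∣ a x
        cases p pp p≢2 (inj₁ p∣) = avoid-all p (inj₁ (OddPrimesOf.complete minus p pp p≢2 p∣))
        cases p pp p≢2 (inj₂ p∣) = avoid-all p (inj₂ (OddPrimesOf.complete plus p pp p≢2 p∣))
      by : (100 * 100 * suc (h * 2) ≤ s * s × ∃ λ deep → ∃ λ zs → Check.attempts (suc (h * 2)) s (isEven h) deep zs Pm Pp ≡ true) → GoodPoint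
      by (s-large , deep , zs , found) = finish (Correctness.attempts-sound h L cofactor-e s s-large minus plus deep zs found)

    checkWith-sound : ∀ exceptions s {Pq Pm Pp} → OddPrimesOf (suc (h * 2)) Pq → OddPrimesOf (h * 2) Pm → OddPrimesOf (suc (suc (h * 2))) Pp →
                      checkWith exceptions (suc (h * 2)) s (isEven h) Pq Pm Pp ≡ true →
                      ∀ {p k} → Prime p → suc (h * 2) ≡ p ^ k → ¬ suc (h * 2) ∈ exceptions → GoodPoint
    checkWith-sound exceptions s {Pq} {Pm} {Pp} self minus plus eq {p} {k} pp q≡ ∉exceptions = by (checkWith-cases exceptions (suc (h * 2)) s (isEven h) Pq Pm Pp eq)
      where
      by : manyPrimes Pq ≡ true ⊎ criterion (suc (h * 2)) s (isEven h) Pm Pp ≡ true ⊎ suc (h * 2) ∈ exceptions → GoodPoint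
      by (inj₁ many) = contradiction many (manyPrimes-sound {k = k} pp q≡ self)
      by (inj₂ (inj₁ found)) = criterion-sound s minus plus found
      by (inj₂ (inj₂ listed)) = contradiction listed ∉exceptions

    finite-search : 0 < h → h < 35000 → ∀ {p k} → Prime p → suc (h * 2) ≡ p ^ k → ¬ suc (h * 2) ∈ excluded → GoodPoint
    finite-search h>0 h< {p} {k} pp q≡ ∉excluded = checkWith-sound excluded (root-approximation h) {oddPrimes (suc (h * 2))} {oddPrimes h} {oddPrimes (suc h)}
      (oddPrimes-spec (suc (h * 2)) (s≤s z≤n) 2h<70000)
      (double-spec (oddPrimes-spec h h>0 (ℕₚ.≤-trans h≤2h (ℕₚ.<⇒≤ 2h<70000))))
      (double-spec (oddPrimes-spec (suc h) (s≤s z≤n) (ℕₚ.≤-trans (s≤s h≤2h) 2h<70000)))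
      (checked h h>0 (ℕₚ.≤-pred h<)) {p} {k} pp q≡ ∉excluded
      where
      2h<70000 : h * 2 < 70000
      2h<70000 = ℕₚ.*-monoˡ-< 2 h<
      h≤2h : h ≤ h * 2
      h≤2h = ℕₚ.m≤m*n h 2

-- Error bounds for arbitrary q.

module Asymptotic where

  open import Data.Nat as ℕ using (ℕ; zero; suc; z≤n; s≤s; NonZero; _+_; _*_; _∸_; _≤_; _<_; _^_)
  open import Data.Nat.Tactic.RingSolver using (solve-∀)
  open import Relation.Binary.PropositionalEquality
  open Lines
  open Factors
  open Estimates
  open Arith
  open Sieve

  abstract
    ceil-sqrt : ∀ q → ∃ λ s → q ≤ s * s × (s ∸ 1) * (s ∸ 1) ≤ q
    ceil-sqrt zero = 0 , z≤n , z≤n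
    ceil-sqrt (suc q) with ceil-sqrt q
    ... | s , q≤s² , s-1²≤q with suc q ℕₚ.≤? s * s
    ... | yes q<s² = s , q<s² , ℕₚ.m≤n⇒m≤1+n s-1²≤q
    ... | no q≮s² = suc s , ℕₚ.≤-trans (s≤s q≤s²) (ℕₚ.*-mono-< {s} {suc s} {s} {suc s} ℕₚ.≤-refl ℕₚ.≤-refl) , ℕₚ.m≤n⇒m≤1+n (ℕₚ.≤-pred (ℕₚ.≰⇒> q≮s²))

  peaks-split : ∀ fs → All Modulus fs → peaks fs ≡ mainTerm fs + gap fs
  peaks-split [] [] = refl
  peaks-split (f ∷ fs) (m ∷ ms) = begin
    peak₁ f * peaks fs
      ≡⟨ cong (_* peaks fs) (peak₁-split f m) ⟨
    (main₁ f + (proj₁ f ∸ 1)) * peaks fs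
      ≡⟨ ℕₚ.*-distribʳ-+ (peaks fs) (main₁ f) (proj₁ f ∸ 1) ⟩
    main₁ f * peaks fs + (proj₁ f ∸ 1) * peaks fs
      ≡⟨ cong (λ z → main₁ f * z + (proj₁ f ∸ 1) * peaks fs) (peaks-split fs ms) ⟩
    main₁ f * (mainTerm fs + gap fs) + (proj₁ f ∸ 1) * peaks fs
      ≡⟨ regroup (main₁ f) (mainTerm fs) (gap fs) ((proj₁ f ∸ 1) * peaks fs) ⟩
    main₁ f * mainTerm fs + (main₁ f * gap fs + (proj₁ f ∸ 1) * peaks fs) ∎
    where
    open ≡-Reasoning
    regroup : ∀ a m g x → a * (m + g) + x ≡ a * m + (a * g + x)
    regroup = solve-∀

  -- The 4 counts the characters in `two true`: the trivial one, the quadratic one and two of order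
  -- 4. Once those with an exact value are charged s as well, both classes of q modulo 4 give the
  -- same total.
  crude-error : ∀ {s} one fs gs → 0 < s → All Modulus fs → All Modulus gs → error 1 s one true fs gs ≤ 4 * (s * (peaks fs * peaks gs))
  crude-error {s} one fs gs s>0 ms ns = ℕₚ.≤-trans (ℕₚ.≤-reflexive (cong (_+ s * rootError one true fs gs) (ℕₚ.*-identityˡ _))) (by one)
    where
    A = mainTerm fs
    G = gap fs
    T = peaks fs
    H = gap gs
    U = peaks gs
    H≤U : H ≤ U
    H≤U = subst (H ≤_) (sym (peaks-split gs ns)) (ℕₚ.m≤n+m H (mainTerm gs))
    scaled : ∀ x → x ≤ s * x
    scaled x = ℕₚ.m≤n*m x s {{ℕ.>-nonZero s>0}}
    collect-true : ∀ s A G U → s * (A * (U + U)) + s * (2 * (G * U) + 2 * ((A + G) * U)) ≡ 4 * (s * ((A + G) * U))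
    collect-true = solve-∀
    collect-false : ∀ s A G U → s * (A * (U + 3 * U)) + s * (4 * (G * U)) ≡ 4 * (s * ((A + G) * U))
    collect-false = solve-∀
    by : ∀ one → exactError one true fs gs + s * rootError one true fs gs ≤ 4 * (s * (T * U))
    by true = ℕₚ.≤-trans
      (ℕₚ.+-mono-≤ (ℕₚ.≤-trans (ℕₚ.*-monoʳ-≤ A (ℕₚ.+-monoˡ-≤ U H≤U)) (scaled _))
        (ℕₚ.≤-reflexive (cong (λ z → s * (2 * (G * U) + 2 * (z * U))) (peaks-split fs ms))))
      (ℕₚ.≤-reflexive (trans (collect-true s A G U) (cong (λ z → 4 * (s * (z * U))) (sym (peaks-split fs ms)))))
    by false = ℕₚ.≤-trans
      (ℕₚ.+-monoˡ-≤ _ (ℕₚ.≤-trans (ℕₚ.*-monoʳ-≤ A (ℕₚ.+-monoˡ-≤ (3 * U) H≤U)) (scaled _)))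
      (ℕₚ.≤-reflexive (trans (collect-false s A G U) (cong (λ z → 4 * (s * (z * U))) (sym (peaks-split fs ms)))))

  scale-++ : ∀ fs gs → scale (fs ++ gs) ≡ scale fs * scale gs
  scale-++ [] gs = sym (ℕₚ.*-identityˡ (scale gs))
  scale-++ (f ∷ fs) gs = trans (cong (proj₁ f *_) (scale-++ fs gs)) (sym (ℕₚ.*-assoc (proj₁ f) (scale fs) (scale gs)))

  module Large (K h : ℕ) (L : LineLogs (h * 2))
    (cofactor-e : ∀ p → Prime p → p ∣ h * 2 → ¬ p ∣ _∣_.quotient (LineLogs.q+1∣e L))
    (s : ℕ) (s>0 : 0 < s) (q≤s² : suc (h * 2) ≤ s * s) where
    open LineLogs L
    open Sieving h L cofactor-e

    Sided : Factor → Set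
    Sided f = PrimeFactor (h * 2) f ⊎ PrimeFactor (suc q) f

    -- A list of primes in increasing order mixes divisors of q - 1 and q + 1, while the count
    -- estimates want them apart. The crude bounds depend on products over the whole list only, so
    -- they can be carried back to it.
    record Sides (hs : List Factor) : Set₁ where
      field
        fs gs    : List Factor
        minus    : All (PrimeFactor (h * 2)) fs
        plus     : All (PrimeFactor (suc q)) gs
        fs-from  : ∀ {P : Factor → Set} → All P hs → All P fs
        gs-from  : ∀ {P : Factor → Set} → All P hs → All P gs
        hs-from  : ∀ {P : Factor → Set} → All P fs → All P gs → All P hs
        fs-pairs : AllPairs _≢₁_ hs → AllPairs _≢₁_ fs
        gs-pairs : AllPairs _≢₁_ hs → AllPairs _≢₁_ gs
        mains    : mainTerm fs * mainTerm gs ≡ mainTerm hs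
        peaks≡   : peaks fs * peaks gs ≡ peaks hs
        scales   : scale fs * scale gs ≡ scale hs

    sides : ∀ hs → All Sided hs → Sides hs
    sides [] [] = record
      { fs = [] ; gs = [] ; minus = [] ; plus = [] ; fs-from = id ; gs-from = id ; hs-from = λ _ p → p
      ; fs-pairs = id ; gs-pairs = id ; mains = refl ; peaks≡ = refl ; scales = refl }
    sides (f ∷ hs) (inj₁ p ∷ ps) = record
      { fs = f ∷ fs ; gs = gs ; minus = p ∷ minus ; plus = plus
      ; fs-from = λ { (x ∷ xs) → x ∷ fs-from xs } ; gs-from = λ { (x ∷ xs) → gs-from xs }
      ; hs-from = λ { (x ∷ xs) ys → x ∷ hs-from xs ys }
      ; fs-pairs = λ { (x ∷ xs) → fs-from x ∷ fs-pairs xs } ; gs-pairs = λ { (x ∷ xs) → gs-pairs xs }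
      ; mains = trans (ℕₚ.*-assoc (main₁ f) _ _) (cong (main₁ f *_) mains)
      ; peaks≡ = trans (ℕₚ.*-assoc (peak₁ f) _ _) (cong (peak₁ f *_) peaks≡)
      ; scales = trans (ℕₚ.*-assoc (proj₁ f) _ _) (cong (proj₁ f *_) scales) }
      where open Sides (sides hs ps)
    sides (f ∷ hs) (inj₂ p ∷ ps) = record
      { fs = fs ; gs = f ∷ gs ; minus = minus ; plus = p ∷ plus
      ; fs-from = λ { (x ∷ xs) → fs-from xs } ; gs-from = λ { (x ∷ xs) → x ∷ gs-from xs }
      ; hs-from = λ { xs (y ∷ ys) → y ∷ hs-from xs ys }
      ; fs-pairs = λ { (x ∷ xs) → fs-pairs xs } ; gs-pairs = λ { (x ∷ xs) → gs-from x ∷ gs-pairs xs }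
      ; mains = trans (left-comm (mainTerm fs) (main₁ f) _) (cong (main₁ f *_) mains)
      ; peaks≡ = trans (left-comm (peaks fs) (peak₁ f) _) (cong (peak₁ f *_) peaks≡)
      ; scales = trans (left-comm (scale fs) (proj₁ f) _) (cong (proj₁ f *_) scales) }
      where
      open Sides (sides hs ps)
      left-comm : ∀ a b c → a * (b * c) ≡ b * (a * c)
      left-comm = solve-∀

    module _ (hs : List Factor) (sided : All Sided hs) (distinct : AllPairs _≢₁_ hs) where
      open Sides (sides hs sided)
      private
        adm = admissible (minus , fs-pairs distinct) (plus , gs-pairs distinct)
        E = error 1 s (isEven h) true fs gs
        E≤ : E ≤ 4 * (s * peaks hs)
        E≤ = subst (λ z → E ≤ 4 * (s * z)) peaks≡ (crude-error (isEven h) fs gs s>0 (All.map (1<prime ∘ proj₁) minus) (All.map (1<prime ∘ proj₁) plus))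
        q≤ : 1 * 1 * q ≤ s * s
        q≤ = subst (_≤ s * s) (sym (ℕₚ.*-identityˡ q)) q≤s²
        count≡ : count L true (fs ++ gs) ≡ count L true hs
        count≡ = ℕₚ.≤-antisym
          (count-mono L true true (fs ++ gs) hs (λ { k (two , all) → two , hs-from (Allₚ.++⁻ˡ fs all) (Allₚ.++⁻ʳ fs all) }))
          (count-mono L true true hs (fs ++ gs) (λ { k (two , all) → two , Allₚ.++⁺ (fs-from all) (gs-from all) }))
        counted : 1 * (4 * scale (fs ++ gs) * count L true (fs ++ gs)) ≡ 4 * scale hs * count L true hs
        counted = trans (ℕₚ.*-identityˡ _) (cong₂ (λ x y → 4 * x * y) (trans (scale-++ fs gs) scales) count≡)
        expected≡ : 1 * (mainTerm fs * (mainTerm gs * q)) ≡ mainTerm hs * q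
        expected≡ = trans (ℕₚ.*-identityˡ _) (trans (sym (ℕₚ.*-assoc (mainTerm fs) (mainTerm gs) q)) (cong (_* q) mains))

      crude-upper : 4 * scale hs * count L true hs ≤ mainTerm hs * q + 4 * (s * peaks hs)
      crude-upper = subst₂ _≤_ counted refl (ℕₚ.≤-trans (count-upper L {1} {s} q≤ adm (isEven h) true quartic 2∣q+1)
        (ℕₚ.+-mono-≤ (ℕₚ.≤-reflexive expected≡) E≤))

      crude-lower : mainTerm hs * q ≤ 4 * scale hs * count L true hs + 4 * (s * peaks hs)
      crude-lower = subst₂ _≤_ expected≡ refl (ℕₚ.≤-trans (count-lower L {1} {s} q≤ adm (isEven h) true quartic 2∣q+1)
        (ℕₚ.+-mono-≤ (ℕₚ.≤-reflexive counted) E≤))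

    OddPrime : ℕ → Set
    OddPrime ℓ = OddPrimeDivisor (h * 2) ℓ ⊎ OddPrimeDivisor (suc q) ℓ

    module Core (ys : List ℕ) (ys-primes : All OddPrime ys) (ys-distinct : AllPairs (λ ℓ ℓ′ → ¬ ℓ ≡ ℓ′) ys) where
      private
        hs = avoids ys
        M = mainTerm hs
        T = peaks hs
        D = 4 * scale hs
        sided : All Sided hs
        sided = Allₚ.map⁺ ys-primes
        pairs : AllPairs _≢₁_ hs
        pairs = AllPairsₚ.map⁺ ys-distinct

      main>0 : 0 < M
      main>0 = positive ys ys-primes
        where
        1<ℓ : ∀ {ℓ} → OddPrime ℓ → 1 < ℓ
        1<ℓ (inj₁ (pp , _)) = 1<prime pp
        1<ℓ (inj₂ (pp , _)) = 1<prime pp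
        positive : ∀ ys → All OddPrime ys → 0 < mainTerm (avoids ys)
        positive [] [] = s≤s z≤n
        positive (ℓ ∷ ys) (p ∷ ps) = ℕₚ.*-mono-≤ (ℕₚ.m<n⇒0<n∸m (1<ℓ p)) (positive ys ps)

      peaks-2^ : ∀ ys → peaks (avoids ys) ≡ 2 ^ length ys * mainTerm (avoids ys)
      peaks-2^ [] = refl
      peaks-2^ (ℓ ∷ ys) = trans (cong (2 * (ℓ ∸ 1) *_) (peaks-2^ ys)) (regroup (ℓ ∸ 1) (2 ^ length ys) (mainTerm (avoids ys)))
        where
        regroup : ∀ l w m → 2 * l * (w * m) ≡ 2 * w * (l * m)
        regroup = solve-∀

      -- w is an upper bound for K/ℓ; the common denominator K replaces the division of q by ℓ.
      hit-bound : ∀ ℓ w → OddPrime ℓ → All (λ y → ¬ ℓ ≡ y) ys → K ≤ w * ℓ →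
                  K * (D * count L true ((ℓ , hit) ∷ hs)) ≤ w * (M * q) + K * (4 * (s * T))
      hit-bound ℓ w p ℓ∉ K≤wℓ = ℕₚ.*-cancelˡ-≤ ℓ {{ℓ≢0}} (begin
        ℓ * (K * (D * c))                        ≡⟨ regroup₁ ℓ K (scale hs) c ⟩
        K * (4 * (ℓ * scale hs) * c)             ≤⟨ ℕₚ.*-monoʳ-≤ K (crude-upper ((ℓ , hit) ∷ hs) (p ∷ sided) (Allₚ.map⁺ ℓ∉ ∷ pairs)) ⟩
        K * ((1 * M) * q + 4 * (s * (ℓ * T)))    ≡⟨ regroup₂ K M q s ℓ T ⟩
        K * (M * q) + ℓ * (K * (4 * (s * T)))    ≤⟨ ℕₚ.+-monoˡ-≤ _ (ℕₚ.*-monoˡ-≤ (M * q) K≤wℓ) ⟩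
        w * ℓ * (M * q) + ℓ * (K * (4 * (s * T))) ≡⟨ regroup₃ w ℓ (M * q) (K * (4 * (s * T))) ⟩
        ℓ * (w * (M * q) + K * (4 * (s * T)))    ∎)
        where
        open ℕₚ.≤-Reasoning
        c = count L true ((ℓ , hit) ∷ hs)
        ℓ>0 : OddPrime ℓ → 0 < ℓ
        ℓ>0 (inj₁ (pp , _)) = ℕₚ.<-trans ℕₚ.0<1+n (1<prime pp)
        ℓ>0 (inj₂ (pp , _)) = ℕₚ.<-trans ℕₚ.0<1+n (1<prime pp)
        ℓ≢0 : NonZero ℓ
        ℓ≢0 = ℕ.>-nonZero (ℓ>0 p)
        regroup₁ : ∀ ℓ k d c → ℓ * (k * (4 * d * c)) ≡ k * (4 * (ℓ * d) * c)
        regroup₁ = solve-∀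
        regroup₂ : ∀ k m q s ℓ t → k * ((1 * m) * q + 4 * (s * (ℓ * t))) ≡ k * (m * q) + ℓ * (k * (4 * (s * t)))
        regroup₂ = solve-∀
        regroup₃ : ∀ w ℓ x y → w * ℓ * x + ℓ * y ≡ ℓ * (w * x + y)
        regroup₃ = solve-∀

      -- W bounds K · ∑ 1/ℓ over the sieved primes from above.
      data Weighted : List ℕ → ℕ → Set where
        []   : Weighted [] 0
        cons : ∀ {ℓ ℓs w W} → OddPrime ℓ → All (λ y → ¬ ℓ ≡ y) ys → K ≤ w * ℓ → Weighted ℓs W → Weighted (ℓ ∷ ℓs) (w + W)

      hits-bound : ∀ {ℓs W} → Weighted ℓs W → K * (D * hits ℓs hs) ≤ W * (M * q) + length ℓs * (K * (4 * (s * T)))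
      hits-bound [] = ℕₚ.≤-reflexive (trans (cong (K *_) (ℕₚ.*-zeroʳ D)) (ℕₚ.*-zeroʳ K))
      hits-bound {ℓ ∷ ℓs} (cons {w = w} {W = W} p ℓ∉ K≤ rest) = begin
        K * (D * (c + hits ℓs hs))                ≡⟨ regroup₁ K D c (hits ℓs hs) ⟩
        K * (D * c) + K * (D * hits ℓs hs)        ≤⟨ ℕₚ.+-mono-≤ (hit-bound ℓ w p ℓ∉ K≤) (hits-bound rest) ⟩
        (w * (M * q) + e′) + (W * (M * q) + length ℓs * e′) ≡⟨ regroup₂ w W (M * q) e′ (length ℓs) ⟩
        (w + W) * (M * q) + suc (length ℓs) * e′  ∎
        where
        open ℕₚ.≤-Reasoning
        c = count L true ((ℓ , hit) ∷ hs)
        e′ = K * (4 * (s * T))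
        regroup₁ : ∀ k d c x → k * (d * (c + x)) ≡ k * (d * c) + k * (d * x)
        regroup₁ = solve-∀
        regroup₂ : ∀ w v x e n → (w * x + e) + (v * x + n * e) ≡ (w + v) * x + (1 + n) * e
        regroup₂ = solve-∀

      -- The peak of the core is 2ᶜ times its main term M, with c core primes, so M cancels
      -- throughout. Divided by K, the hypothesis reads q(1 - W/K) > (m + 1) · 4 · 2ᶜ · s for m
      -- sieved primes.
      core-sieve : ∀ {ℓs W} → Weighted ℓs W → W * q + (suc (length ℓs) * (4 * K * 2 ^ length ys)) * s < K * q → hits ℓs hs < count L true hs
      core-sieve {ℓs} {W} weighted gap<  = ℕₚ.≰⇒> λ count≤hits → ℕₚ.<⇒≱ gap< (ℕₚ.*-cancelˡ-≤ M {{ℕ.>-nonZero main>0}} (begin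
        M * (K * q)                                          ≡⟨ regroup₁ M K q ⟩
        K * (M * q)                                          ≤⟨ ℕₚ.*-monoʳ-≤ K (crude-lower hs sided pairs) ⟩
        K * (D * count L true hs + 4 * (s * T))              ≡⟨ ℕₚ.*-distribˡ-+ K _ _ ⟩
        K * (D * count L true hs) + e′                       ≤⟨ ℕₚ.+-monoˡ-≤ e′ (ℕₚ.*-monoʳ-≤ K (ℕₚ.*-monoʳ-≤ D count≤hits)) ⟩
        K * (D * hits ℓs hs) + e′                            ≤⟨ ℕₚ.+-monoˡ-≤ e′ (hits-bound weighted) ⟩
        (W * (M * q) + length ℓs * e′) + e′                  ≡⟨ cong (λ t → (W * (M * q) + length ℓs * (K * (4 * (s * t)))) + K * (4 * (s * t))) (peaks-2^ ys) ⟩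
        (W * (M * q) + length ℓs * (K * (4 * (s * (2 ^ length ys * M))))) + K * (4 * (s * (2 ^ length ys * M)))
          ≡⟨ regroup₂ W M q (length ℓs) K s (2 ^ length ys) ⟩
        M * (W * q + (suc (length ℓs) * (4 * K * 2 ^ length ys)) * s) ∎))
        where
        open ℕₚ.≤-Reasoning
        e′ = K * (4 * (s * T))
        regroup₁ : ∀ m k q → m * (k * q) ≡ k * (m * q)
        regroup₁ = solve-∀
        regroup₂ : ∀ W m q n k s p → (W * (m * q) + n * (k * (4 * (s * (p * m))))) + k * (4 * (s * (p * m))) ≡ m * (W * q + ((1 + n) * (4 * k * p)) * s)
        regroup₂ = solve-∀

      found : ∀ {ℓs W} → Weighted ℓs W → W * q + (suc (length ℓs) * (4 * K * 2 ^ length ys)) * s < K * q →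
              ∃ λ x → TwoPart true (a x) × (∀ ℓ → ℓ ∈ ys ⊎ ℓ ∈ ℓs → ¬ ℓ ∣ a x)
      found {ℓs} weighted gap< = conclude (sieve ℓs hs (core-sieve weighted gap<))
        where
        conclude : (∃ λ x → Test true (avoids ℓs ++ hs) (a x)) → ∃ λ x → TwoPart true (a x) × (∀ ℓ → ℓ ∈ ys ⊎ ℓ ∈ ℓs → ¬ ℓ ∣ a x)
        conclude (x , two , all) = x , two , cases
          where
          cases : ∀ ℓ → ℓ ∈ ys ⊎ ℓ ∈ ℓs → ¬ ℓ ∣ a x
          cases ℓ (inj₁ ℓ∈) = All.lookup (Allₚ.map⁻ (Allₚ.++⁻ʳ (avoids ℓs) all)) ℓ∈
          cases ℓ (inj₂ ℓ∈) = All.lookup (Allₚ.map⁻ (Allₚ.++⁻ˡ (avoids ℓs) all)) ℓ∈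

-- Large q: comparison with the smallest odd primes.

module Threshold where

  open import Data.Nat as ℕ using (ℕ; zero; suc; z≤n; s≤s; _+_; _*_; _∸_; _≤_; _<_; _^_)
  open import Data.Nat.Tactic.RingSolver using (solve-∀)
  open import Relation.Binary.PropositionalEquality
  open Kernels using (coprime-*∣)
  open Lines
  open Factors using (coprime-*)
  open Estimates using (TwoPart)
  open Arith
  open Sieve
  open Search using (GoodPoint; checkAll-sound; <ᵇ-true)
  open Asymptotic

  candidates : List ℕ
  candidates = 7 ∷ 11 ∷ 13 ∷ 17 ∷ 19 ∷ 23 ∷ 29 ∷ 31 ∷ 37 ∷ 41 ∷ 43 ∷ 47 ∷ 53 ∷ 59 ∷ 61 ∷ 67 ∷ 71 ∷ 73 ∷ []

  allCandidates : List ℕ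
  allCandidates = 3 ∷ 5 ∷ candidates

  -- No prime is skipped, so the i-th member of an increasing list of primes above c is at least the
  -- i-th candidate; after the last candidate all primes exceed 16.
  Consecutive : ℕ → List ℕ → Set
  Consecutive c [] = 16 ≤ c
  Consecutive c (c′ ∷ cs) = (c < c′) × (∀ {x} → x < c′ → c < x → ¬ Prime x) × Consecutive c′ cs

  consecutive? : ∀ c cs → Dec (Consecutive c cs)
  consecutive? c [] = 16 ℕₚ.≤? c
  consecutive? c (c′ ∷ cs) = (c ℕₚ.<? c′) ×-dec ℕₚ.allUpTo? (λ x → (c ℕₚ.<? x) →-dec ¬? (prime? x)) c′ ×-dec consecutive? c′ cs

  abstract
    candidates-consecutive : Consecutive 2 allCandidates
    candidates-consecutive = from-yes (consecutive? 2 allCandidates)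

  -- Beyond the listed candidates the lower bound 16 is used.
  data Dominated : List ℕ → List ℕ → Set where
    done   : ∀ {cs} → Dominated [] cs
    next   : ∀ {p ps c cs} → 0 < c → c ≤ p → Dominated ps cs → Dominated (p ∷ ps) (c ∷ cs)
    beyond : ∀ {p ps} → 16 ≤ p → Dominated ps [] → Dominated (p ∷ ps) []

  dominated : ∀ {c} cs {ps} → Consecutive c cs → All Prime ps → All (c <_) ps → AllPairs _<_ ps → Dominated ps cs
  dominated cs {[]} _ _ _ _ = done
  dominated [] {p ∷ ps} 16≤c (_ ∷ primes) (c<p ∷ c<ps) (_ ∷ sorted) =
    beyond (ℕₚ.≤-trans 16≤c (ℕₚ.<⇒≤ c<p)) (dominated [] 16≤c primes c<ps sorted)
  dominated (c′ ∷ cs) {p ∷ ps} (c<c′ , gap , rest) (pp ∷ primes) (c<p ∷ _) (p<ps ∷ sorted) =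
    next (ℕₚ.≤-<-trans z≤n c<c′) c′≤p (dominated cs rest primes (All.map (ℕₚ.≤-<-trans c′≤p) p<ps) sorted)
    where
    c′≤p : c′ ≤ p
    c′≤p = ℕₚ.≮⇒≥ (λ p<c′ → gap p<c′ c<p pp)

  weight : ℕ → ℕ → ℕ
  weight K c = suc (K div c)

  weights : ℕ → ℕ → List ℕ → ℕ
  weights K zero cs = 0
  weights K (suc n) [] = weight K 16 + weights K n []
  weights K (suc n) (c ∷ cs) = weight K c + weights K n cs

  lowerProduct : ℕ → List ℕ → ℕ
  lowerProduct zero cs = 1
  lowerProduct (suc n) [] = 16 * lowerProduct n []
  lowerProduct (suc n) (c ∷ cs) = c * lowerProduct n cs

  weight-≤ : ∀ K c {p} → 0 < c → c ≤ p → K ≤ weight K c * p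
  weight-≤ K (suc c) {p} _ c≤p = ℕₚ.≤-trans (ℕₚ.<⇒≤ (subst (_< weight K (suc c) * suc c) (sym (m≡m%n+[m/n]*n K (suc c)))
    (ℕₚ.+-monoˡ-< (K / suc c * suc c) (m%n<n K (suc c))))) (ℕₚ.*-monoʳ-≤ (weight K (suc c)) c≤p)

  lowerProduct-≤ : ∀ {ps cs} → Dominated ps cs → lowerProduct (length ps) cs ≤ product ps
  lowerProduct-≤ done = ℕₚ.≤-refl
  lowerProduct-≤ (next _ c≤p d) = ℕₚ.*-mono-≤ c≤p (lowerProduct-≤ d)
  lowerProduct-≤ (beyond 16≤p d) = ℕₚ.*-mono-≤ 16≤p (lowerProduct-≤ d)

  lowerProduct-beyond : ∀ cs m → lowerProduct (length cs + m) cs ≡ product cs * 16 ^ m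
  lowerProduct-beyond [] zero = refl
  lowerProduct-beyond [] (suc m) = trans (cong (16 *_) (trans (lowerProduct-beyond [] m) (ℕₚ.*-identityˡ (16 ^ m)))) (sym (ℕₚ.*-identityˡ (16 * 16 ^ m)))
  lowerProduct-beyond (c ∷ cs) m = trans (cong (c *_) (lowerProduct-beyond cs m)) (sym (ℕₚ.*-assoc c (product cs) (16 ^ m)))

  -- For Bs < Dq with s² ≤ 1.01q it is enough that q > 1.01(B/D)². This follows either from q ≥
  -- 70001 or, after squaring, from q² > P.
  Sufficient : ℕ → ℕ → ℕ → Set
  Sufficient D B P = 101 * (B * B) < 100 * (D * D) * 70001 ⊎ (101 * (B * B)) * (101 * (B * B)) ≤ (100 * (D * D)) * (100 * (D * D)) * P

  sufficient : ∀ {q s D B P} → 70001 ≤ q → 100 * (s * s) ≤ 101 * q → P < q * q → 0 < D →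
    Sufficient D B P → B * s < D * q
  sufficient {q} {s} {D} {B} {P} 70001≤q s²≤ P<q² D>0 cond = ℕₚ.≰⇒> (λ Dq≤Bs → refute (bound Dq≤Bs) cond)
    where
    open ℕₚ.≤-Reasoning
    q>0 : 0 < q
    q>0 = ℕₚ.≤-trans (s≤s z≤n) 70001≤q
    shuffle₁ : ∀ c D q → c * (D * D) * q * q ≡ c * ((D * q) * (D * q))
    shuffle₁ = solve-∀
    shuffle₂ : ∀ c B s → c * ((B * s) * (B * s)) ≡ (B * B) * (c * (s * s))
    shuffle₂ = solve-∀
    shuffle₃ : ∀ b c q → b * (c * q) ≡ c * b * q
    shuffle₃ = solve-∀
    bound : D * q ≤ B * s → 100 * (D * D) * q ≤ 101 * (B * B)
    bound le = ℕₚ.*-cancelʳ-≤ _ _ q {{ℕ.>-nonZero q>0}} (begin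
      100 * (D * D) * q * q            ≡⟨ shuffle₁ 100 D q ⟩
      100 * ((D * q) * (D * q))        ≤⟨ ℕₚ.*-monoʳ-≤ 100 (ℕₚ.*-mono-≤ le le) ⟩
      100 * ((B * s) * (B * s))        ≡⟨ shuffle₂ 100 B s ⟩
      (B * B) * (100 * (s * s))        ≤⟨ ℕₚ.*-monoʳ-≤ (B * B) s²≤ ⟩
      (B * B) * (101 * q)              ≡⟨ shuffle₃ (B * B) 101 q ⟩
      101 * (B * B) * q                ∎)
    E = 100 * (D * D)
    E>0 : 0 < E
    E>0 = ℕₚ.*-mono-≤ {1} {100} (s≤s z≤n) (ℕₚ.*-mono-≤ D>0 D>0)
    refute : 100 * (D * D) * q ≤ 101 * (B * B) → ¬ (101 * (B * B) < 100 * (D * D) * 70001 ⊎ (101 * (B * B)) * (101 * (B * B)) ≤ E * E * P)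
    refute le (inj₁ lt) = ℕₚ.<⇒≱ lt (ℕₚ.≤-trans (ℕₚ.*-monoʳ-≤ E 70001≤q) le)
    refute le (inj₂ le′) = ℕₚ.<⇒≱ (ℕₚ.*-monoʳ-< (E * E) {{ℕ.>-nonZero (ℕₚ.*-mono-≤ E>0 E>0)}} P<q²) (begin
      E * E * (q * q)                  ≡⟨ ℕₚ.[m*n]*[o*p]≡[m*o]*[n*p] E E q q ⟩
      (E * q) * (E * q)                ≤⟨ ℕₚ.*-mono-≤ le le ⟩
      (101 * (B * B)) * (101 * (B * B)) ≤⟨ le′ ⟩
      E * E * P                        ∎)

  -- The case of n sieved primes and a core of two: the last factor 4 is 2², and D/K is the share of
  -- the main term that the sieve leaves. The weights start at 7 because 3 and 5 bound the core
  -- primes, which enter only the product.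
  record Margin (K n : ℕ) : Set where
    field
      D     : ℕ
      split : K ≡ weights K n candidates + D
      D>0   : 0 < D
      large : Sufficient D (suc n * (4 * K * 4)) (lowerProduct (2 + n) allCandidates)

  margin? : ℕ → ℕ → Bool
  margin? K n = let W = weights K n candidates ; D = K ∸ W ; B = suc n * (4 * K * 4) ; P = lowerProduct (2 + n) allCandidates in
    (W ℕ.<ᵇ K) ∧ ((101 * (B * B) ℕ.<ᵇ 100 * (D * D) * 70001) ∨ ((101 * (B * B)) * (101 * (B * B)) ℕ.≤ᵇ (100 * (D * D)) * (100 * (D * D)) * P))

  margin-sound : ∀ K n → margin? K n ≡ true → Margin K n
  margin-sound K n eq with Equivalence.to T-∧ (Equivalence.from T-≡ eq)
  ... | W<K , rest = record
    { D = K ∸ weights K n candidates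
    ; split = sym (ℕₚ.m+[n∸m]≡n (ℕₚ.<⇒≤ (ℕₚ.<ᵇ⇒< (weights K n candidates) K W<K)))
    ; D>0 = ℕₚ.m<n⇒0<n∸m (ℕₚ.<ᵇ⇒< (weights K n candidates) K W<K)
    ; large = Sum.map (ℕₚ.<ᵇ⇒< _ _) (ℕₚ.≤ᵇ⇒≤ _ _) (Equivalence.to T-∨ rest) }

  abstract
    -- n < 18 means fewer than twenty primes in all. K = 10000 is the denominator in which the
    -- reciprocals are rounded up; it is hidden with the proof and stays an opaque number
    -- afterwards.
    margins : ∃ λ K → ∀ n → n < 18 → Margin K n
    margins = 10000 , λ n n<18 → margin-sound 10000 n (subst (λ z → margin? 10000 z ≡ true) (ℕₚ.+-identityʳ n) (checkAll-sound (margin? 10000) 18 0 refl n n<18))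

  product-∣ : ∀ {n} ps → All Prime ps → AllPairs _<_ ps → All (_∣ n) ps → product ps ∣ n
  product-∣ [] _ _ _ = 1∣ _
  product-∣ (p ∷ ps) (pp ∷ primes) (p<ps ∷ sorted) (p∣n ∷ ps∣n) = coprime-*∣ (coprime-product ps primes p<ps) p∣n (product-∣ ps primes sorted ps∣n)
    where
    coprime-product : ∀ ps → All Prime ps → All (p <_) ps → Coprime p (product ps)
    coprime-product [] _ _ = Coprime.sym (Coprime.1-coprimeTo p)
    coprime-product (p′ ∷ ps) (pp′ ∷ primes) (p<p′ ∷ p<ps) =
      coprime-* (distinct-primes-coprime pp pp′ (ℕₚ.<⇒≢ p<p′)) (coprime-product ps primes p<ps)

  -- With s = u + 1, 100s² exceeds 100u² by 200u + 100 ≤ 201u ≤ u², since u ≥ 201.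
  root-bound : ∀ {q s} → 70001 ≤ q → q ≤ s * s → (s ∸ 1) * (s ∸ 1) ≤ q → 100 * (s * s) ≤ 101 * q
  root-bound {q} {zero} 70001≤q q≤ _ = contradiction (ℕₚ.≤-trans 70001≤q q≤) λ ()
  root-bound {q} {suc u} 70001≤q q≤ u²≤q = begin
    100 * (suc u * suc u)              ≡⟨ expand u ⟩
    100 * (u * u) + (200 * u + 100)    ≤⟨ ℕₚ.+-monoʳ-≤ (100 * (u * u)) (ℕₚ.≤-trans (ℕₚ.+-monoʳ-≤ (200 * u) 100≤u) (ℕₚ.≤-trans (ℕₚ.≤-reflexive (collect u)) (ℕₚ.*-monoˡ-≤ u 201≤u))) ⟩
    100 * (u * u) + u * u              ≡⟨ total u ⟩
    101 * (u * u)                      ≤⟨ ℕₚ.*-monoʳ-≤ 101 u²≤q ⟩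
    101 * q                            ∎
    where
    open ℕₚ.≤-Reasoning
    expand : ∀ u → 100 * ((1 + u) * (1 + u)) ≡ 100 * (u * u) + (200 * u + 100)
    expand = solve-∀
    collect : ∀ u → 200 * u + u ≡ 201 * u
    collect = solve-∀
    total : ∀ u → 100 * (u * u) + u * u ≡ 101 * (u * u)
    total = solve-∀
    201≤u : 201 ≤ u
    201≤u = ℕₚ.≮⇒≥ λ u<201 → ℕₚ.<⇒≱ (<ᵇ-true {201 * 201} {70001} refl)
      (ℕₚ.≤-trans (ℕₚ.≤-trans 70001≤q q≤) (ℕₚ.*-mono-≤ u<201 u<201))
    100≤u : 100 ≤ u
    100≤u = ℕₚ.≤-trans (ℕₚ.≤ᵇ⇒≤ 100 201 _) 201≤u

  -- The second alternative of `Sufficient` for an empty sieve, with c and e for 101 and 100. The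
  -- products by 1 are kept in the shape in which K = D = 1 produces them.
  EnoughWith : ℕ → ℕ → ℕ → ℕ → Set
  EnoughWith c e W P = let B = 1 * (4 * 1 * W) in (c * (B * B)) * (c * (B * B)) ≤ (e * (1 * 1)) * (e * (1 * 1)) * P

  -- The left side is a multiple of W⁴ and each further prime doubles W, so it grows by exactly 16
  -- per prime. This is the origin of the lower bound 16 beyond the candidates.
  enough-from : ∀ c e n m p → (c * ((4 * 2 ^ n) * (4 * 2 ^ n))) * (c * ((4 * 2 ^ n) * (4 * 2 ^ n))) ≤ e * e * p →
                EnoughWith c e (2 ^ (n + m)) (p * 16 ^ m)
  enough-from c e n m p le = subst₂ (EnoughWith c e) (sym (ℕₚ.^-distribˡ-+-* 2 n m)) (cong (p *_) (sym 16^m))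
    (subst₂ _≤_ (left c (2 ^ n) (2 ^ m)) (right e p ((2 ^ m * 2 ^ m) * (2 ^ m * 2 ^ m)))
      (ℕₚ.*-monoˡ-≤ ((2 ^ m * 2 ^ m) * (2 ^ m * 2 ^ m)) le))
    where
    16^m : 16 ^ m ≡ (2 ^ m * 2 ^ m) * (2 ^ m * 2 ^ m)
    16^m = trans (ℕₚ.^-*-assoc 2 4 m) (trans (cong (2 ^_) (regroup m)) (trans (ℕₚ.^-distribˡ-+-* 2 (m + m) (m + m)) (cong₂ _*_ (ℕₚ.^-distribˡ-+-* 2 m m) (ℕₚ.^-distribˡ-+-* 2 m m))))
      where
      regroup : ∀ m → 4 * m ≡ (m + m) + (m + m)
      regroup = solve-∀
    left : ∀ c b t → (c * ((4 * b) * (4 * b))) * (c * ((4 * b) * (4 * b))) * ((t * t) * (t * t)) ≡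
      (c * ((1 * (4 * 1 * (b * t))) * (1 * (4 * 1 * (b * t))))) * (c * ((1 * (4 * 1 * (b * t))) * (1 * (4 * 1 * (b * t)))))
    left = solve-∀
    right : ∀ e p u → e * e * p * u ≡ (e * (1 * 1)) * (e * (1 * 1)) * (p * u)
    right = solve-∀

  enough-beyond : ∀ c e cs m → (c * ((4 * 2 ^ length cs) * (4 * 2 ^ length cs))) * (c * ((4 * 2 ^ length cs) * (4 * 2 ^ length cs))) ≤ e * e * product cs →
                  EnoughWith c e (2 ^ (length cs + m)) (lowerProduct (length cs + m) cs)
  enough-beyond c e cs m le = subst (EnoughWith c e (2 ^ (length cs + m))) (sym (lowerProduct-beyond cs m)) (enough-from c e (length cs) m (product cs) le)

  abstract
    enough : ∀ k → length allCandidates ≤ k → Sufficient 1 (1 * (4 * 1 * 2 ^ k)) (lowerProduct k allCandidates)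
    enough k le = subst (λ k → Sufficient 1 (1 * (4 * 1 * 2 ^ k)) (lowerProduct k allCandidates)) (ℕₚ.m+[n∸m]≡n le)
      (inj₂ (enough-beyond 101 100 allCandidates (k ∸ length allCandidates) (ℕₚ.≤ᵇ⇒≤ _ _ _)))

    -- The product bound 0 rules out the second alternative: for at most one odd prime, q ≥ 70001
    -- alone suffices.
    few-enough : ∀ k → k ≤ 1 → Sufficient 1 (1 * (4 * 1 * 2 ^ k)) 0
    few-enough 0 _ = inj₁ (ℕₚ.<ᵇ⇒< _ _ _)
    few-enough 1 _ = inj₁ (ℕₚ.<ᵇ⇒< _ _ _)
    few-enough (suc (suc k)) (s≤s ())

  module _ (h : ℕ) (L : LineLogs (h * 2)) (cofactor-e : ∀ p → Prime p → p ∣ h * 2 → ¬ p ∣ _∣_.quotient (LineLogs.q+1∣e L)) where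
    open LineLogs L

    private
      Wanted : ℕ → Set
      Wanted p = Prime p × (¬ p ≡ 2) × (p ∣ n)

      wanted? : ∀ p → Dec (Wanted p)
      wanted? p = prime? p ×-dec ¬? (p ℕₚ.≟ 2) ×-dec (p ∣? n)

      ps : List ℕ
      ps = filter wanted? (upTo (suc n))

      n>0 : 0 < n
      n>0 = ℕₚ.*-mono-≤ r>0 (s≤s (z≤n {suc (h * 2)}))

      ps-wanted : All Wanted ps
      ps-wanted = Allₚ.all-filter wanted? (upTo (suc n))

      ps-sorted : AllPairs _<_ ps
      ps-sorted = AllPairsₚ.filter⁺ wanted? (AllPairsₚ.applyUpTo⁺₁ id (suc n) (λ i<j _ → i<j))

      ps-complete : ∀ {p} → Wanted p → p ∈ ps
      ps-complete {p} w@(_ , _ , p∣n) = ∈-filter⁺ wanted? (∈-upTo⁺ (s≤s (∣⇒≤ {{ℕ.>-nonZero n>0}} p∣n))) w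

      n<q² : n < q * q
      n<q² = ℕₚ.≤-reflexive (cong suc (ℕₚ.*-suc (h * 2) (suc (h * 2))))

      3≤ : ∀ {p} → Wanted p → 2 < p
      3≤ (pp , p≢2 , _) = ℕₚ.≤∧≢⇒< (1<prime pp) (p≢2 ∘ sym)

      ps-dominated : ∀ {qs} → All Wanted qs → AllPairs _<_ qs → Dominated qs allCandidates
      ps-dominated ws sorted = dominated _ candidates-consecutive (All.map proj₁ ws) (All.map 3≤ ws) sorted

      product<q² : ∀ {qs} → All Wanted qs → AllPairs _<_ qs → product qs < q * q
      product<q² {qs} ws sorted = ℕₚ.≤-<-trans (∣⇒≤ {{ℕ.>-nonZero n>0}} (product-∣ qs (All.map proj₁ ws) sorted (All.map (proj₂ ∘ proj₂) ws))) n<q²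

      finish : ∀ ys ℓs → (∀ p → Wanted p → p ∈ ys ⊎ p ∈ ℓs) →
               (∃ λ x → TwoPart true (a x) × (∀ ℓ → ℓ ∈ ys ⊎ ℓ ∈ ℓs → ¬ ℓ ∣ a x)) → GoodPoint h L cofactor-e
      finish ys ℓs covers (x , two , avoided) = x , two , λ p pp p≢2 side → avoided p (covers p (pp , p≢2 , divides-n side))
        where
        divides-n : ∀ {p} → p ∣ h * 2 ⊎ p ∣ suc q → p ∣ n
        divides-n (inj₁ p∣r) = ∣-trans p∣r (m∣m*n (suc q))
        divides-n (inj₂ p∣q+1) = ∣-trans p∣q+1 (n∣m*n (h * 2))

    module _ (70001≤q : 70001 ≤ q) where
      private
        s = proj₁ (ceil-sqrt q)
        q≤s² : q ≤ s * s
        q≤s² = proj₁ (proj₂ (ceil-sqrt q))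
        s² : 100 * (s * s) ≤ 101 * q
        s² = root-bound {q} {s} 70001≤q q≤s² (proj₂ (proj₂ (ceil-sqrt q)))
        s>0 : 0 < s
        s>0 = ℕₚ.n≢0⇒n>0 (λ s≡0 → ℕₚ.<⇒≱ (ℕₚ.≤-trans (s≤s z≤n) 70001≤q) (subst (λ z → q ≤ z * z) s≡0 q≤s²))

        odd-prime : ∀ {K p} → Wanted p → Large.OddPrime K h L cofactor-e s s>0 q≤s² p
        odd-prime (pp , p≢2 , p∣n) with euclidsLemma (h * 2) (suc q) pp p∣n
        ... | inj₁ p∣r = inj₁ (pp , p≢2 , p∣r)
        ... | inj₂ p∣q+1 = inj₂ (pp , p≢2 , p∣q+1)

        core-only : ∀ {P} qs → All Wanted qs → AllPairs _<_ qs → (∀ p → Wanted p → p ∈ qs) → P < q * q →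
          Sufficient 1 (1 * (4 * 1 * 2 ^ length qs)) P → GoodPoint h L cofactor-e
        core-only {P} qs ws sorted covers P<q² cond = finish qs [] (λ p w → inj₁ (covers p w))
          (Large.Core.found 1 h L cofactor-e s s>0 q≤s² qs (All.map (odd-prime {1}) ws) (AllPairs.map ℕₚ.<⇒≢ sorted)
            Large.Core.[] (sufficient {q} {s} {1} {1 * (4 * 1 * 2 ^ length qs)} {P} 70001≤q s² P<q² (s≤s z≤n) cond))

      large-search : GoodPoint h L cofactor-e
      large-search = by ps ps-wanted ps-sorted (λ p w → ps-complete w)
        where
        by : ∀ qs → All Wanted qs → AllPairs _<_ qs → (∀ p → Wanted p → p ∈ qs) → GoodPoint h L cofactor-e
        by [] ws sorted covers = core-only {0} [] ws sorted covers (ℕₚ.≤-<-trans z≤n n<q²) (few-enough 0 z≤n)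
        by (p ∷ []) ws sorted covers = core-only {0} (p ∷ []) ws sorted covers (ℕₚ.≤-<-trans z≤n n<q²) (few-enough 1 (s≤s z≤n))
        by qs@(p₁ ∷ p₂ ∷ ℓs) ws@(w₁ ∷ w₂ ∷ ws′) sorted@((p₁<p₂ ∷ p₁<ℓs) ∷ p₂<ℓs ∷ sorted′) covers = cases (length qs ℕₚ.<? length allCandidates)
          where
          -- The core takes the two smallest primes, so the sieved ones are compared with 7, 11, 13,
          -- ... and the largest reciprocals stay out of the sieve.
          dom : Dominated ℓs candidates
          dom = tail (ps-dominated ws sorted)
            where
            tail : Dominated qs allCandidates → Dominated ℓs candidates
            tail (next _ _ (next _ _ d)) = d
          cases : Dec (length qs < length allCandidates) → GoodPoint h L cofactor-e
          cases (yes few) = finish (p₁ ∷ p₂ ∷ []) ℓs (λ p w → locate (covers p w))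
            (Large.Core.found K h L cofactor-e s s>0 q≤s² (p₁ ∷ p₂ ∷ []) (odd-prime {K} w₁ ∷ odd-prime {K} w₂ ∷ [])
              ((ℕₚ.<⇒≢ p₁<p₂ ∷ []) ∷ [] ∷ []) (weighted ws′ p₁<ℓs p₂<ℓs dom)
              (subst (weights K (length ℓs) candidates * q + (suc (length ℓs) * (4 * K * 4)) * s <_)
                (trans (sym (ℕₚ.*-distribʳ-+ q (weights K (length ℓs) candidates) D)) (cong (_* q) (sym split)))
                (ℕₚ.+-monoʳ-< (weights K (length ℓs) candidates * q) (sufficient {q} {s} {D} {suc (length ℓs) * (4 * K * 4)} {lowerProduct (2 + length ℓs) allCandidates} 70001≤q s² P<q² D>0 large))))
            where
            K = proj₁ margins
            open Margin (proj₂ margins (length ℓs) (ℕₚ.≤-pred (ℕₚ.≤-pred few)))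
            P<q² : lowerProduct (2 + length ℓs) allCandidates < q * q
            P<q² = ℕₚ.≤-<-trans (lowerProduct-≤ (ps-dominated ws sorted)) (product<q² ws sorted)
            locate : ∀ {p} → p ∈ qs → p ∈ p₁ ∷ p₂ ∷ [] ⊎ p ∈ ℓs
            locate (here eq) = inj₁ (here eq)
            locate (there (here eq)) = inj₁ (there (here eq))
            locate (there (there p∈)) = inj₂ p∈
            open Large.Core K h L cofactor-e s s>0 q≤s² (p₁ ∷ p₂ ∷ []) (odd-prime {K} w₁ ∷ odd-prime {K} w₂ ∷ []) ((ℕₚ.<⇒≢ p₁<p₂ ∷ []) ∷ [] ∷ []) using (Weighted; []; cons)
            differs : ∀ {m} → p₁ < m → p₂ < m → All (λ y → ¬ m ≡ y) (p₁ ∷ p₂ ∷ [])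
            differs p₁<m p₂<m = (ℕₚ.<⇒≢ p₁<m ∘ sym) ∷ (ℕₚ.<⇒≢ p₂<m ∘ sym) ∷ []
            weighted : ∀ {cs ms} → All Wanted ms → All (p₁ <_) ms → All (p₂ <_) ms → Dominated ms cs → Weighted ms (weights K (length ms) cs)
            weighted _ _ _ done = []
            weighted (w ∷ ws) (p₁<m ∷ p₁<ms) (p₂<m ∷ p₂<ms) (next {c = c} c>0 c≤m d) =
              cons {w = weight K c} (odd-prime {K} w) (differs p₁<m p₂<m) (weight-≤ K c c>0 c≤m) (weighted ws p₁<ms p₂<ms d)
            weighted (w ∷ ws) (p₁<m ∷ p₁<ms) (p₂<m ∷ p₂<ms) (beyond 16≤m d) =
              cons {w = weight K 16} (odd-prime {K} w) (differs p₁<m p₂<m) (weight-≤ K 16 (s≤s z≤n) 16≤m) (weighted ws p₁<ms p₂<ms d)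
          cases (no many) = core-only {P} qs ws sorted covers (ℕₚ.≤-<-trans (lowerProduct-≤ (ps-dominated ws sorted)) (product<q² ws sorted))
            (enough (length qs) (ℕₚ.≮⇒≥ many))
            where
            P = lowerProduct (length qs) allCandidates

-- The theorem, from the two ranges of q.

open import Defs
open import Level using (0ℓ)
open import Data.Nat using (ℕ; _*_; _<_)
open import Data.Product using (_×_)
open import Data.List.Membership.Propositional using (_∈_)
open import Relation.Nullary using (¬_)
open import Algebra.Bundles using (CommutativeRing)
open import Data.Nat as ℕ using (suc; _≤_; _^_; s≤s; z≤n)
open import Relation.Binary.PropositionalEquality using (_≡_; refl; trans; cong; subst)
open Lines
open Arith
open Setup
open Search using (GoodPoint; finite-search)
open Threshold using (large-search)

odd-decomposition : ∀ q → ¬ 2 ∣ q → ∃ λ h → q ≡ suc (h * 2)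
odd-decomposition q 2∤q = q / 2 , trans (m≡m%n+[m/n]*n q 2) (cong (ℕ._+ q / 2 * 2) (by (q % 2) refl (m%n<n q 2)))
  where
  by : ∀ k → q % 2 ≡ k → k < 2 → k ≡ 1
  by 0 eq _ = contradiction (m%n≡0⇒n∣m q 2 eq) 2∤q
  by 1 _ _ = refl
  by (suc (suc _)) _ (s≤s (s≤s ()))

good-point : ∀ h {p k} → Prime p → suc (h * 2) ≡ p ^ k → ¬ suc (h * 2) ∈ excluded →
             (L : LineLogs (h * 2)) (c : ∀ p → Prime p → p ∣ h * 2 → ¬ p ∣ _∣_.quotient (LineLogs.q+1∣e L)) → GoodPoint h L c
-- The bound on h separates q ≤ 69999 from q ≥ 70001.
good-point h {p} {k} pp q≡ ∉excluded L c with h ℕₚ.<? 35000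
... | yes h< = finite-search h L c (h>0 h (LineLogs.r>0 L)) h< {p} {k} pp q≡ ∉excluded
  where
  h>0 : ∀ h → 0 < h * 2 → 0 < h
  h>0 (suc h) _ = s≤s z≤n
... | no h≮ = large-search h L c (s≤s (ℕₚ.*-monoˡ-≤ 2 (ℕₚ.≮⇒≥ h≮)))

line-property : ∀ h {p k} → Prime p → suc (h * 2) ≡ p ^ k → ¬ suc (h * 2) ∈ excluded →
  (K L : CommutativeRing 0ℓ 0ℓ) → IsFiniteField K (suc (h * 2)) → IsFiniteField L (suc (h * 2) * suc (h * 2)) →
  (ι : CommutativeRing.Carrier K → CommutativeRing.Carrier L) → IsEmbedding K L ι → LineProperty2 K L (suc (h * 2)) ι
line-property h {p} {k} pp q≡ ∉excluded K L fieldK fieldL ι embedding α θ α≉0 θ∉K = conclude (good-point h {p} {k} pp q≡ ∉excluded logs e-cofactor)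
  where
  open Line K L (h * 2) fieldK fieldL ι embedding α θ α≉0 θ∉K using (logs; e-cofactor; two-primitive; N≡n)
  conclude : GoodPoint h logs e-cofactor → ∃ λ x → TwoPrimitive L (suc (h * 2)) (CommutativeRing._*_ L α (CommutativeRing._+_ L θ (ι x)))
  conclude (x , two , avoids) = IsFiniteField.enum fieldK x , two-primitive x (n∣m*n h) two
    (λ p pp p≢2 p∣N → avoids p pp p≢2 (euclidsLemma (h * 2) _ pp (subst (p ∣_) N≡n p∣N)))

theorem6 : (∀ (q : ℕ) → OddPrimePower q → ¬ (q ∈ excluded) →
    (K L : CommutativeRing 0ℓ 0ℓ) → IsFiniteField K q → IsFiniteField L (q * q) →
    (ι : CommutativeRing.Carrier K → CommutativeRing.Carrier L) → IsEmbedding K L ι →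
    LineProperty2 K L q ι)
    × (∀ (q : ℕ) → OddPrimePower q → 3541 < q →
    (K L : CommutativeRing 0ℓ 0ℓ) → IsFiniteField K q → IsFiniteField L (q * q) →
    (ι : CommutativeRing.Carrier K → CommutativeRing.Carrier L) → IsEmbedding K L ι →
    LineProperty2 K L q ι)
theorem6 = outside , λ q odd 3541<q → outside q odd (λ q∈ → ℕₚ.<⇒≱ 3541<q (All.lookup excluded-≤ q∈))
  where
  excluded-≤ : All (_≤ 3541) excluded
  excluded-≤ = from-yes (All.all? (ℕₚ._≤? 3541) excluded)
  outside : ∀ q → OddPrimePower q → ¬ (q ∈ excluded) →
    (K L : CommutativeRing 0ℓ 0ℓ) → IsFiniteField K q → IsFiniteField L (q * q) →
    (ι : CommutativeRing.Carrier K → CommutativeRing.Carrier L) → IsEmbedding K L ι → LineProperty2 K L q ι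
  outside q (p , k , pp , 2∤p , _ , q≡) ∉excluded = by (odd-decomposition q (λ 2∣q → 2∤p (prime-∣^ k prime[2] (subst (2 ∣_) q≡ 2∣q))))
    where
    by : (∃ λ h → q ≡ suc (h * 2)) → (K L : CommutativeRing 0ℓ 0ℓ) → IsFiniteField K q → IsFiniteField L (q * q) →
      (ι : CommutativeRing.Carrier K → CommutativeRing.Carrier L) → IsEmbedding K L ι → LineProperty2 K L q ι
    by (h , refl) = line-property h {p} {k} pp q≡ ∉excluded
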